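{- Let $n \ge 1$ be an integer, and let $x, y \in (0,1)$ with $x \le y$. Then $$\prod_{k \in \mathbb{Z}} \left(\frac{y^n + k^n}{x^n + k^n}\right)^2 = \prod_{k=1}^{n} \frac{\cosh\left(2\pi y \sin\left(\frac{(2k-1)\pi}{n}\right)\right) - \cos\left(2\pi y \cos\left(\frac{(2k-1)\pi}{n}\right)\right)}{\cosh\left(2\pi x \sin\left(\frac{(2k-1)\pi}{n}\right)\right) - \cos\left(2\pi x \cos\left(\frac{(2k-1)\pi}{n}\right)\right)}.$$
   Context: The infinite product over $k \in \mathbb{Z}$ is understood as the limit of symmetric partial products, $\prod_{k\in\mathbb{Z}} c_k = \lim_{N\to\infty} \prod_{k=-N}^{N} c_k$ (this matters only for $n=1$). -}

module Defs where

open import Data.Empty using (⊥-elim)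
open import Data.Fin using (Fin; toℕ)
open import Data.Integer as ℤ using (ℤ; +_; -[1+_])
import Data.Integer.Properties as ℤP
open import Data.Nat as ℕ using (ℕ; zero; suc; NonZero)
import Data.Nat.Properties as ℕP
open import Data.Product using (Σ; ∃-syntax; _×_; _,_; proj₁; proj₂)
open import Data.Rational as Q using (ℚ; 0ℚ; 1ℚ; ½; mkℚ)
import Data.Rational.Properties as ℚP
import Data.Rational.Unnormalised as ℚᵘ
import Data.Rational.Unnormalised.Properties as ℚᵘP
open import Data.Rational.Solver using (module +-*-Solver)
open import Data.Sum using (_⊎_; inj₁; inj₂)
open import Data.Vec.Functional using (Vector; foldr)
open import Relation.Binary.PropositionalEquality
  using (_≡_; refl; sym; trans; cong; cong₂; subst)
open import Relation.Nullary using (¬_; yes; no)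

------------------------------------------------------------------------
-- Cauchy sequences of rationals and power series

module Sequences where
  open Q using (_+_; _*_; _-_; -_; _≤_; _<_; ∣_∣)
  open +-*-Solver using (solve; _:+_; _:*_; _:-_; :-_; _:=_; con)

  Cauchy : (ℕ → ℚ) → Set
  Cauchy s = ∀ ε → 0ℚ < ε →
    ∃[ N ] ∀ m n → N ℕ.≤ m → N ℕ.≤ n → ∣ s m - s n ∣ < ε

  -- The value at 0 is a placeholder: a real number apart from 0 has only
  -- finitely many vanishing terms.
  recip : ℚ → ℚ
  recip q with q ℚP.≟ 0ℚ
  ... | yes _  = 0ℚ
  ... | no q≢0 = (Q.1/ q) {{Q.≢-nonZero q≢0}}

  Σ< : ℕ → (ℕ → ℚ) → ℚ
  Σ< zero    f = 0ℚ
  Σ< (suc n) f = Σ< n f + f n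

  -- a ^ k / k !
  expTerm : ℚ → ℕ → ℚ
  expTerm a zero    = 1ℚ
  expTerm a (suc k) = expTerm a k * a * (+ 1 Q./ suc k)

  -- (- 1) ^ k
  sign : ℕ → ℚ
  sign zero    = 1ℚ
  sign (suc k) = - sign k

  leibnizSum : ℕ → ℚ
  leibnizSum n = Σ< n (λ k → sign k * (+ 1 Q./ suc (2 ℕ.* k)))

  private
    0≤½ : 0ℚ ≤ ½
    0≤½ = ℚP.nonNegative⁻¹ ½

    *-monoˡ : ∀ {a b} c → 0ℚ ≤ c → a ≤ b → a * c ≤ b * c
    *-monoˡ c 0≤c = ℚP.*-monoʳ-≤-nonNeg c {{Q.nonNegative 0≤c}}

    *-monoʳ : ∀ {a b} c → 0ℚ ≤ c → a ≤ b → c * a ≤ c * b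
    *-monoʳ c 0≤c = ℚP.*-monoˡ-≤-nonNeg c {{Q.nonNegative 0≤c}}

    *-mono : ∀ {a b c d} → 0ℚ ≤ a → 0ℚ ≤ d → a ≤ b → c ≤ d → a * c ≤ b * d
    *-mono {a} {b} {c} {d} 0≤a 0≤d a≤b c≤d =
      ℚP.≤-trans (*-monoʳ a 0≤a c≤d) (*-monoˡ d 0≤d a≤b)

    *-nonNeg : ∀ {a b} → 0ℚ ≤ a → 0ℚ ≤ b → 0ℚ ≤ a * b
    *-nonNeg {a} {b} 0≤a 0≤b =
      subst (_≤ a * b) (ℚP.*-zeroˡ b) (*-monoˡ b 0≤b 0≤a)

    *-pos : ∀ {a b} → 0ℚ < a → 0ℚ < b → 0ℚ < a * b
    *-pos {a} {b} 0<a 0<b =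
      subst (_< a * b) (ℚP.*-zeroˡ b) (ℚP.*-monoˡ-<-pos b {{Q.positive 0<b}} 0<a)

    half-pos : ∀ {ε} → 0ℚ < ε → 0ℚ < ½ * ε
    half-pos = *-pos (ℚP.positive⁻¹ ½)

    halves : ∀ ε → ½ * ε + ½ * ε ≡ ε
    halves = solve 1 (λ e → con ½ :* e :+ con ½ :* e := e) refl

    ∣p-q∣≡∣q-p∣ : ∀ p q → ∣ p - q ∣ ≡ ∣ q - p ∣
    ∣p-q∣≡∣q-p∣ p q = trans (cong ∣_∣ (neg p q)) (ℚP.∣-p∣≡∣p∣ (q - p))
      where
      neg : ∀ p q → p - q ≡ - (q - p)
      neg = solve 2 (λ p q → p :- q := :- (q :- p)) refl

    triangle : ∀ p q r → ∣ p - r ∣ ≤ ∣ p - q ∣ + ∣ q - r ∣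
    triangle p q r =
      subst (λ z → ∣ z ∣ ≤ ∣ p - q ∣ + ∣ q - r ∣) (telescope p q r)
            (ℚP.∣p+q∣≤∣p∣+∣q∣ (p - q) (q - r))
      where
      telescope : ∀ p q r → (p - q) + (q - r) ≡ p - r
      telescope = solve 3 (λ p q r → (p :- q) :+ (q :- r) := p :- r) refl

    -- The positive unit fractions tend to zero.

    unit-pos : ∀ k → 0ℚ < + 1 Q./ suc k
    unit-pos k = ℚP.positive⁻¹ _ {{ℚP.normalize-pos 1 (suc k)}}

    toℚᵘ-/ : ∀ i k → Q.toℚᵘ (i Q./ suc k) ℚᵘ.≃ ℚᵘ.mkℚᵘ i k
    toℚᵘ-/ i k = ℚP.toℚᵘ-fromℚᵘ (ℚᵘ.mkℚᵘ i k)

    unit-anti : ∀ {j k} → j ℕ.≤ k → + 1 Q./ suc k ≤ + 1 Q./ suc j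
    unit-anti {j} {k} j≤k = ℚP.toℚᵘ-cancel-≤
      (ℚᵘP.≤-respˡ-≃ (ℚᵘP.≃-sym (toℚᵘ-/ (+ 1) k))
        (ℚᵘP.≤-respʳ-≃ (ℚᵘP.≃-sym (toℚᵘ-/ (+ 1) j))
          (ℚᵘ.*≤* (ℤP.*-monoˡ-≤-nonNeg (+ 1) (ℤ.+≤+ (ℕ.s≤s j≤k))))))

    unit-small : ∀ ε → 0ℚ < ε → ∃[ N ] ∀ k → N ℕ.≤ k → + 1 Q./ suc k < ε
    unit-small (mkℚ (+ zero) d c) (Q.*<* (ℤ.+<+ ()))
    unit-small (mkℚ -[1+ a ] d c) (Q.*<* ())
    unit-small (mkℚ (+ suc a) d c) _ = suc d , λ k d<k → ℚP.toℚᵘ-cancel-<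
      (ℚᵘP.<-respˡ-≃ (ℚᵘP.≃-sym (toℚᵘ-/ (+ 1) k))
        (ℚᵘ.*<* (ℤ.+<+ (bound k d<k))))
      where
      bound : ∀ k → d ℕ.< k → suc (d ℕ.+ 0) ℕ.< suc (k ℕ.+ a ℕ.* suc k)
      bound k d<k rewrite ℕP.+-identityʳ d =
        ℕ.s≤s (ℕP.≤-trans d<k (ℕP.m≤m+n k (a ℕ.* suc k)))

    *-recip : ∀ q → 0ℚ < q → ∃[ r ] (0ℚ < r × q * r ≡ 1ℚ)
    *-recip q 0<q = r , ℚP.positive⁻¹ r {{ℚP.1/pos⇒pos q}} , ℚP.*-inverseʳ q
      where
      instance
        q>0 : Q.Positive q
        q>0 = Q.positive 0<q
        q≢0 : Q.NonZero q
        q≢0 = ℚP.pos⇒nonZero q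
      r : ℚ
      r = Q.1/ q

    small : ∀ C ε → 0ℚ < C → 0ℚ < ε →
            ∃[ N ] ∀ k → N ℕ.≤ k → C * (+ 1 Q./ suc k) < ε
    small C ε 0<C 0<ε with *-recip C 0<C
    ... | r , 0<r , Cr≡1 with unit-small (r * ε) (*-pos 0<r 0<ε)
    ...   | N , below = N , λ k N≤k →
      subst (C * (+ 1 Q./ suc k) <_) cancel
            (ℚP.*-monoʳ-<-pos C {{Q.positive 0<C}} (below k N≤k))
      where
      cancel : C * (r * ε) ≡ ε
      cancel = trans (sym (ℚP.*-assoc C r ε))
                     (trans (cong (_* ε) Cr≡1) (ℚP.*-identityˡ ε))

  -- Closure properties of Cauchy sequences.

  cauchy-const : ∀ q → Cauchy (λ _ → q)
  cauchy-const q ε 0<ε = 0 , λ _ _ _ _ →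
    subst (_< ε) (sym (cong ∣_∣ (ℚP.+-inverseʳ q))) 0<ε

  private
    cauchy-lipschitz : ∀ s t K N → 0ℚ < K →
      (∀ m n → N ℕ.≤ m → N ℕ.≤ n → ∣ t m - t n ∣ ≤ K * ∣ s m - s n ∣) →
      Cauchy s → Cauchy t
    cauchy-lipschitz s t K N 0<K lip cs ε 0<ε with *-recip K 0<K
    ... | r , 0<r , Kr≡1 with cs (r * ε) (*-pos 0<r 0<ε)
    ...   | M , close = N ℕ.⊔ M , λ m n le le′ →
      ℚP.≤-<-trans
        (lip m n (ℕP.m⊔n≤o⇒m≤o N M le) (ℕP.m⊔n≤o⇒m≤o N M le′))
        (subst (K * ∣ s m - s n ∣ <_) cancel
          (ℚP.*-monoʳ-<-pos K {{Q.positive 0<K}}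
            (close m n (ℕP.m⊔n≤o⇒n≤o N M le) (ℕP.m⊔n≤o⇒n≤o N M le′))))
      where
      cancel : K * (r * ε) ≡ ε
      cancel = trans (sym (ℚP.*-assoc K r ε))
                     (trans (cong (_* ε) Kr≡1) (ℚP.*-identityˡ ε))

    cauchy-nonexpansive : ∀ s t → (∀ m n → ∣ t m - t n ∣ ≤ ∣ s m - s n ∣) →
                          Cauchy s → Cauchy t
    cauchy-nonexpansive s t le =
      cauchy-lipschitz s t 1ℚ 0 (ℚP.positive⁻¹ 1ℚ)
        (λ m n _ _ → ℚP.≤-trans (le m n)
          (ℚP.≤-reflexive (sym (ℚP.*-identityˡ ∣ s m - s n ∣))))

  cauchy-neg : ∀ s → Cauchy s → Cauchy (λ n → - s n)
  cauchy-neg s = cauchy-nonexpansive s (λ n → - s n) (λ m n →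
    ℚP.≤-reflexive (trans (cong ∣_∣ (eq (s m) (s n))) (ℚP.∣-p∣≡∣p∣ (s m - s n))))
    where
    eq : ∀ a b → - a - - b ≡ - (a - b)
    eq = solve 2 (λ a b → :- a :- (:- b) := :- (a :- b)) refl

  cauchy-abs : ∀ s → Cauchy s → Cauchy (λ n → ∣ s n ∣)
  cauchy-abs s = cauchy-nonexpansive s (λ n → ∣ s n ∣) (λ m n → reverse (s m) (s n))
    where
    split : ∀ a b → ∣ a ∣ - ∣ b ∣ ≤ ∣ a - b ∣
    split a b = ℚP.≤-trans
      (ℚP.+-monoˡ-≤ (- ∣ b ∣)
        (subst (λ z → ∣ z ∣ ≤ ∣ a - b ∣ + ∣ b ∣) (re a b)
               (ℚP.∣p+q∣≤∣p∣+∣q∣ (a - b) b)))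
      (ℚP.≤-reflexive (re′ ∣ a - b ∣ ∣ b ∣))
      where
      re : ∀ a b → (a - b) + b ≡ a
      re = solve 2 (λ a b → (a :- b) :+ b := a) refl
      re′ : ∀ a b → (a + b) - b ≡ a
      re′ = solve 2 (λ a b → (a :+ b) :- b := a) refl
    reverse : ∀ a b → ∣ ∣ a ∣ - ∣ b ∣ ∣ ≤ ∣ a - b ∣
    reverse a b with ℚP.∣p∣≡p∨∣p∣≡-p (∣ a ∣ - ∣ b ∣)
    ... | inj₁ eq = subst (_≤ ∣ a - b ∣) (sym eq) (split a b)
    ... | inj₂ eq = subst (_≤ ∣ a - b ∣) (sym (trans eq (flip ∣ a ∣ ∣ b ∣)))
                      (subst (∣ b ∣ - ∣ a ∣ ≤_) (∣p-q∣≡∣q-p∣ b a) (split b a))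
      where
      flip : ∀ a b → - (a - b) ≡ b - a
      flip = solve 2 (λ a b → :- (a :- b) := b :- a) refl

  cauchy-+ : ∀ s t → Cauchy s → Cauchy t → Cauchy (λ n → s n + t n)
  cauchy-+ s t cs ct ε 0<ε
    with cs (½ * ε) (half-pos 0<ε) | ct (½ * ε) (half-pos 0<ε)
  ... | N , f | M , g = N ℕ.⊔ M , λ m n le le′ →
    ℚP.≤-<-trans
      (subst (λ z → ∣ z ∣ ≤ ∣ s m - s n ∣ + ∣ t m - t n ∣)
             (eq (s m) (s n) (t m) (t n))
             (ℚP.∣p+q∣≤∣p∣+∣q∣ (s m - s n) (t m - t n)))
      (subst (∣ s m - s n ∣ + ∣ t m - t n ∣ <_) (halves ε)
        (ℚP.+-mono-<
          (f m n (ℕP.m⊔n≤o⇒m≤o N M le) (ℕP.m⊔n≤o⇒m≤o N M le′))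
          (g m n (ℕP.m⊔n≤o⇒n≤o N M le) (ℕP.m⊔n≤o⇒n≤o N M le′))))
    where
    eq : ∀ a b c d → (a - b) + (c - d) ≡ (a + c) - (b + d)
    eq = solve 4 (λ a b c d → (a :- b) :+ (c :- d) := (a :+ c) :- (b :+ d)) refl

  private
    bounded : ∀ s → Cauchy s →
              ∃[ B ] ∃[ N ] (0ℚ < B × (∀ n → N ℕ.≤ n → ∣ s n ∣ ≤ B))
    bounded s cs with cs 1ℚ (ℚP.positive⁻¹ 1ℚ)
    ... | N , f = 1ℚ + ∣ s N ∣ , N
      , ℚP.+-mono-<-≤ (ℚP.positive⁻¹ 1ℚ) (ℚP.0≤∣p∣ (s N))
      , λ n N≤n → ℚP.≤-trans
          (subst (λ z → ∣ z ∣ ≤ ∣ s n - s N ∣ + ∣ s N ∣) (re (s n) (s N))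
                 (ℚP.∣p+q∣≤∣p∣+∣q∣ (s n - s N) (s N)))
          (ℚP.+-monoˡ-≤ ∣ s N ∣ (ℚP.<⇒≤ (f n N N≤n ℕP.≤-refl)))
      where
      re : ∀ a b → (a - b) + b ≡ a
      re = solve 2 (λ a b → (a :- b) :+ b := a) refl

  private
    *-close : ∀ A B r ε a b c d → 0ℚ < A → 0ℚ < B → (A + B) * r ≡ 1ℚ →
              ∣ a ∣ ≤ A → ∣ d ∣ ≤ B → ∣ a - b ∣ < r * ε → ∣ c - d ∣ < r * ε →
              ∣ a * c - b * d ∣ < ε
    *-close A B r ε a b c d 0<A 0<B r-eq a≤A d≤B ab cd = begin-strict
      ∣ a * c - b * d ∣                      ≡⟨ cong ∣_∣ (expand a b c d) ⟩
      ∣ a * (c - d) + d * (a - b) ∣          ≤⟨ ℚP.∣p+q∣≤∣p∣+∣q∣ (a * (c - d)) (d * (a - b)) ⟩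
      ∣ a * (c - d) ∣ + ∣ d * (a - b) ∣      ≡⟨ cong₂ _+_ (ℚP.∣p*q∣≡∣p∣*∣q∣ a (c - d))
                                                          (ℚP.∣p*q∣≡∣p∣*∣q∣ d (a - b)) ⟩
      ∣ a ∣ * ∣ c - d ∣ + ∣ d ∣ * ∣ a - b ∣  ≤⟨ ℚP.+-mono-≤
                                                  (*-monoˡ ∣ c - d ∣ (ℚP.0≤∣p∣ (c - d)) a≤A)
                                                  (*-monoˡ ∣ a - b ∣ (ℚP.0≤∣p∣ (a - b)) d≤B) ⟩
      A * ∣ c - d ∣ + B * ∣ a - b ∣          <⟨ ℚP.+-mono-<
                                                  (ℚP.*-monoʳ-<-pos A {{Q.positive 0<A}} cd)
                                                  (ℚP.*-monoʳ-<-pos B {{Q.positive 0<B}} ab) ⟩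
      A * (r * ε) + B * (r * ε)              ≡⟨ distribute A B r ε ⟩
      (A + B) * r * ε                        ≡⟨ cong (_* ε) r-eq ⟩
      1ℚ * ε                                 ≡⟨ ℚP.*-identityˡ ε ⟩
      ε                                      ∎
      where
      open ℚP.≤-Reasoning
      expand : ∀ a b c d → a * c - b * d ≡ a * (c - d) + d * (a - b)
      expand = solve 4 (λ a b c d →
        a :* c :- b :* d := a :* (c :- d) :+ d :* (a :- b)) refl
      distribute : ∀ a b r e → a * (r * e) + b * (r * e) ≡ (a + b) * r * e
      distribute = solve 4 (λ a b r e →
        a :* (r :* e) :+ b :* (r :* e) := (a :+ b) :* r :* e) refl

  cauchy-* : ∀ s t → Cauchy s → Cauchy t → Cauchy (λ n → s n * t n)
  cauchy-* s t cs ct ε 0<ε = N₁ ℕ.⊔ N₂ ℕ.⊔ (M₁ ℕ.⊔ M₂) , λ m n le le′ →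
    *-close A B r ε (s m) (s n) (t m) (t n) 0<A 0<B r-eq
      (s≤A m (ℕP.m⊔n≤o⇒m≤o N₁ N₂ (N≤ m le)))
      (t≤B n (ℕP.m⊔n≤o⇒n≤o N₁ N₂ (N≤ n le′)))
      (f m n (ℕP.m⊔n≤o⇒m≤o M₁ M₂ (M≤ m le)) (ℕP.m⊔n≤o⇒m≤o M₁ M₂ (M≤ n le′)))
      (g m n (ℕP.m⊔n≤o⇒n≤o M₁ M₂ (M≤ m le)) (ℕP.m⊔n≤o⇒n≤o M₁ M₂ (M≤ n le′)))
    where
    open Σ (bounded s cs) renaming (proj₁ to A; proj₂ to A-bound)
    open Σ A-bound renaming (proj₁ to N₁; proj₂ to A-props)
    open Σ A-props renaming (proj₁ to 0<A; proj₂ to s≤A)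
    open Σ (bounded t ct) renaming (proj₁ to B; proj₂ to B-bound)
    open Σ B-bound renaming (proj₁ to N₂; proj₂ to B-props)
    open Σ B-props renaming (proj₁ to 0<B; proj₂ to t≤B)
    open Σ (*-recip (A + B) (ℚP.+-mono-< 0<A 0<B)) renaming (proj₁ to r; proj₂ to r-props)
    open Σ r-props renaming (proj₁ to 0<r; proj₂ to r-eq)
    open Σ (cs (r * ε) (*-pos 0<r 0<ε)) renaming (proj₁ to M₁; proj₂ to f)
    open Σ (ct (r * ε) (*-pos 0<r 0<ε)) renaming (proj₁ to M₂; proj₂ to g)
    N≤ : ∀ m → N₁ ℕ.⊔ N₂ ℕ.⊔ (M₁ ℕ.⊔ M₂) ℕ.≤ m → N₁ ℕ.⊔ N₂ ℕ.≤ m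
    N≤ m = ℕP.m⊔n≤o⇒m≤o (N₁ ℕ.⊔ N₂) (M₁ ℕ.⊔ M₂)
    M≤ : ∀ m → N₁ ℕ.⊔ N₂ ℕ.⊔ (M₁ ℕ.⊔ M₂) ℕ.≤ m → M₁ ℕ.⊔ M₂ ℕ.≤ m
    M≤ m = ℕP.m⊔n≤o⇒n≤o (N₁ ℕ.⊔ N₂) (M₁ ℕ.⊔ M₂)

  private
    recip-inverse : ∀ q → ¬ (q ≡ 0ℚ) → recip q * q ≡ 1ℚ
    recip-inverse q q≢0 with q ℚP.≟ 0ℚ
    ... | yes q≡0 = ⊥-elim (q≢0 q≡0)
    ... | no q≢0′ = ℚP.*-inverseˡ q {{Q.≢-nonZero q≢0′}}

    far⇒≢0 : ∀ {δ q} → 0ℚ < δ → δ ≤ ∣ q ∣ → ¬ (q ≡ 0ℚ)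
    far⇒≢0 0<δ δ≤ refl = ℚP.<-irrefl refl (ℚP.<-≤-trans 0<δ δ≤)

  cauchy-recip : ∀ s δ N → 0ℚ < δ → (∀ n → N ℕ.≤ n → δ ≤ ∣ s n ∣) →
                 Cauchy s → Cauchy (λ n → recip (s n))
  cauchy-recip s δ N 0<δ far with *-recip δ 0<δ
  ... | r , 0<r , δr≡1 =
    cauchy-lipschitz s (λ n → recip (s n)) (r * r) N (*-pos 0<r 0<r) lip
    where
    bound : ∀ q → δ ≤ ∣ q ∣ → ∣ recip q ∣ ≤ r
    bound q δ≤ = ℚP.*-cancelʳ-≤-pos δ {{Q.positive 0<δ}}
      (ℚP.≤-trans (*-monoʳ ∣ recip q ∣ (ℚP.0≤∣p∣ _) δ≤)
        (ℚP.≤-reflexive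
          (trans (sym (ℚP.∣p*q∣≡∣p∣*∣q∣ (recip q) q))
            (trans (cong ∣_∣ (recip-inverse q (far⇒≢0 0<δ δ≤)))
              (trans (sym δr≡1) (ℚP.*-comm δ r))))))

    regroup : ∀ x y a b → (y * b) * x - (x * a) * y ≡ (x * y) * (b - a)
    regroup = solve 4 (λ x y a b →
      (y :* b) :* x :- (x :* a) :* y := (x :* y) :* (b :- a)) refl

    difference : ∀ a b → ¬ (a ≡ 0ℚ) → ¬ (b ≡ 0ℚ) →
                 recip a - recip b ≡ (recip a * recip b) * (b - a)
    difference a b a≢0 b≢0 = trans
      (cong₂ _-_
        (sym (trans (cong (_* recip a) (recip-inverse b b≢0))
                    (ℚP.*-identityˡ (recip a))))
        (sym (trans (cong (_* recip b) (recip-inverse a a≢0))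
                    (ℚP.*-identityˡ (recip b)))))
      (regroup (recip a) (recip b) a b)

    lip : ∀ m n → N ℕ.≤ m → N ℕ.≤ n →
          ∣ recip (s m) - recip (s n) ∣ ≤ r * r * ∣ s m - s n ∣
    lip m n N≤m N≤n = ℚP.≤-trans
      (ℚP.≤-reflexive
        (trans (cong ∣_∣ (difference (s m) (s n) (far⇒≢0 0<δ (far m N≤m))
                                                  (far⇒≢0 0<δ (far n N≤n))))
          (trans (ℚP.∣p*q∣≡∣p∣*∣q∣ (recip (s m) * recip (s n)) (s n - s m))
            (cong₂ _*_ (ℚP.∣p*q∣≡∣p∣*∣q∣ (recip (s m)) (recip (s n)))
                       (∣p-q∣≡∣q-p∣ (s n) (s m))))))
      (*-monoˡ ∣ s m - s n ∣ (ℚP.0≤∣p∣ _)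
        (*-mono (ℚP.0≤∣p∣ _) (ℚP.<⇒≤ 0<r)
                (bound (s m) (far m N≤m)) (bound (s n) (far n N≤n))))

  private
    cauchy-approx : ∀ s →
      (∀ ε → 0ℚ < ε → ∃[ r ] ∃[ N ]
        (Cauchy r × (∀ n → N ℕ.≤ n → ∣ s n - r n ∣ < ε))) →
      Cauchy s
    cauchy-approx s approx ε 0<ε
      with approx (½ * (½ * ε)) (half-pos (half-pos 0<ε))
    ... | r , N , cr , near with cr (½ * ε) (half-pos 0<ε)
    ...   | M , close = N ℕ.⊔ M , λ m n le le′ →
      ℚP.≤-<-trans
        (ℚP.≤-trans (triangle (s m) (r m) (s n))
          (ℚP.+-monoʳ-≤ ∣ s m - r m ∣ (triangle (r m) (r n) (s n))))
        (subst (∣ s m - r m ∣ + (∣ r m - r n ∣ + ∣ r n - s n ∣) <_) (total ε)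
          (ℚP.+-mono-< (near m (ℕP.m⊔n≤o⇒m≤o N M le))
            (ℚP.+-mono-<
              (close m n (ℕP.m⊔n≤o⇒n≤o N M le) (ℕP.m⊔n≤o⇒n≤o N M le′))
              (subst (_< ½ * (½ * ε)) (∣p-q∣≡∣q-p∣ (s n) (r n))
                     (near n (ℕP.m⊔n≤o⇒m≤o N M le′))))))
      where
      total : ∀ ε → ½ * (½ * ε) + (½ * ε + ½ * (½ * ε)) ≡ ε
      total = solve 1 (λ e → con ½ :* (con ½ :* e) :+
                (con ½ :* e :+ con ½ :* (con ½ :* e)) := e) refl

    cauchy-Σ : ∀ (s : ℕ → ℚ) (f : ℚ → ℕ → ℚ) →
               (∀ k → Cauchy (λ n → f (s n) k)) →
               ∀ K → Cauchy (λ n → Σ< K (f (s n)))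
    cauchy-Σ s f cf zero    = cauchy-const 0ℚ
    cauchy-Σ s f cf (suc K) =
      cauchy-+ (λ n → Σ< K (f (s n))) (λ n → f (s n) K) (cauchy-Σ s f cf K) (cf K)

    cauchy-expTerm : ∀ s → Cauchy s → ∀ k → Cauchy (λ n → expTerm (s n) k)
    cauchy-expTerm s cs zero    = cauchy-const 1ℚ
    cauchy-expTerm s cs (suc k) =
      cauchy-* (λ n → expTerm (s n) k * s n) (λ _ → + 1 Q./ suc k)
        (cauchy-* (λ n → expTerm (s n) k) s (cauchy-expTerm s cs k) cs)
        (cauchy-const (+ 1 Q./ suc k))

    expTerm-nonNeg : ∀ {B} → 0ℚ ≤ B → ∀ k → 0ℚ ≤ expTerm B k
    expTerm-nonNeg 0≤B zero    = ℚP.nonNegative⁻¹ 1ℚ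
    expTerm-nonNeg 0≤B (suc k) =
      *-nonNeg (*-nonNeg (expTerm-nonNeg 0≤B k) 0≤B) (ℚP.<⇒≤ (unit-pos k))

    expTerm-bound : ∀ {a B} → ∣ a ∣ ≤ B → ∀ k → ∣ expTerm a k ∣ ≤ expTerm B k
    expTerm-bound {a} {B} ∣a∣≤B zero    = ℚP.≤-refl
    expTerm-bound {a} {B} ∣a∣≤B (suc k) = ℚP.≤-trans
      (ℚP.≤-reflexive
        (trans (ℚP.∣p*q∣≡∣p∣*∣q∣ (expTerm a k * a) u)
          (cong₂ _*_ (ℚP.∣p*q∣≡∣p∣*∣q∣ (expTerm a k) a)
                     (ℚP.0≤p⇒∣p∣≡p (ℚP.<⇒≤ (unit-pos k))))))
      (*-monoˡ u (ℚP.<⇒≤ (unit-pos k))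
        (*-mono (ℚP.0≤∣p∣ _) (ℚP.≤-trans (ℚP.0≤∣p∣ a) ∣a∣≤B)
                (expTerm-bound ∣a∣≤B k) ∣a∣≤B))
      where
      u : ℚ
      u = + 1 Q./ suc k

  -- The power series Σ c k * x ^ k / k !, evaluated along s.

  expSum : (ℕ → ℚ) → ℚ → ℕ → ℚ
  expSum c a n = Σ< n (λ k → c k * expTerm a k)

  private
    module Tail (c : ℕ → ℚ) (∣c∣≤1 : ∀ k → ∣ c k ∣ ≤ 1ℚ) (B : ℚ) (0≤B : 0ℚ ≤ B)
                (K : ℕ) (halving : ∀ k → K ℕ.≤ k → B * (+ 1 Q./ suc k) < ½) where
      open ℚP.≤-Reasoning

      u : ℕ → ℚ
      u = expTerm B

      u≥0 : ∀ k → 0ℚ ≤ u k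
      u≥0 = expTerm-nonNeg 0≤B

      shrink : ∀ k → K ℕ.≤ k → u (suc k) ≤ u k * ½
      shrink k K≤k = begin
        u k * B * (+ 1 Q./ suc k)    ≡⟨ ℚP.*-assoc (u k) B (+ 1 Q./ suc k) ⟩
        u k * (B * (+ 1 Q./ suc k))  ≤⟨ *-monoʳ (u k) (u≥0 k) (ℚP.<⇒≤ (halving k K≤k)) ⟩
        u k * ½                      ∎

      decreasing : ∀ k → K ℕ.≤ k → u (suc k) ≤ u k
      decreasing k K≤k = begin
        u (suc k)  ≤⟨ shrink k K≤k ⟩
        u k * ½    ≤⟨ *-monoʳ (u k) (u≥0 k) ½≤1 ⟩
        u k * 1ℚ   ≡⟨ ℚP.*-identityʳ (u k) ⟩
        u k        ∎
        where
        ½≤1 : ½ ≤ 1ℚ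
        ½≤1 = Q.*≤* (ℤ.+≤+ (ℕ.s≤s ℕ.z≤n))

      below-uK : ∀ j → u (j ℕ.+ K) ≤ u K
      below-uK zero    = ℚP.≤-refl
      below-uK (suc j) =
        ℚP.≤-trans (decreasing (j ℕ.+ K) (ℕP.m≤n+m K j)) (below-uK j)

      below : ∀ k → K ℕ.≤ k → u k ≤ u K
      below k K≤k = subst (λ z → u z ≤ u K) (ℕP.m∸n+n≡m K≤k) (below-uK (k ℕ.∸ K))

      C : ℚ
      C = u K * B + 1ℚ

      0<C : 0ℚ < C
      0<C = ℚP.+-mono-≤-< (*-nonNeg (u≥0 K) 0≤B) (ℚP.positive⁻¹ 1ℚ)

      u-suc : ∀ k → K ℕ.≤ k → u (suc k) ≤ C * (+ 1 Q./ suc k)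
      u-suc k K≤k = *-monoˡ (+ 1 Q./ suc k) (ℚP.<⇒≤ (unit-pos k)) (begin
        u k * B       ≤⟨ *-monoˡ B 0≤B (below k K≤k) ⟩
        u K * B       ≡⟨ ℚP.+-identityʳ (u K * B) ⟨
        u K * B + 0ℚ  ≤⟨ ℚP.+-monoʳ-≤ (u K * B) (ℚP.nonNegative⁻¹ 1ℚ) ⟩
        C             ∎)

      u-small : ∀ ε → 0ℚ < ε → ∃[ n ] (K ℕ.≤ n × u n < ε)
      u-small ε 0<ε with small C ε 0<C 0<ε
      ... | M , lt = suc (K ℕ.⊔ M) , ℕP.m≤n⇒m≤1+n (ℕP.m≤m⊔n K M)
        , ℚP.≤-<-trans (u-suc (K ℕ.⊔ M) (ℕP.m≤m⊔n K M)) (lt (K ℕ.⊔ M) (ℕP.m≤n⊔m K M))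

      term-bound : ∀ a → ∣ a ∣ ≤ B → ∀ k → ∣ c k * expTerm a k ∣ ≤ u k
      term-bound a ∣a∣≤B k = begin
        ∣ c k * expTerm a k ∣      ≡⟨ ℚP.∣p*q∣≡∣p∣*∣q∣ (c k) (expTerm a k) ⟩
        ∣ c k ∣ * ∣ expTerm a k ∣  ≤⟨ *-mono (ℚP.0≤∣p∣ (c k)) (u≥0 k) (∣c∣≤1 k)
                                         (expTerm-bound ∣a∣≤B k) ⟩
        1ℚ * u k                   ≡⟨ ℚP.*-identityˡ (u k) ⟩
        u k                        ∎

      -- u m ≤ 2 u m - 2 u (m + 1), so the tail from n telescopes below 2 u n.
      double-gap : ∀ x y z → z ≤ y * ½ → ((x + x) - (y + y)) + y ≤ (x + x) - (z + z)
      double-gap x y z z≤ = begin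
        ((x + x) - (y + y)) + y    ≡⟨ collect x y ⟩
        (x + x) - (y * ½ + y * ½)  ≤⟨ ℚP.+-monoʳ-≤ (x + x)
                                        (ℚP.neg-antimono-≤ (ℚP.+-mono-≤ z≤ z≤)) ⟩
        (x + x) - (z + z)          ∎
        where
        collect : ∀ x y → ((x + x) - (y + y)) + y ≡ (x + x) - (y * ½ + y * ½)
        collect = solve 2 (λ x y → ((x :+ x) :- (y :+ y)) :+ y
                                := (x :+ x) :- (y :* con ½ :+ y :* con ½)) refl

      move : ∀ x y z → (x + z) - y ≡ (x - y) + z
      move = solve 3 (λ x y z → (x :+ z) :- y := (x :- y) :+ z) refl

      tail : ∀ a → ∣ a ∣ ≤ B → ∀ n → K ℕ.≤ n → ∀ j →
             ∣ expSum c a (j ℕ.+ n) - expSum c a n ∣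
             ≤ (u n + u n) - (u (j ℕ.+ n) + u (j ℕ.+ n))
      tail a ∣a∣≤B n K≤n zero = ℚP.≤-reflexive
        (trans (cong ∣_∣ (ℚP.+-inverseʳ (expSum c a n)))
               (sym (ℚP.+-inverseʳ (u n + u n))))
      tail a ∣a∣≤B n K≤n (suc j) = begin
        ∣ (E m + e) - E n ∣                    ≡⟨ cong ∣_∣ (move (E m) (E n) e) ⟩
        ∣ (E m - E n) + e ∣                    ≤⟨ ℚP.∣p+q∣≤∣p∣+∣q∣ (E m - E n) e ⟩
        ∣ E m - E n ∣ + ∣ e ∣                  ≤⟨ ℚP.+-mono-≤ (tail a ∣a∣≤B n K≤n j)
                                                            (term-bound a ∣a∣≤B m) ⟩
        ((u n + u n) - (u m + u m)) + u m      ≤⟨ double-gap (u n) (u m) (u (suc m))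
                                                    (shrink m (ℕP.≤-trans K≤n (ℕP.m≤n+m n j))) ⟩
        (u n + u n) - (u (suc m) + u (suc m))  ∎
        where
        m : ℕ
        m = j ℕ.+ n
        E : ℕ → ℚ
        E = expSum c a
        e : ℚ
        e = c m * expTerm a m

      tail-bound : ∀ a → ∣ a ∣ ≤ B → ∀ n m → K ℕ.≤ n → n ℕ.≤ m →
                   ∣ expSum c a m - expSum c a n ∣ ≤ u n + u n
      tail-bound a ∣a∣≤B n m K≤n n≤m =
        subst (λ z → ∣ expSum c a z - expSum c a n ∣ ≤ u n + u n) (ℕP.m∸n+n≡m n≤m)
          (begin
            ∣ expSum c a (j ℕ.+ n) - expSum c a n ∣      ≤⟨ tail a ∣a∣≤B n K≤n j ⟩
            (u n + u n) - (u (j ℕ.+ n) + u (j ℕ.+ n))    ≤⟨ ℚP.+-monoʳ-≤ (u n + u n)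
                                                              (ℚP.neg-antimono-≤ nonNeg) ⟩
            (u n + u n) + 0ℚ                             ≡⟨ ℚP.+-identityʳ (u n + u n) ⟩
            u n + u n                                    ∎)
        where
        j : ℕ
        j = m ℕ.∸ n
        nonNeg : 0ℚ ≤ u (j ℕ.+ n) + u (j ℕ.+ n)
        nonNeg = ℚP.+-mono-≤ (u≥0 (j ℕ.+ n)) (u≥0 (j ℕ.+ n))

  cauchy-expSum : ∀ c → (∀ k → ∣ c k ∣ ≤ 1ℚ) →
                  ∀ s → Cauchy s → Cauchy (λ n → expSum c (s n) n)
  cauchy-expSum c ∣c∣≤1 s cs =
    cauchy-approx (λ n → expSum c (s n) n) approx
    where
    open Σ (bounded s cs) renaming (proj₁ to B; proj₂ to B-bound)
    open Σ B-bound renaming (proj₁ to N; proj₂ to B-props)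
    open Σ B-props renaming (proj₁ to 0<B; proj₂ to s≤B)
    open Σ (small B ½ 0<B (ℚP.positive⁻¹ ½)) renaming (proj₁ to K; proj₂ to halving)
    open Tail c ∣c∣≤1 B (ℚP.<⇒≤ 0<B) K halving

    cauchy-term : ∀ k → Cauchy (λ n → c k * expTerm (s n) k)
    cauchy-term k = cauchy-* (λ _ → c k) (λ n → expTerm (s n) k)
                      (cauchy-const (c k)) (cauchy-expTerm s cs k)

    approx : ∀ ε → 0ℚ < ε → ∃[ r ] ∃[ M ]
      (Cauchy r × (∀ n → M ℕ.≤ n → ∣ expSum c (s n) n - r n ∣ < ε))
    approx ε 0<ε = truncate (u-small (½ * ε) (half-pos 0<ε))
      where
      truncate : ∃[ p ] (K ℕ.≤ p × u p < ½ * ε) → ∃[ r ] ∃[ M ]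
        (Cauchy r × (∀ n → M ℕ.≤ n → ∣ expSum c (s n) n - r n ∣ < ε))
      truncate (p , K≤p , up<) =
        (λ n → expSum c (s n) p) , N ℕ.⊔ p
        , cauchy-Σ s (λ a k → c k * expTerm a k) cauchy-term p
        , λ n le → ℚP.≤-<-trans
            (tail-bound (s n) (s≤B n (ℕP.m⊔n≤o⇒m≤o N p le)) p n K≤p
                        (ℕP.m⊔n≤o⇒n≤o N p le))
            (subst (u p + u p <_) (halves ε) (ℚP.+-mono-< up< up<))

  cauchy-leibnizSum : Cauchy leibnizSum
  cauchy-leibnizSum ε 0<ε with unit-small (½ * ε) (half-pos 0<ε)
  ... | N , lt = N , λ m n N≤m N≤n →
    ℚP.≤-<-trans (triangle (leibnizSum m) (leibnizSum N) (leibnizSum n))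
      (subst (∣ leibnizSum m - leibnizSum N ∣ + ∣ leibnizSum N - leibnizSum n ∣ <_)
             (halves ε)
             (ℚP.+-mono-< (close m N≤m)
               (subst (_< ½ * ε) (∣p-q∣≡∣q-p∣ (leibnizSum n) (leibnizSum N))
                      (close n N≤n))))
    where
    a : ℕ → ℚ
    a k = + 1 Q./ suc (2 ℕ.* k)

    -- The tail starting at n, normalised to begin with a positive term.
    T : ℕ → ℕ → ℚ
    T n zero    = 0ℚ
    T n (suc j) = a n - T (suc n) j

    bounds : ∀ n j → 0ℚ ≤ T n j × T n j ≤ a n
    bounds n zero    = ℚP.≤-refl , ℚP.<⇒≤ (unit-pos (2 ℕ.* n))
    bounds n (suc j) with bounds (suc n) j
    ... | 0≤T , T≤a =
        subst (_≤ a n - T (suc n) j) (ℚP.+-inverseʳ (a n))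
          (ℚP.+-monoʳ-≤ (a n) (ℚP.neg-antimono-≤
            (ℚP.≤-trans T≤a (unit-anti (ℕP.*-monoʳ-≤ 2 (ℕP.n≤1+n n))))))
      , subst (a n - T (suc n) j ≤_) (ℚP.+-identityʳ (a n))
          (ℚP.+-monoʳ-≤ (a n) (ℚP.neg-antimono-≤ 0≤T))

    split : ∀ j n → leibnizSum (j ℕ.+ n) ≡ leibnizSum n + sign n * T n j
    split zero    n = sym (trans (cong (λ z → leibnizSum n + z) (ℚP.*-zeroʳ (sign n)))
                                 (ℚP.+-identityʳ (leibnizSum n)))
    split (suc j) n = trans (cong leibnizSum (sym (ℕP.+-suc j n)))
      (trans (split j (suc n)) (re (leibnizSum n) (sign n) (a n) (T (suc n) j)))
      where
      re : ∀ l σ a t → (l + σ * a) + (- σ) * t ≡ l + σ * (a - t)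
      re = solve 4 (λ l σ a t →
        (l :+ σ :* a) :+ (:- σ) :* t := l :+ σ :* (a :- t)) refl

    ∣sign∣ : ∀ n → ∣ sign n ∣ ≡ 1ℚ
    ∣sign∣ zero    = refl
    ∣sign∣ (suc n) = trans (ℚP.∣-p∣≡∣p∣ (sign n)) (∣sign∣ n)

    close : ∀ m → N ℕ.≤ m → ∣ leibnizSum m - leibnizSum N ∣ < ½ * ε
    close m N≤m = ℚP.≤-<-trans
      (subst (λ z → ∣ leibnizSum z - leibnizSum N ∣ ≤ a N) (ℕP.m∸n+n≡m N≤m)
        (ℚP.≤-trans (ℚP.≤-reflexive size) (proj₂ (bounds N (m ℕ.∸ N)))))
      (lt (2 ℕ.* N) (ℕP.m≤m+n N (N ℕ.+ 0)))
      where
      re : ∀ l d → (l + d) - l ≡ d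
      re = solve 2 (λ l d → (l :+ d) :- l := d) refl
      size : ∣ leibnizSum (m ℕ.∸ N ℕ.+ N) - leibnizSum N ∣ ≡ T N (m ℕ.∸ N)
      size = trans (cong (λ z → ∣ z - leibnizSum N ∣) (split (m ℕ.∸ N) N))
        (trans (cong ∣_∣ (re (leibnizSum N) (sign N * T N (m ℕ.∸ N))))
          (trans (ℚP.∣p*q∣≡∣p∣*∣q∣ (sign N) (T N (m ℕ.∸ N)))
            (trans (cong₂ _*_ (∣sign∣ N)
                     (ℚP.0≤p⇒∣p∣≡p (proj₁ (bounds N (m ℕ.∸ N)))))
                   (ℚP.*-identityˡ (T N (m ℕ.∸ N))))))

open Sequences

------------------------------------------------------------------------
-- Real numbers

record ℝ : Set where
  constructor real
  field
    seq    : ℕ → ℚ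
    cauchy : Cauchy seq
open ℝ public

infix  4 _<_ _≤_ _≈_ _#_
infixl 6 _+_ _-_
infixl 7 _*_ _/_∵_
infix  8 -_
infixr 9 _^_

_<_ : ℝ → ℝ → Set
x < y = ∃[ δ ] (0ℚ Q.< δ × ∃[ N ] ∀ n → N ℕ.≤ n → seq x n Q.+ δ Q.≤ seq y n)

_≤_ : ℝ → ℝ → Set
x ≤ y = ¬ (y < x)

-- Equality of reals; distinct sequences may represent the same real.
_≈_ : ℝ → ℝ → Set
x ≈ y = x ≤ y × y ≤ x

-- The constructively meaningful form of x ≠ y.
_#_ : ℝ → ℝ → Set
x # y = x < y ⊎ y < x

fromℚ : ℚ → ℝ
fromℚ q = real (λ _ → q) (cauchy-const q)

fromℤ : ℤ → ℝ
fromℤ k = fromℚ (k Q./ 1)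

0ℝ 1ℝ : ℝ
0ℝ = fromℚ 0ℚ
1ℝ = fromℚ 1ℚ

_+_ : ℝ → ℝ → ℝ
x + y = real (λ n → seq x n Q.+ seq y n) (cauchy-+ (seq x) (seq y) (cauchy x) (cauchy y))

-_ : ℝ → ℝ
- x = real (λ n → Q.- seq x n) (cauchy-neg (seq x) (cauchy x))

_-_ : ℝ → ℝ → ℝ
x - y = x + - y

_*_ : ℝ → ℝ → ℝ
x * y = real (λ n → seq x n Q.* seq y n) (cauchy-* (seq x) (seq y) (cauchy x) (cauchy y))

∣_∣ : ℝ → ℝ
∣ x ∣ = real (λ n → Q.∣ seq x n ∣) (cauchy-abs (seq x) (cauchy x))

_^_ : ℝ → ℕ → ℝ
x ^ zero  = 1ℝ
x ^ suc n = x * x ^ n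

private
  p≤∣p∣ : ∀ p → p Q.≤ Q.∣ p ∣
  p≤∣p∣ p with ℚP.≤-total 0ℚ p
  ... | inj₁ 0≤p = ℚP.≤-reflexive (sym (ℚP.0≤p⇒∣p∣≡p 0≤p))
  ... | inj₂ p≤0 = ℚP.≤-trans p≤0 (ℚP.0≤∣p∣ p)

#0⇒far : ∀ y → y # 0ℝ →
         ∃[ δ ] (0ℚ Q.< δ × ∃[ N ] ∀ n → N ℕ.≤ n → δ Q.≤ Q.∣ seq y n ∣)
#0⇒far y (inj₂ (δ , 0<δ , N , le)) = δ , 0<δ , N , λ n N≤n →
  ℚP.≤-trans (subst (Q._≤ seq y n) (ℚP.+-identityˡ δ) (le n N≤n)) (p≤∣p∣ (seq y n))
#0⇒far y (inj₁ (δ , 0<δ , N , le)) = δ , 0<δ , N , λ n N≤n →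
  ℚP.≤-trans (δ≤-p (seq y n) (le n N≤n))
    (subst (Q.- seq y n Q.≤_) (ℚP.∣-p∣≡∣p∣ (seq y n)) (p≤∣p∣ (Q.- seq y n)))
  where
  open +-*-Solver using (solve; _:+_; :-_; _:=_)
  re : ∀ p d → (Q.- p) Q.+ (p Q.+ d) ≡ d
  re = solve 2 (λ p d → (:- p) :+ (p :+ d) := d) refl
  δ≤-p : ∀ p → p Q.+ δ Q.≤ 0ℚ → δ Q.≤ Q.- p
  δ≤-p p le = ℚP.≤-trans (ℚP.≤-reflexive (sym (re p δ)))
    (subst ((Q.- p) Q.+ (p Q.+ δ) Q.≤_) (ℚP.+-identityʳ (Q.- p))
           (ℚP.+-monoʳ-≤ (Q.- p) le))

_/_∵_ : (x y : ℝ) → y # 0ℝ → ℝ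
x / y ∵ y#0 = x * real (λ n → recip (seq y n)) (inverse (#0⇒far y y#0))
  where
  inverse : (∃[ δ ] (0ℚ Q.< δ × ∃[ N ] ∀ n → N ℕ.≤ n → δ Q.≤ Q.∣ seq y n ∣)) →
            Cauchy (λ n → recip (seq y n))
  inverse (δ , 0<δ , N , far) = cauchy-recip (seq y) δ N 0<δ far (cauchy y)

------------------------------------------------------------------------
-- Elementary functions

expSeries : (c : ℕ → ℚ) → (∀ k → Q.∣ c k ∣ Q.≤ 1ℚ) → ℝ → ℝ
expSeries c ∣c∣≤1 x = real (λ n → expSum c (seq x n) n) (cauchy-expSum c ∣c∣≤1 (seq x) (cauchy x))

-- The k-th derivatives of sin and cos at 0.
sinCoeff cosCoeff : ℕ → ℚ
sinCoeff 0 = 0ℚ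
sinCoeff 1 = 1ℚ
sinCoeff (suc (suc k)) = Q.- sinCoeff k
cosCoeff 0 = 1ℚ
cosCoeff 1 = 0ℚ
cosCoeff (suc (suc k)) = Q.- cosCoeff k

private
  0≤1 : 0ℚ Q.≤ 1ℚ
  0≤1 = ℚP.nonNegative⁻¹ 1ℚ

∣sinCoeff∣≤1 : ∀ k → Q.∣ sinCoeff k ∣ Q.≤ 1ℚ
∣sinCoeff∣≤1 0 = 0≤1
∣sinCoeff∣≤1 1 = ℚP.≤-refl
∣sinCoeff∣≤1 (suc (suc k)) =
  subst (Q._≤ 1ℚ) (sym (ℚP.∣-p∣≡∣p∣ (sinCoeff k))) (∣sinCoeff∣≤1 k)

∣cosCoeff∣≤1 : ∀ k → Q.∣ cosCoeff k ∣ Q.≤ 1ℚ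
∣cosCoeff∣≤1 0 = ℚP.≤-refl
∣cosCoeff∣≤1 1 = 0≤1
∣cosCoeff∣≤1 (suc (suc k)) =
  subst (Q._≤ 1ℚ) (sym (ℚP.∣-p∣≡∣p∣ (cosCoeff k))) (∣cosCoeff∣≤1 k)

exp sin cos cosh : ℝ → ℝ
exp    = expSeries (λ _ → 1ℚ) (λ _ → ℚP.≤-refl)
sin    = expSeries sinCoeff ∣sinCoeff∣≤1
cos    = expSeries cosCoeff ∣cosCoeff∣≤1
cosh x = fromℚ ½ * (exp x + exp (- x))

-- π = 4 (1 - 1/3 + 1/5 - 1/7 + ⋯)
π : ℝ
π = fromℤ (+ 4) * real leibnizSum cauchy-leibnizSum

------------------------------------------------------------------------
-- Limits and products

infix 4 _⟶_

_⟶_ : (ℕ → ℝ) → ℝ → Set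
a ⟶ L = ∀ ε → 0ℝ < ε → ∃[ M ] ∀ N → M ℕ.≤ N → ∣ a N - L ∣ < ε

∏ : ∀ {n} → Vector ℝ n → ℝ
∏ = foldr _*_ 1ℝ

-- ∏± N c is the product of c k over - N ≤ k ≤ N.
∏± : ℕ → (ℤ → ℝ) → ℝ
∏± zero    c = c (+ 0)
∏± (suc N) c = ∏± N c * (c (+ suc N) * c -[1+ N ])

-- ∏ℤ c ≐ L: the product of c over ℤ, taken along symmetric partial products,
-- converges to L.
∏ℤ_≐_ : (ℤ → ℝ) → ℝ → Set
∏ℤ c ≐ L = (λ N → ∏± N c) ⟶ L

infix 4 ∏ℤ_≐_

------------------------------------------------------------------------
-- The factors of the identity

-- (2k - 1) π / n for 1 ≤ k ≤ n, where i : Fin n stands for k = toℕ i + 1.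
θ : (n : ℕ) .{{_ : NonZero n}} → Fin n → ℝ
θ n i = fromℚ ((+ (2 ℕ.* toℕ i ℕ.+ 1)) Q./ n) * π

factor : (n : ℕ) .{{_ : NonZero n}} → ℝ → Fin n → ℝ
factor n t i = cosh (fromℤ (+ 2) * π * t * sin (θ n i))
             - cos  (fromℤ (+ 2) * π * t * cos (θ n i))

{-# OPTIONS --safe #-}

module Submission where

-- Put F(ζ) = cosh (Im ζ) - cos (Re ζ) = 2 |sin (ζ/2)|². The points ω with ωⁿ = -1 give
-- (tⁿ + kⁿ)² = ∏ |k - tω|², so the theorem reduces to the sine product
-- F(2πz) / F(2πz′) = lim ∏ |k - z|² / |k - z′|² over |k| ≤ N, applied to z = yω and z′ = xω.
-- The factorisation of zᴹ - wᴹ over the M-th roots of unity, M = 2m + 1, writes F(ζ) as a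
-- constant times the product of F((ζ + 2πk) / M) over |k| ≤ m; the constant cancels in the
-- quotient. The factors at ±k combine to a quadratic in 1 - cos (2πk/M), which is at least
-- a multiple of k²/M², so that replacing ζ by ζ′ changes this pair by a factor of at most
-- 1 + C/k², uniformly in M. Hence the factors with N < |k| ≤ m contribute at most 1 + 2C/N,
-- while the finitely many others converge to the claimed ones as m → ∞.
-- That 2π is a period for the Leibniz value of π follows from sin A(t) ≈ t cos A(t) along
-- partial sums A of the arctangent series, which at t = 1 gives sin (π/4) = cos (π/4).

-- Nothing from calculus enters: derivatives and integrals become finite differences with explicit
-- remainders, and all constants are rational. Two constructive obstacles shape the proof. A
-- quotient asks for a denominator apart from 0, so identities and estimates are kept multiplied
-- out, and a factor is cancelled only when a rational lower bound for it is known (`Pos`). For the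
-- denominators `factor n x i` this bound is itself obtained from the sine product, by comparing the
-- argument with `π`, where `F` is bounded away from 0. The other obstacle is that `xⁿ + kⁿ` changes
-- sign with the parity of `n` and the sign of `k`; the analysis sees only its square, and the sign
-- is recovered from a rational approximation.
--
-- An upper estimate for the exchange of two arguments is enough: with the arguments swapped it
-- becomes the lower estimate. The number M of roots of unity is odd so that exactly one factor has
-- no partner. The numerical constants go back to `2 ≤ π ≤ 17/5`: the lower bound makes the angles
-- 2πk/M large enough, the upper one gives `∣ α ∣, ∣ β ∣ ≤ 7` and the range on which `1 - cos` is
-- bounded below.

import Defs as D
open import Data.Integer as ℤ using (ℤ; +_; -[1+_])
open import Data.Nat as ℕ using (ℕ; zero; suc; _∸_; NonZero)
import Data.Nat.Properties as ℕP
open import Data.Product using (Σ-syntax; ∃-syntax; _×_; _,_; proj₁; proj₂)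
open import Data.Rational as Q using (ℚ; 0ℚ; 1ℚ; ½)
import Data.Rational.Properties as ℚP
open import Data.Sum using (_⊎_; inj₁; inj₂)
open import Function using (_∘_)
open import Level using (0ℓ)
open import Relation.Binary.PropositionalEquality using (_≡_; cong; cong₂; subst)
  renaming (refl to ≡-refl; sym to ≡-sym; trans to ≡-trans)
open import Relation.Nullary using (¬_; yes; no; contradiction)

-- Rational inequalities and unit fractions

module Rationals where
  open Q using (mkℚ; _+_; _*_; _-_; -_; _≤_; _<_; ∣_∣)
  open import Relation.Binary.PropositionalEquality using (sym; trans)
  import Data.Integer.Properties as ℤP
  import Data.Rational.Unnormalised as ℚᵘ
  import Data.Rational.Unnormalised.Properties as ℚᵘP
  open import Data.Rational.Solver using (module +-*-Solver)
  import Relation.Binary.PropositionalEquality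
  module S = +-*-Solver
  open S using (solve; _:+_; _:*_; _:-_; :-_; _:=_; con)

  # : ℕ → ℚ
  # n = + n Q./ 1

  abstract
    -- The pattern of almost every inequality here and, through `by`, of those between reals: the
    -- difference is written as an expression built from nonnegative terms, and the ring solver
    -- checks that identity. The choice of the expression is the content of such a proof.
    ≤-by : ∀ {a b c} → 0ℚ ≤ c → b - a ≡ c → a ≤ b
    ≤-by {a} {b} {c} 0≤c eq = begin
      a            ≡⟨ ℚP.+-identityʳ a ⟨
      a + 0ℚ       ≤⟨ ℚP.+-monoʳ-≤ a 0≤c ⟩
      a + c        ≡⟨ cong (λ z → a + z) eq ⟨
      a + (b - a)  ≡⟨ solve 2 (λ a b → a :+ (b :- a) := b) ≡-refl a b ⟩
      b            ∎
      where open ℚP.≤-Reasoning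

    0≤- : ∀ {a b} → a ≤ b → 0ℚ ≤ b - a
    0≤- {a} {b} a≤b = subst (_≤ b - a) (ℚP.+-inverseʳ a) (ℚP.+-monoˡ-≤ (- a) a≤b)

    0≤+ : ∀ {a b} → 0ℚ ≤ a → 0ℚ ≤ b → 0ℚ ≤ a + b
    0≤+ = ℚP.+-mono-≤

    0≤* : ∀ {a b} → 0ℚ ≤ a → 0ℚ ≤ b → 0ℚ ≤ a * b
    0≤* {a} {b} 0≤a 0≤b = subst (_≤ a * b) (ℚP.*-zeroˡ b)
      (ℚP.*-monoʳ-≤-nonNeg b {{Q.nonNegative 0≤b}} 0≤a)

    0<* : ∀ {a b} → 0ℚ < a → 0ℚ < b → 0ℚ < a * b
    0<* {a} {b} 0<a 0<b =
      subst (_< a * b) (ℚP.*-zeroˡ b) (ℚP.*-monoˡ-<-pos b {{Q.positive 0<b}} 0<a)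

    0≤sq : ∀ a → 0ℚ ≤ a * a
    0≤sq a with ℚP.≤-total 0ℚ a
    ... | inj₁ 0≤a = 0≤* 0≤a 0≤a
    ... | inj₂ a≤0 = subst (0ℚ ≤_) (solve 1 (λ a → (con 0ℚ :- a) :* (con 0ℚ :- a) := a :* a) ≡-refl a)
      (0≤* (0≤- a≤0) (0≤- a≤0))

    0≤1 : 0ℚ ≤ 1ℚ
    0≤1 = ℚP.nonNegative⁻¹ 1ℚ

    0<1 : 0ℚ < 1ℚ
    0<1 = ℚP.positive⁻¹ 1ℚ

    0<½ : 0ℚ < ½
    0<½ = ℚP.positive⁻¹ ½

    ≤∣∣ : ∀ p → p ≤ ∣ p ∣
    ≤∣∣ p with ℚP.≤-total 0ℚ p
    ... | inj₁ 0≤p = ℚP.≤-reflexive (sym (ℚP.0≤p⇒∣p∣≡p 0≤p))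
    ... | inj₂ p≤0 = ℚP.≤-trans p≤0 (ℚP.0≤∣p∣ p)

    -≤∣∣ : ∀ p → - p ≤ ∣ p ∣
    -≤∣∣ p = subst (- p ≤_) (ℚP.∣-p∣≡∣p∣ p) (≤∣∣ (- p))

    ∣∣≤ : ∀ {p e} → p ≤ e → - p ≤ e → ∣ p ∣ ≤ e
    ∣∣≤ {p} {e} p≤e -p≤e with ℚP.∣p∣≡p∨∣p∣≡-p p
    ... | inj₁ eq = subst (_≤ e) (sym eq) p≤e
    ... | inj₂ eq = subst (_≤ e) (sym eq) -p≤e

    ∣-∣-comm : ∀ p q → ∣ p - q ∣ ≡ ∣ q - p ∣
    ∣-∣-comm p q = trans (cong ∣_∣ (solve 2 (λ a b → a :- b := (:- (b :- a))) ≡-refl p q)) (ℚP.∣-p∣≡∣p∣ (q - p))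

    reciprocal : ∀ q → 0ℚ < q → ∃[ r ] (0ℚ < r × q * r ≡ 1ℚ)
    reciprocal q 0<q = r , ℚP.positive⁻¹ r {{ℚP.1/pos⇒pos q}} , ℚP.*-inverseʳ q
      where
      instance
        q>0 : Q.Positive q
        q>0 = Q.positive 0<q
        q≢0 : Q.NonZero q
        q≢0 = ℚP.pos⇒nonZero q
      r : ℚ
      r = Q.1/ q

    -- Supplies the tolerance in the ε-arguments. The witness `ε / (C + ε)` exists for `C = 0` as
    -- well; being at most 1, it allows `δ * δ` to be bounded by `δ`.
    scale : ∀ C ε → 0ℚ ≤ C → 0ℚ < ε → ∃[ δ ] (0ℚ < δ × δ ≤ 1ℚ × C * δ ≤ ε)
    scale C ε 0≤C 0<ε with reciprocal (C + ε) (ℚP.+-mono-≤-< 0≤C 0<ε)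
    ... | r , 0<r , eq = ε * r , 0<* 0<ε 0<r
      , ≤-by (0≤* 0≤C (ℚP.<⇒≤ 0<r)) (trans (cong (_- ε * r) (sym eq))
        (solve 3 (λ a b c → (a :+ b) :* c :- b :* c := a :* c) ≡-refl C ε r))
      , ≤-by (0≤* (ℚP.<⇒≤ 0<ε) (0≤* (ℚP.<⇒≤ 0<ε) (ℚP.<⇒≤ 0<r)))
          (trans (cong (_- C * (ε * r)) (trans (sym (ℚP.*-identityʳ ε)) (cong (ε *_) (sym eq))))
                 (solve 3 (λ a b c → a :* ((b :+ a) :* c) :- b :* (a :* c) := a :* (a :* c)) ≡-refl ε C r))

  -- The index is shifted as in `expTerm`: `inv k` is 1/(k + 1), so that `inv (2 * n)` is 1/(2n +
  -- 1).
  inv : ℕ → ℚ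
  inv k = + 1 Q./ suc k

  abstract
    0<inv : ∀ k → 0ℚ < inv k
    0<inv k = ℚP.positive⁻¹ _ {{ℚP.normalize-pos 1 (suc k)}}

    0≤# : ∀ n → 0ℚ ≤ # n
    0≤# n = ℚP.nonNegative⁻¹ _ {{ℚP.normalize-nonNeg n 1}}

    #-+ : ∀ m n → # (m ℕ.+ n) ≡ # m + # n
    #-+ m n = ℚP.toℚᵘ-injective (begin
      Q.toℚᵘ (# (m ℕ.+ n))               ≈⟨ ℚP.toℚᵘ-fromℚᵘ (ℚᵘ.mkℚᵘ (+ (m ℕ.+ n)) 0) ⟩
      ℚᵘ.mkℚᵘ (+ (m ℕ.+ n)) 0            ≈⟨ ℚᵘ.*≡* eq ⟩
      ℚᵘ.mkℚᵘ (+ m) 0 ℚᵘ.+ ℚᵘ.mkℚᵘ (+ n) 0 ≈⟨ ℚᵘP.+-cong (ℚP.toℚᵘ-fromℚᵘ (ℚᵘ.mkℚᵘ (+ m) 0))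
        (ℚP.toℚᵘ-fromℚᵘ (ℚᵘ.mkℚᵘ (+ n) 0)) ⟨
      Q.toℚᵘ (# m) ℚᵘ.+ Q.toℚᵘ (# n)     ≈⟨ ℚP.toℚᵘ-homo-+ (# m) (# n) ⟨
      Q.toℚᵘ (# m + # n)                 ∎)
      where
      open ℚᵘP.≃-Reasoning
      eq : + (m ℕ.+ n) ℤ.* + 1 ≡ (+ m ℤ.* + 1 ℤ.+ + n ℤ.* + 1) ℤ.* + 1
      eq = cong (ℤ._* + 1) (sym (cong₂ ℤ._+_ (ℤP.*-identityʳ (+ m)) (ℤP.*-identityʳ (+ n))))

    #-suc : ∀ n → # (suc n) ≡ 1ℚ + # n
    #-suc n = #-+ 1 n

    inv-suc : ∀ k → inv k * # (suc k) ≡ 1ℚ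
    inv-suc k = ℚP.toℚᵘ-injective (begin
      Q.toℚᵘ (inv k * # (suc k))                   ≈⟨ ℚP.toℚᵘ-homo-* (inv k) (# (suc k)) ⟩
      Q.toℚᵘ (inv k) ℚᵘ.* Q.toℚᵘ (# (suc k))       ≈⟨ ℚᵘP.*-cong (ℚP.toℚᵘ-fromℚᵘ (ℚᵘ.mkℚᵘ (+ 1) k))
        (ℚP.toℚᵘ-fromℚᵘ (ℚᵘ.mkℚᵘ (+ suc k) 0)) ⟩
      ℚᵘ.mkℚᵘ (+ 1) k ℚᵘ.* ℚᵘ.mkℚᵘ (+ suc k) 0     ≈⟨ ℚᵘ.*≡* eq ⟩
      ℚᵘ.1ℚᵘ                                       ∎)
      where
      open ℚᵘP.≃-Reasoning
      eq : + 1 ℤ.* + suc k ℤ.* + 1 ≡ + 1 ℤ.* + (suc k ℕ.* 1)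
      eq = trans (ℤP.*-identityʳ (+ 1 ℤ.* + suc k)) (cong (λ z → + 1 ℤ.* + z) (sym (ℕP.*-identityʳ (suc k))))

    #-mono : ∀ {m n} → m ℕ.≤ n → # m ≤ # n
    #-mono {m} {n} m≤n = subst (λ z → # m ≤ # z) (ℕP.m+[n∸m]≡n m≤n)
      (≤-by (0≤# (n ℕ.∸ m)) (trans (cong (_- # m) (#-+ m (n ℕ.∸ m)))
        (solve 2 (λ a b → a :+ b :- a := b) ≡-refl (# m) (# (n ℕ.∸ m)))))

    archimedean : ∀ q → ∃[ n ] q ≤ # n
    archimedean (mkℚ (+ a) d c) = a , ℚP.toℚᵘ-cancel-≤ (ℚᵘP.≤-respʳ-≃
      (ℚᵘP.≃-sym (ℚP.toℚᵘ-fromℚᵘ (ℚᵘ.mkℚᵘ (+ a) 0)))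
      (ℚᵘ.*≤* (ℤP.*-monoˡ-≤-nonNeg (+ a) (ℤ.+≤+ (ℕ.s≤s ℕ.z≤n)))))
    archimedean q@(mkℚ -[1+ a ] d c) = 0 , ℚP.<⇒≤ (ℚP.negative⁻¹ q)

    inv-small : ∀ ε → 0ℚ < ε → ∃[ N ] ∀ k → N ℕ.≤ k → inv k ≤ ε
    inv-small ε 0<ε with reciprocal ε 0<ε
    ... | r , 0<r , εr≡1 with archimedean r
    ...   | N , r≤N = N , λ k N≤k → ≤-by
      (0≤* (0≤* (ℚP.<⇒≤ 0<ε) (ℚP.<⇒≤ (0<inv k)))
           (0≤- (ℚP.≤-trans r≤N (#-mono (ℕP.m≤n⇒m≤1+n N≤k)))))
      (begin
        ε - inv k                                  ≡⟨ solve 2 (λ a b → a :- b := a :* con 1ℚ :- b :* con 1ℚ)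
          ≡-refl ε (inv k) ⟩
        ε * 1ℚ - inv k * 1ℚ                        ≡⟨ cong₂ (λ u v → ε * u - inv k * v) (inv-suc k) εr≡1 ⟨
        ε * (inv k * # (suc k)) - inv k * (ε * r)
          ≡⟨ solve 4 (λ a b c d → a :* (b :* c) :- b :* (a :* d) := a :* b :* (c :- d)) ≡-refl ε (inv k)
          (# (suc k)) r ⟩
        ε * inv k * (# (suc k) - r)                ∎)
      where open Relation.Binary.PropositionalEquality.≡-Reasoning

    inv-anti : ∀ {j k} → j ℕ.≤ k → inv k ≤ inv j
    inv-anti {j} {k} j≤k = ≤-by
      (0≤* (0≤* (ℚP.<⇒≤ (0<inv j)) (ℚP.<⇒≤ (0<inv k))) (0≤- (#-mono (ℕ.s≤s j≤k))))
      (begin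
        inv j - inv k
          ≡⟨ solve 2 (λ a b → a :- b := a :* con 1ℚ :- b :* con 1ℚ) ≡-refl (inv j) (inv k) ⟩
        inv j * 1ℚ - inv k * 1ℚ                                    ≡⟨ cong₂ (λ u v → inv j * u - inv k * v)
          (inv-suc k) (inv-suc j) ⟨
        inv j * (inv k * # (suc k)) - inv k * (inv j * # (suc j))
          ≡⟨ solve 4 (λ a b c d → a :* (b :* c) :- b :* (a :* d) := a :* b :* (c :- d)) ≡-refl (inv j) (inv k)
          (# (suc k)) (# (suc j)) ⟩
        inv j * inv k * (# (suc k) - # (suc j))                    ∎)
      where open Relation.Binary.PropositionalEquality.≡-Reasoning

    /-inv : ∀ k m → + k Q./ suc m ≡ # k * inv m
    /-inv k m = ℚP.toℚᵘ-injective (begin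
      Q.toℚᵘ (+ k Q./ suc m)                   ≈⟨ ℚP.toℚᵘ-fromℚᵘ (ℚᵘ.mkℚᵘ (+ k) m) ⟩
      ℚᵘ.mkℚᵘ (+ k) m                          ≈⟨ ℚᵘ.*≡* eq ⟩
      ℚᵘ.mkℚᵘ (+ k) 0 ℚᵘ.* ℚᵘ.mkℚᵘ (+ 1) m     ≈⟨ ℚᵘP.*-cong (ℚP.toℚᵘ-fromℚᵘ (ℚᵘ.mkℚᵘ (+ k) 0))
        (ℚP.toℚᵘ-fromℚᵘ (ℚᵘ.mkℚᵘ (+ 1) m)) ⟨
      Q.toℚᵘ (# k) ℚᵘ.* Q.toℚᵘ (inv m)         ≈⟨ ℚP.toℚᵘ-homo-* (# k) (inv m) ⟨
      Q.toℚᵘ (# k * inv m)                     ∎)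
      where
      open ℚᵘP.≃-Reasoning
      eq : + k ℤ.* + (1 ℕ.* suc m) ≡ + k ℤ.* + 1 ℤ.* + suc m
      eq = cong₂ ℤ._*_ (sym (ℤP.*-identityʳ (+ k))) (cong +_ (ℕP.*-identityˡ (suc m)))

-- The ordered ring of real numbers

module Reals where
  open Rationals public
  open import Algebra.Bundles using (CommutativeRing)
  open import Algebra.Solver.Ring.AlmostCommutativeRing using (fromCommutativeRing; _-Raw-AlmostCommutative⟶_)
  import Algebra.Solver.Ring
  open import Data.Maybe using (Maybe; just; nothing)
  open import Relation.Binary using (IsEquivalence)

  Ev : (ℕ → Set) → Set
  Ev P = ∃[ N ] ∀ n → N ℕ.≤ n → P n

  always : ∀ {P : ℕ → Set} → (∀ n → P n) → Ev P
  always f = 0 , λ n _ → f n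

  infixr 4 _&_
  _&_ : ∀ {P Q : ℕ → Set} → Ev P → Ev Q → Ev (λ n → P n × Q n)
  (M , f) & (N , g) = M ℕ.⊔ N , λ n le →
    f n (ℕP.m⊔n≤o⇒m≤o M N le) , g n (ℕP.m⊔n≤o⇒n≤o M N le)

  ev : ∀ {P Q : ℕ → Set} → Ev P → (∀ n → P n → Q n) → Ev Q
  ev (N , f) g = N , λ n le → g n (f n le)

  infix  4 _≤_ _≈_
  infixl 6 _+_ _-_
  infixl 7 _*_
  infix  8 -_

  opaque
    -- The reals of the statement, with an order that does not go through
    -- negation: every strict inequality then has a rational witness.
    R : Set
    R = D.ℝ

    ι : ℚ → R
    ι = D.fromℚ

    _+_ _*_ : R → R → R
    _+_ = D._+_
    _*_ = D._*_

    -_ : R → R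
    -_ = D.-_

    seq : R → ℕ → ℚ
    seq = D.seq

    cauchy : ∀ x → D.Sequences.Cauchy (seq x)
    cauchy = D.cauchy

    _≤_ : R → R → Set
    x ≤ y = ∀ ε → 0ℚ Q.< ε → Ev (λ n → seq x n Q.≤ seq y n Q.+ ε)

  record _≈_ (x y : R) : Set where
    constructor both
    field
      to   : x ≤ y
      from : y ≤ x
  open _≈_ public

  _-_ : R → R → R
  x - y = x + - y

  0# 1# : R
  0# = ι 0ℚ
  1# = ι 1ℚ

  opaque
    unfolding R seq cauchy ι _+_ _*_ -_ _≤_

    pointwise-≤ : ∀ {x y : R} → (∀ n → seq x n Q.≤ seq y n) → x ≤ y
    pointwise-≤ {x} {y} f ε 0<ε = always λ n → ℚP.≤-trans (f n)
      (≤-by (ℚP.<⇒≤ 0<ε) (S.solve 2 (λ a b → a S.:+ b S.:- a S.:= b) ≡-refl (seq y n) ε))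

    pointwise : ∀ {x y : R} → (∀ n → seq x n ≡ seq y n) → x ≈ y
    pointwise {x} {y} f = both (pointwise-≤ {x} {y} (λ n → ℚP.≤-reflexive (f n)))
                               (pointwise-≤ {y} {x} (λ n → ℚP.≤-reflexive (≡-sym (f n))))

    ≤-refl : ∀ {x} → x ≤ x
    ≤-refl {x} = pointwise-≤ {x} {x} (λ n → ℚP.≤-refl)

    ≤-trans : ∀ {x y z} → x ≤ y → y ≤ z → x ≤ z
    ≤-trans {x} {y} {z} p q ε 0<ε = ev (p (½ Q.* ε) 0<ε/2 & q (½ Q.* ε) 0<ε/2)
      λ n (a , b) → ≤-by (0≤+ (0≤- a) (0≤- b))
        (S.solve 4 (λ a b c d → a S.:+ b S.:- c S.:= d S.:+ S.con ½ S.:* b S.:- c S.:+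
          (a S.:+ S.con ½ S.:* b S.:- d)) ≡-refl (seq z n) ε (seq x n) (seq y n))
      where
      0<ε/2 : 0ℚ Q.< ½ Q.* ε
      0<ε/2 = 0<* 0<½ 0<ε

    +-mono : ∀ {x y u v} → x ≤ y → u ≤ v → x + u ≤ y + v
    +-mono {x} {y} {u} {v} p q ε 0<ε = ev (p (½ Q.* ε) 0<ε/2 & q (½ Q.* ε) 0<ε/2)
      λ n (a , b) → ≤-by (0≤+ (0≤- a) (0≤- b))
        (S.solve 5 (λ a b c d e → a S.:+ b S.:+ c S.:- (d S.:+ e) S.:= a S.:+ S.con ½ S.:* c S.:- d S.:+
          (b S.:+ S.con ½ S.:* c S.:- e)) ≡-refl (seq y n) (seq v n) ε (seq x n) (seq u n))
      where
      0<ε/2 : 0ℚ Q.< ½ Q.* ε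
      0<ε/2 = 0<* 0<½ 0<ε

    neg-anti : ∀ {x y} → x ≤ y → - y ≤ - x
    neg-anti {x} {y} p ε 0<ε = ev (p ε 0<ε) λ n a → ≤-by (0≤- a)
      (S.solve 3 (λ a b c → (S.:- a) S.:+ b S.:- (S.:- c) S.:= c S.:+ b S.:- a) ≡-refl (seq x n) ε (seq y n))

    ι-mono : ∀ {p q} → p Q.≤ q → ι p ≤ ι q
    ι-mono {p} {q} p≤q = pointwise-≤ {ι p} {ι q} (λ _ → p≤q)

    ι-+ : ∀ p q → ι (p Q.+ q) ≈ ι p + ι q
    ι-+ p q = pointwise {ι (p Q.+ q)} {ι p + ι q} (λ _ → ≡-refl)

    ι-* : ∀ p q → ι (p Q.* q) ≈ ι p * ι q
    ι-* p q = pointwise {ι (p Q.* q)} {ι p * ι q} (λ _ → ≡-refl)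

    ι-neg : ∀ p → ι (Q.- p) ≈ - ι p
    ι-neg p = pointwise {ι (Q.- p)} { - ι p} (λ _ → ≡-refl)

    bound-seq : ∀ (x : R) → ∃[ B ] (0ℚ Q.< B × Ev (λ n → seq x n Q.≤ B × Q.- B Q.≤ seq x n))
    bound-seq x = B , ℚP.+-mono-<-≤ 0<1 (ℚP.0≤∣p∣ a) , N , λ n N≤n →
        ≤-by (0≤+ (0≤- (ℚP.≤-trans (≤∣∣ (seq x n Q.- a)) (ℚP.<⇒≤ (f n N N≤n ℕP.≤-refl)))) (0≤- (≤∣∣ a)))
          (S.solve 3 (λ a b c → S.con 1ℚ S.:+ a S.:- b S.:= S.con 1ℚ S.:- (b S.:- c) S.:+ (a S.:- c)) ≡-refl
            (Q.∣ seq x N ∣) (seq x n) (seq x N))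
      , ≤-by (0≤+ (0≤- (ℚP.≤-trans (-≤∣∣ (seq x n Q.- a)) (ℚP.<⇒≤ (f n N N≤n ℕP.≤-refl)))) (0≤- (-≤∣∣ a)))
          (S.solve 3 (λ a b c → a S.:- (S.:- (S.con 1ℚ S.:+ b)) S.:= S.con 1ℚ S.:- (S.:- (a S.:- c)) S.:+
            (b S.:- (S.:- c))) ≡-refl (seq x n) (Q.∣ seq x N ∣) (seq x N))
      where
      N : ℕ
      N = proj₁ (cauchy x 1ℚ 0<1)
      f : ∀ m n → N ℕ.≤ m → N ℕ.≤ n → Q.∣ seq x m Q.- seq x n ∣ Q.< 1ℚ
      f = proj₂ (cauchy x 1ℚ 0<1)
      a B : ℚ
      a = seq x N
      B = 1ℚ Q.+ Q.∣ a ∣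

    -- With terms at least `- δ`, the product `(x + δ) * (y + δ)` is nonnegative, so `x * y` is at
    -- least `- δ * (x + y + δ)`. The bounds `A` and `B` on the sequences then decide how small `δ`
    -- has to be.
    nonneg-* : ∀ {x y} → 0# ≤ x → 0# ≤ y → 0# ≤ x * y
    nonneg-* {x} {y} 0≤x 0≤y ε 0<ε =
      let A , 0<A , A-bd = bound-seq x
          B , 0<B , B-bd = bound-seq y
          δ , 0<δ , δ≤1 , Cδ≤ε = scale (A Q.+ B Q.+ 1ℚ) ε (0≤+ (0≤+ (ℚP.<⇒≤ 0<A) (ℚP.<⇒≤ 0<B)) 0≤1) 0<ε
      in ev (0≤x δ 0<δ & 0≤y δ 0<δ & A-bd & B-bd)
      λ n (p , q , (a , _) , (b , _)) → ≤-by
        (0≤+ (0≤+ (0≤+ (0≤+ (0≤* p q) (0≤- Cδ≤ε)) (0≤* (ℚP.<⇒≤ 0<δ) (0≤- a)))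
             (0≤* (ℚP.<⇒≤ 0<δ) (0≤- b))) (0≤* (ℚP.<⇒≤ 0<δ) (0≤- δ≤1)))
        (S.solve 6 (λ a b c d e f → a S.:* b S.:+ c S.:- S.con 0ℚ S.:= (a S.:+ d) S.:* (b S.:+ d) S.:+
          (c S.:- (e S.:+ f S.:+ S.con 1ℚ) S.:* d) S.:+ d S.:* (e S.:- a) S.:+ d S.:* (f S.:- b) S.:+ d S.:*
          (S.con 1ℚ S.:- d)) ≡-refl (seq x n) (seq y n) ε δ A B)

    sq-nonneg : ∀ x → 0# ≤ x * x
    sq-nonneg x = pointwise-≤ {0#} {x * x} (λ n → 0≤sq (seq x n))

    -- The sign of `z` is unknown, so both halves of the equality are used: `(y - x) * z + δ * B` is
    -- the average of `(y + δ - x) * (z + B)` and `(x + δ - y) * (B - z)`, whose factors are all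
    -- nonnegative.
    *-monoˡ-≈ : ∀ {x y} z → x ≈ y → x * z ≤ y * z
    *-monoˡ-≈ {x} {y} z (both x≤y y≤x) ε 0<ε =
      let B , 0<B , B-bd = bound-seq z
          δ , 0<δ , _ , Bδ≤ε = scale B ε (ℚP.<⇒≤ 0<B) 0<ε
      in ev (x≤y δ 0<δ & y≤x δ 0<δ & B-bd)
      λ n (p , q , (a , b)) → ≤-by
        (0≤+ (0≤* (ℚP.<⇒≤ 0<½) (0≤+ (0≤* (0≤- p) (0≤- b)) (0≤* (0≤- q) (0≤- a)))) (0≤- Bδ≤ε))
        (S.solve 6 (λ a b c d e f → a S.:* b S.:+ c S.:- d S.:* b S.:= S.con ½ S.:*
          ((a S.:+ e S.:- d) S.:* (b S.:- (S.:- f)) S.:+ (d S.:+ e S.:- a) S.:* (f S.:- b)) S.:+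
          (c S.:- f S.:* e)) ≡-refl (seq y n) (seq z n) ε (seq x n) δ B)

    -- Cancellation without forming a reciprocal of `c`: eventually `c` is at least `½ * δ`, and at
    -- each index the sign of the rational `seq x n + ε` can be decided.
    cancel-pos : ∀ {c x δ} → 0ℚ Q.< δ → ι δ ≤ c → 0# ≤ c * x → 0# ≤ x
    cancel-pos {c} {x} {δ} 0<δ δ≤c 0≤cx ε 0<ε =
      ev (δ≤c η 0<η & 0≤cx (η Q.* ε) (0<* 0<η 0<ε)) step
      where
      r : ℚ
      r = proj₁ (reciprocal (½ Q.* δ) (0<* 0<½ 0<δ))
      0<r : 0ℚ Q.< r
      0<r = proj₁ (proj₂ (reciprocal (½ Q.* δ) (0<* 0<½ 0<δ)))
      ηr≡1 : ½ Q.* δ Q.* r ≡ 1ℚ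
      ηr≡1 = proj₂ (proj₂ (reciprocal (½ Q.* δ) (0<* 0<½ 0<δ)))
      η : ℚ
      η = ½ Q.* δ
      0<η : 0ℚ Q.< η
      0<η = 0<* 0<½ 0<δ
      step : ∀ n → δ Q.≤ seq c n Q.+ η × 0ℚ Q.≤ seq c n Q.* seq x n Q.+ η Q.* ε →
             0ℚ Q.≤ seq x n Q.+ ε
      step n (p , q) with ℚP.≤-total 0ℚ (seq x n Q.+ ε)
      ... | inj₁ yes! = yes!
      -- Even in this case the nonnegative terms add up to `½ * δ * (seq x n + ε)`; the factor `r`,
      -- reciprocal to `½ * δ`, leaves `seq x n + ε`.
      ... | inj₂ no! = subst (0ℚ Q.≤_)
          (≡-trans (S.solve 5 (λ a b c d e → a S.:* (b S.:* c S.:+ S.con ½ S.:* d S.:* e S.:+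
            (b S.:+ S.con ½ S.:* d S.:- d) S.:* e S.:+ (b S.:+ S.con ½ S.:* d S.:- d) S.:*
            (S.con 0ℚ S.:- (c S.:+ e))) S.:= S.con ½ S.:* d S.:* a S.:* (c S.:+ e)) ≡-refl r (seq c n)
            (seq x n) δ ε)
            (≡-trans (cong (Q._* (seq x n Q.+ ε)) ηr≡1) (ℚP.*-identityˡ _)))
          (0≤* (ℚP.<⇒≤ 0<r) (0≤+ (0≤+ q (0≤* (0≤- p) (ℚP.<⇒≤ 0<ε))) (0≤* (0≤- p) (0≤- no!))))

    ≤-closed : ∀ {x y} → (∀ ε → 0ℚ Q.< ε → x ≤ y + ι ε) → x ≤ y
    ≤-closed {x} {y} f ε 0<ε = ev (f (½ Q.* ε) 0<ε/2 (½ Q.* ε) 0<ε/2)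
      λ n a → subst (seq x n Q.≤_) (S.solve 2 (λ a b → a S.:+ S.con ½ S.:* b S.:+ S.con ½ S.:* b S.:= a S.:+ b)
        ≡-refl (seq y n) ε) a
      where
      0<ε/2 : 0ℚ Q.< ½ Q.* ε
      0<ε/2 = 0<* 0<½ 0<ε

    bounded : ∀ x → ∃[ B ] (0ℚ Q.< B × x ≤ ι B × - ι B ≤ x)
    bounded x = let B , 0<B , bd = bound-seq x in B , 0<B
      , (λ ε 0<ε → ev bd λ n (a , _) → ℚP.≤-trans a
        (≤-by (ℚP.<⇒≤ 0<ε) (S.solve 2 (λ a b → a S.:+ b S.:- a S.:= b) ≡-refl B ε)))
      , (λ ε 0<ε → ev bd λ n (_ , b) → ℚP.≤-trans b
        (≤-by (ℚP.<⇒≤ 0<ε) (S.solve 2 (λ a b → a S.:+ b S.:- a S.:= b) ≡-refl (seq x n) ε)))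

    approx : ∀ (x : R) ε → 0ℚ Q.< ε →
             Ev (λ m → x ≤ ι (seq x m) + ι ε × ι (seq x m) ≤ x + ι ε)
    approx x ε 0<ε = let N , f = cauchy x ε 0<ε in N , λ m N≤m →
        (λ η 0<η → N , λ n N≤n → ≤-by
          (0≤+ (0≤- (ℚP.≤-trans (≤∣∣ (seq x n Q.- seq x m)) (ℚP.<⇒≤ (f n m N≤n N≤m)))) (ℚP.<⇒≤ 0<η))
          (S.solve 4 (λ a b c d → a S.:+ b S.:+ c S.:- d S.:= b S.:- (d S.:- a) S.:+ c) ≡-refl (seq x m) ε η
            (seq x n)))
      , (λ η 0<η → N , λ n N≤n → ≤-by
          (0≤+ (0≤- (ℚP.≤-trans (≤∣∣ (seq x m Q.- seq x n)) (ℚP.<⇒≤ (f m n N≤m N≤n)))) (ℚP.<⇒≤ 0<η))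
          (S.solve 4 (λ a b c d → a S.:+ b S.:+ c S.:- d S.:= b S.:- (d S.:- a) S.:+ c) ≡-refl (seq x n) ε η
            (seq x m)))

    +-assoc : ∀ x y z → (x + y) + z ≈ x + (y + z)
    +-assoc x y z = pointwise {(x + y) + z} {x + (y + z)} λ n → ℚP.+-assoc (seq x n) (seq y n) (seq z n)

    +-comm : ∀ x y → x + y ≈ y + x
    +-comm x y = pointwise {x + y} {y + x} λ n → ℚP.+-comm (seq x n) (seq y n)

    +-identityˡ : ∀ x → 0# + x ≈ x
    +-identityˡ x = pointwise {0# + x} {x} λ n → ℚP.+-identityˡ (seq x n)

    +-inverseˡ : ∀ x → - x + x ≈ 0#
    +-inverseˡ x = pointwise { - x + x} {0#} λ n → ℚP.+-inverseˡ (seq x n)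

    *-assoc : ∀ x y z → (x * y) * z ≈ x * (y * z)
    *-assoc x y z = pointwise {(x * y) * z} {x * (y * z)} λ n → ℚP.*-assoc (seq x n) (seq y n) (seq z n)

    *-comm : ∀ x y → x * y ≈ y * x
    *-comm x y = pointwise {x * y} {y * x} λ n → ℚP.*-comm (seq x n) (seq y n)

    *-identityˡ : ∀ x → 1# * x ≈ x
    *-identityˡ x = pointwise {1# * x} {x} λ n → ℚP.*-identityˡ (seq x n)

    *-distribˡ-+ : ∀ x y z → x * (y + z) ≈ x * y + x * z
    *-distribˡ-+ x y z = pointwise {x * (y + z)} {x * y + x * z} λ n →
      ℚP.*-distribˡ-+ (seq x n) (seq y n) (seq z n)

  refl : ∀ {x} → x ≈ x
  refl = both ≤-refl ≤-refl

  sym : ∀ {x y} → x ≈ y → y ≈ x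
  sym (both p q) = both q p

  trans : ∀ {x y z} → x ≈ y → y ≈ z → x ≈ z
  trans (both p q) (both r s) = both (≤-trans p r) (≤-trans s q)

  ≡⇒≈ : ∀ {x y} → x ≡ y → x ≈ y
  ≡⇒≈ ≡-refl = refl

  +-cong : ∀ {x y u v} → x ≈ y → u ≈ v → x + u ≈ y + v
  +-cong (both p q) (both r s) = both (+-mono p r) (+-mono q s)

  neg-cong : ∀ {x y} → x ≈ y → - x ≈ - y
  neg-cong (both p q) = both (neg-anti q) (neg-anti p)

  *-congʳ : ∀ {x y z} → x ≈ y → x * z ≈ y * z
  *-congʳ {z = z} e = both (*-monoˡ-≈ z e) (*-monoˡ-≈ z (sym e))

  *-cong : ∀ {x y u v} → x ≈ y → u ≈ v → x * u ≈ y * v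
  *-cong {y = y} {u} {v} e f = trans (*-congʳ e) (trans (*-comm y u) (trans (*-congʳ f) (*-comm v y)))

  -‿-cong : ∀ {x y u v} → x ≈ y → u ≈ v → x - u ≈ y - v
  -‿-cong e f = +-cong e (neg-cong f)

  isEquivalence : IsEquivalence _≈_
  isEquivalence = record { refl = refl ; sym = sym ; trans = trans }

  commutativeRing : CommutativeRing 0ℓ 0ℓ
  commutativeRing = record
    { Carrier = R ; _≈_ = _≈_ ; _+_ = _+_ ; _*_ = _*_ ; -_ = -_ ; 0# = 0# ; 1# = 1#
    ; isCommutativeRing = record
      { isRing = record
        { +-isAbelianGroup = record
          { isGroup = record
            { isMonoid = record
              { isSemigroup = record
                { isMagma = record { isEquivalence = isEquivalence ; ∙-cong = +-cong }
                ; assoc = +-assoc }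
              ; identity = +-identityˡ , λ x → trans (+-comm x 0#) (+-identityˡ x) }
            ; inverse = +-inverseˡ , (λ x → trans (+-comm x (- x)) (+-inverseˡ x))
            ; ⁻¹-cong = neg-cong }
          ; comm = +-comm }
        ; *-cong = *-cong
        ; *-assoc = *-assoc
        ; *-identity = *-identityˡ , (λ x → trans (*-comm x 1#) (*-identityˡ x))
        ; distrib = *-distribˡ-+ , λ x y z → trans (*-comm (y + z) x)
            (trans (*-distribˡ-+ x y z) (+-cong (*-comm x y) (*-comm x z)))
        }
      ; *-comm = *-comm } }

  private
    almost = fromCommutativeRing commutativeRing
    ι-morphism : Q.+-*-rawRing -Raw-AlmostCommutative⟶ almost
    ι-morphism = record { ⟦_⟧ = ι ; +-homo = ι-+ ; *-homo = ι-* ; -‿homo = ι-neg ; 0-homo = refl ; 1-homo =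
      refl }
    ι-≟ : ∀ p q → Maybe (ι p ≈ ι q)
    ι-≟ p q with p ℚP.≟ q
    ... | yes ≡-refl = just refl
    ... | no  _      = nothing

  module RealSolver = Algebra.Solver.Ring Q.+-*-rawRing almost ι-morphism ι-≟
  open RealSolver using (solve; _:+_; _:*_; _:-_; :-_; _:=_; con) public

  ≤-reflexive : ∀ {x y} → x ≈ y → x ≤ y
  ≤-reflexive = to

  0≤⇒≤ : ∀ {a b} → 0# ≤ b - a → a ≤ b
  0≤⇒≤ {a} {b} p = ≤-trans (to (solve 1 (λ a → a := con 0ℚ :+ a) refl a))
    (≤-trans (+-mono p ≤-refl) (to (solve 2 (λ a b → a :- b :+ b := a) refl b a)))

  by : ∀ {a b c} → 0# ≤ c → b - a ≈ c → a ≤ b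
  by p e = 0≤⇒≤ (≤-trans p (from e))

  nn : ∀ {a b} → a ≤ b → 0# ≤ b - a
  nn {a} {b} p = ≤-trans (to (solve 1 (λ a → con 0ℚ := a :- a) refl a)) (+-mono p ≤-refl)

  infixl 6 _nn+_
  infixl 7 _nn*_
  _nn+_ : ∀ {a b} → 0# ≤ a → 0# ≤ b → 0# ≤ a + b
  p nn+ q = ≤-trans (to (solve 0 (con 0ℚ := con 0ℚ :+ con 0ℚ) refl)) (+-mono p q)

  _nn*_ : ∀ {a b} → 0# ≤ a → 0# ≤ b → 0# ≤ a * b
  _nn*_ = nonneg-*

-- Absolute bounds, positivity and limits

module Bounds where
  open Reals public
  open import Relation.Binary.Bundles using (Preorder; Setoid)

  ≤-preorder : Preorder 0ℓ 0ℓ 0ℓ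
  ≤-preorder = record
    { Carrier = R ; _≈_ = _≈_ ; _≲_ = _≤_
    ; isPreorder = record { isEquivalence = isEquivalence ; reflexive = to ; trans = ≤-trans } }

  setoid : Setoid 0ℓ 0ℓ
  setoid = record { isEquivalence = isEquivalence }

  module ≈-Reasoning where
    open import Relation.Binary.Reasoning.Setoid setoid public

  module ≤-Reasoning where
    open import Relation.Binary.Reasoning.Preorder ≤-preorder public
      renaming (≲-go to ≤-go)

  ι0≤ : ∀ {q} → 0ℚ Q.≤ q → 0# ≤ ι q
  ι0≤ = ι-mono

  infix 4 _within_
  -- The bound `∣ x ∣ ≤ e`, split into halves because each half serves separately as a nonnegative
  -- factor.
  record _within_ (x e : R) : Set where
    constructor bounds
    field
      lower : - e ≤ x
      upper : x ≤ e
  open _within_ public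

  within-resp : ∀ {x y e} → x ≈ y → x within e → y within e
  within-resp x≈y (bounds l u) = bounds (≤-trans l (to x≈y)) (≤-trans (from x≈y) u)

  within-weaken : ∀ {x e f} → e ≤ f → x within e → x within f
  within-weaken e≤f (bounds l u) = bounds (≤-trans (neg-anti e≤f) l) (≤-trans u e≤f)

  within-+ : ∀ {x y e f} → x within e → y within f → x + y within e + f
  within-+ {e = e} {f} (bounds l u) (bounds l′ u′) =
    bounds (≤-trans (to (solve 2 (λ a b → (:- (a :+ b)) := (:- a) :+ (:- b)) refl e f)) (+-mono l l′))
      (+-mono u u′)

  within-neg : ∀ {x e} → x within e → - x within e
  within-neg {x} {e} (bounds l u) = bounds (neg-anti u)
    (≤-trans (neg-anti l) (to (solve 1 (λ a → (:- (:- a)) := a) refl e)))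

  ½-nn : 0# ≤ ι ½
  ½-nn = ι-mono (ℚP.<⇒≤ 0<½)

  within-* : ∀ {x y e f} → x within e → y within f → x * y within e * f
  within-* {x} {y} {e} {f} (bounds l u) (bounds l′ u′) = bounds
    (by (½-nn nn* (nn l nn* nn l′ nn+ nn u nn* nn u′))
      (solve 4 (λ a b c d → a :* b :- (:- (c :* d)) := con ½ :* ((a :- (:- c)) :* (b :- (:- d)) :+ (c :- a) :*
        (d :- b))) refl x y e f))
    (by (½-nn nn* (nn u nn* nn l′ nn+ nn l nn* nn u′))
      (solve 4 (λ a b c d → a :* b :- c :* d := con ½ :* ((a :- c) :* (d :- (:- b)) :+ (c :- (:- a)) :*
        (b :- d))) refl e f x y))

  within-self : ∀ {x} → 0# ≤ x → x within x
  within-self {x} p = bounds (by (p nn+ p) (solve 1 (λ a → a :- (:- a) := a :+ a) refl x)) ≤-refl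

  within-0 : ∀ {e} → 0# ≤ e → 0# within e
  within-0 {e} p = bounds (by p (solve 1 (λ a → con 0ℚ :- (:- a) := a) refl e)) p

  -- The lower bound is kept as data: cancellation and the apartness proofs of the statement consume
  -- it.
  Pos : R → Set
  Pos x = ∃[ δ ] (0ℚ Q.< δ × ι δ ≤ x)

  pos⇒nn : ∀ {x} → Pos x → 0# ≤ x
  pos⇒nn (δ , 0<δ , δ≤x) = ≤-trans (ι-mono (ℚP.<⇒≤ 0<δ)) δ≤x

  pos-mono : ∀ {x y} → x ≤ y → Pos x → Pos y
  pos-mono x≤y (δ , 0<δ , δ≤x) = δ , 0<δ , ≤-trans δ≤x x≤y

  pos-ι : ∀ {q} → 0ℚ Q.< q → Pos (ι q)
  pos-ι 0<q = _ , 0<q , ≤-refl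

  *-mono : ∀ {x y u v} → 0# ≤ x → 0# ≤ v → x ≤ y → u ≤ v → x * u ≤ y * v
  *-mono {x} {y} {u} {v} 0≤x 0≤v x≤y u≤v = by (0≤x nn* nn u≤v nn+ nn x≤y nn* 0≤v)
    (solve 4 (λ a b c d → a :* b :- c :* d := c :* (b :- d) :+ (a :- c) :* b) refl y v x u)

  pos-* : ∀ {x y} → Pos x → Pos y → Pos (x * y)
  pos-* {x} {y} (δ , 0<δ , δ≤x) (ε , 0<ε , ε≤y) = δ Q.* ε , 0<* 0<δ 0<ε ,
    ≤-trans (to (ι-* δ ε)) (*-mono (ι-mono (ℚP.<⇒≤ 0<δ)) (≤-trans (ι-mono (ℚP.<⇒≤ 0<ε)) ε≤y) δ≤x ε≤y)

  pos-cancel : ∀ {c a b} → Pos c → c * a ≤ c * b → a ≤ b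
  pos-cancel {c} {a} {b} (δ , 0<δ , δ≤c) p =
    0≤⇒≤ (cancel-pos 0<δ δ≤c (≤-trans (nn p) (to (solve 3 (λ a b c → a :* b :- a :* c := a :* (b :- c))
      refl c b a))))

  pos-cancel-≈ : ∀ {c a b} → Pos c → c * a ≈ c * b → a ≈ b
  pos-cancel-≈ p e = both (pos-cancel p (to e)) (pos-cancel p (from e))

  within-bounded : ∀ x → ∃[ B ] (0ℚ Q.< B × x within ι B)
  within-bounded x = let B , 0<B , u , l = bounded x in B , 0<B , bounds l u

  Lim : (ℕ → R) → R → Set
  Lim f L = ∀ ε → 0ℚ Q.< ε → Ev (λ m → f m - L within ι ε)

  lim-const : ∀ x → Lim (λ _ → x) x
  lim-const x ε 0<ε = always λ _ → within-resp (solve 1 (λ a → con 0ℚ := a :- a) refl x)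
    (within-0 (ι-mono (ℚP.<⇒≤ 0<ε)))

  lim-cong : ∀ {f g L K} → (∀ m → f m ≈ g m) → L ≈ K → Lim f L → Lim g K
  lim-cong e e′ p ε 0<ε = ev (p ε 0<ε) λ m → within-resp (-‿-cong (e m) e′)

  lim-+ : ∀ {f g L K} → Lim f L → Lim g K → Lim (λ m → f m + g m) (L + K)
  lim-+ {f} {g} {L} {K} p q ε 0<ε = ev (p (½ Q.* ε) (0<* 0<½ 0<ε) & q (½ Q.* ε) (0<* 0<½ 0<ε))
    λ m (a , b) → within-weaken
      (to (trans (sym (ι-+ (½ Q.* ε) (½ Q.* ε)))
        (≡⇒≈ (cong ι (S.solve 1 (λ a → S.con ½ S.:* a S.:+ S.con ½ S.:* a S.:= a) ≡-refl ε)))))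
      (within-resp (solve 4 (λ a b c d → a :- b :+ (c :- d) := a :+ c :- (b :+ d)) refl (f m) L (g m) K)
        (within-+ a b))

  lim-neg : ∀ {f L} → Lim f L → Lim (λ m → - f m) (- L)
  lim-neg {f} {L} p ε 0<ε = ev (p ε 0<ε) λ m a →
    within-resp (solve 2 (λ a b → (:- (a :- b)) := (:- a) :- (:- b)) refl (f m) L) (within-neg a)

  lim-- : ∀ {f g L K} → Lim f L → Lim g K → Lim (λ m → f m - g m) (L - K)
  lim-- p q = lim-+ p (lim-neg q)

  lim-* : ∀ {f g L K} → Lim f L → Lim g K → Lim (λ m → f m * g m) (L * K)
  lim-* {f} {g} {L} {K} p q ε 0<ε =
    let A , 0<A , a = within-bounded L
        B , 0<B , b = within-bounded K
        δ , 0<δ , δ≤1 , Cδ≤ε = scale (A Q.+ B Q.+ 1ℚ) ε (0≤+ (0≤+ (ℚP.<⇒≤ 0<A) (ℚP.<⇒≤ 0<B)) 0≤1) 0<ε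
    in ev (p δ 0<δ & q δ 0<δ) λ m (u , v) → within-weaken
      (by {c = ι δ * (1# - ι δ) + (ι ε - (ι A + ι B + 1#) * ι δ)}
          (ι-mono (ℚP.<⇒≤ 0<δ) nn* nn (ι-mono δ≤1) nn+
            nn (≤-trans (from (trans (ι-* _ δ) (*-congʳ (trans (ι-+ _ 1ℚ) (+-cong (ι-+ A B) refl)))))
              (ι-mono Cδ≤ε)))
          (solve 4 (λ a b c d → a :- (b :* b :+ c :* b :+ b :* d) := b :* (con 1ℚ :- b) :+
            (a :- (c :+ d :+ con 1ℚ) :* b)) refl (ι ε) (ι δ) (ι A) (ι B)))
      (within-resp (solve 4 (λ a b c d → (a :- b) :* (c :- d) :+ b :* (c :- d) :+ (a :- b) :* d := a :* c
        :- b :* d) refl (f m) L (g m) K)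
        (within-+ (within-+ (within-* u v) (within-* a v)) (within-* u b)))

  lim-≤ : ∀ {f g L K} → Ev (λ m → f m ≤ g m) → Lim f L → Lim g K → L ≤ K
  lim-≤ {f} {g} {L} {K} E p q = ≤-closed λ ε 0<ε →
    let N , h = E & p (½ Q.* ε) (0<* 0<½ 0<ε) & q (½ Q.* ε) (0<* 0<½ 0<ε)
        f≤g , a , b = h N ℕP.≤-refl
    in ≤-trans (by (nn f≤g nn+ nn (lower a) nn+ nn (upper b))
         (solve 5 (λ a b c d e → a :+ (b :+ b) :- c := d :- e :+ (e :- c :- (:- b)) :+ (b :- (d :- a))) refl K
           (ι (½ Q.* ε)) L (g N) (f N)))
       (+-mono ≤-refl (to (trans (sym (ι-+ (½ Q.* ε) (½ Q.* ε)))
         (≡⇒≈ (cong ι (S.solve 1 (λ a → S.con ½ S.:* a S.:+ S.con ½ S.:* a S.:= a) ≡-refl ε))))))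

  lim-within : ∀ {f e L} → Ev (λ m → f m - L within e m) → Lim e 0# → Lim f L
  lim-within {f} {e} {L} E p ε 0<ε = ev (E & p ε 0<ε) λ m (a , b) →
    within-weaken (≤-trans (to (solve 1 (λ a → a := a :- con 0ℚ) refl (e m))) (upper b)) a

  lim-inv : Lim (λ m → ι (inv m)) 0#
  lim-inv ε 0<ε = ev (inv-small ε 0<ε) λ m inv≤ε → within-weaken (ι-mono inv≤ε)
    (within-resp (solve 1 (λ a → a := a :- con 0ℚ) refl (ι (inv m))) (within-self (ι-mono (ℚP.<⇒≤ (0<inv m)))))

  lim-0* : ∀ {f} x → Lim f 0# → Lim (λ m → x * f m) 0#
  lim-0* x p = lim-cong (λ _ → refl) (solve 1 (λ a → a :* con 0ℚ := con 0ℚ) refl x) (lim-* (lim-const x) p)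

-- Addition theorems and remainders for exponential-type series

module PowerSeries where
  open Rationals
  open Q using (_+_; _*_; _-_; -_; _≤_; _<_; ∣_∣)
  open import Relation.Binary.PropositionalEquality using (sym; trans)
  open S using (solve; _:+_; _:*_; _:-_; :-_; _:=_; con)
  import Relation.Binary.PropositionalEquality as ≡
  open import Defs using (sinCoeff; cosCoeff)
  open Defs.Sequences using (Σ<; expTerm; expSum; cauchy-expSum; cauchy-const)

  Σ-cong : ∀ n {f g : ℕ → ℚ} → (∀ k → k ℕ.< n → f k ≡ g k) → Σ< n f ≡ Σ< n g
  Σ-cong zero    e = ≡-refl
  Σ-cong (suc n) e = cong₂ (λ a b → a + b) (Σ-cong n λ k k<n → e k (ℕP.m≤n⇒m≤1+n k<n)) (e n ℕP.≤-refl)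

  Σ-+ : ∀ n (f g : ℕ → ℚ) → Σ< n (λ k → f k + g k) ≡ Σ< n f + Σ< n g
  Σ-+ zero    f g = ≡-refl
  Σ-+ (suc n) f g = trans (cong (λ z → z + (f n + g n)) (Σ-+ n f g))
    (solve 4 (λ a b c d → a :+ b :+ (c :+ d) := a :+ c :+ (b :+ d)) ≡-refl (Σ< n f) (Σ< n g) (f n) (g n))

  Σ-* : ∀ n c (f : ℕ → ℚ) → Σ< n (λ k → c * f k) ≡ c * Σ< n f
  Σ-* zero    c f = sym (ℚP.*-zeroʳ c)
  Σ-* (suc n) c f = trans (cong (λ z → z + c * f n) (Σ-* n c f))
    (solve 3 (λ a b c → a :* b :+ a :* c := a :* (b :+ c)) ≡-refl c (Σ< n f) (f n))

  Σ-linear : ∀ n c (f : ℕ → ℚ) d (g : ℕ → ℚ) → Σ< n (λ k → c * f k + d * g k) ≡ c * Σ< n f + d * Σ< n g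
  Σ-linear n c f d g = trans (Σ-+ n (λ k → c * f k) (λ k → d * g k))
    (cong₂ (λ u v → u + v) (Σ-* n c f) (Σ-* n d g))

  Σ-front : ∀ n (f : ℕ → ℚ) → Σ< (suc n) f ≡ f 0 + Σ< n (λ k → f (suc k))
  Σ-front zero    f = solve 1 (λ a → con 0ℚ :+ a := a :+ con 0ℚ) ≡-refl (f 0)
  Σ-front (suc n) f = trans (cong (λ z → z + f (suc n)) (Σ-front n f)) (ℚP.+-assoc (f 0) _ _)

  ∣Σ∣-tail : ∀ (h g : ℕ → ℚ) → (∀ k → ∣ h k ∣ ≤ g k) → ∀ {a b} → a ℕ.≤ b →
             ∣ Σ< b h - Σ< a h ∣ ≤ Σ< b g - Σ< a g
  ∣Σ∣-tail h g h≤g {a} {b} a≤b = subst (λ z → ∣ Σ< z h - Σ< a h ∣ ≤ Σ< z g - Σ< a g) (ℕP.m∸n+n≡m a≤b)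
    (go (b ∸ a))
    where
    go : ∀ j → ∣ Σ< (j ℕ.+ a) h - Σ< a h ∣ ≤ Σ< (j ℕ.+ a) g - Σ< a g
    go zero = ℚP.≤-reflexive (trans (cong ∣_∣ (ℚP.+-inverseʳ (Σ< a h))) (sym (ℚP.+-inverseʳ (Σ< a g))))
    go (suc j) = begin
      ∣ Σ< m h + h m - Σ< a h ∣        ≡⟨ cong ∣_∣ (solve 3 (λ a b c → a :+ b :- c := a :- c :+ b) ≡-refl
        (Σ< m h) (h m) (Σ< a h)) ⟩
      ∣ Σ< m h - Σ< a h + h m ∣        ≤⟨ ℚP.∣p+q∣≤∣p∣+∣q∣ (Σ< m h - Σ< a h) (h m) ⟩
      ∣ Σ< m h - Σ< a h ∣ + ∣ h m ∣    ≤⟨ ℚP.+-mono-≤ (go j) (h≤g m) ⟩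
      Σ< m g - Σ< a g + g m            ≡⟨ solve 3 (λ a b c → a :- b :+ c := a :+ c :- b) ≡-refl (Σ< m g)
        (Σ< a g) (g m) ⟩
      Σ< m g + g m - Σ< a g            ∎
      where
      open ℚP.≤-Reasoning
      m : ℕ
      m = j ℕ.+ a

  ∣Σ∣≤ : ∀ n (h g : ℕ → ℚ) → (∀ k → k ℕ.< n → ∣ h k ∣ ≤ g k) → ∣ Σ< n h ∣ ≤ Σ< n g
  ∣Σ∣≤ zero    h g h≤g = ℚP.≤-refl
  ∣Σ∣≤ (suc n) h g h≤g = ℚP.≤-trans (ℚP.∣p+q∣≤∣p∣+∣q∣ (Σ< n h) (h n))
    (ℚP.+-mono-≤ (∣Σ∣≤ n h g λ k k<n → h≤g k (ℕP.m≤n⇒m≤1+n k<n)) (h≤g n ℕP.≤-refl))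

  ∣*∣≤ : ∀ {p q a b} → ∣ p ∣ ≤ a → ∣ q ∣ ≤ b → ∣ p * q ∣ ≤ a * b
  ∣*∣≤ {p} {q} {a} {b} p≤a q≤b = ℚP.≤-trans (ℚP.≤-reflexive (ℚP.∣p*q∣≡∣p∣*∣q∣ p q))
    (≤-by (0≤+ (0≤* (ℚP.≤-trans (ℚP.0≤∣p∣ p) p≤a) (0≤- q≤b)) (0≤* (0≤- p≤a) (ℚP.0≤∣p∣ q)))
      (solve 4 (λ a b c d → a :* b :- c :* d := a :* (b :- d) :+ (a :- c) :* d) ≡-refl a b (∣ p ∣) (∣ q ∣)))

  -- The exponential series.

  expTerm-suc : ∀ x k → # (suc k) * expTerm x (suc k) ≡ x * expTerm x k
  expTerm-suc x k = trans (solve 4 (λ a b c d → a :* (b :* c :* d) := d :* a :* (c :* b)) ≡-refl (# (suc k))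
    (expTerm x k) x (inv k))
    (trans (cong (λ z → z * (x * expTerm x k)) (inv-suc k)) (ℚP.*-identityˡ (x * expTerm x k)))

  -- The binomial theorem in divided form. In place of binomial coefficients, the induction puts the
  -- weight `suc k = j + (suc k - j)` on each term: the part `# j` turns `X j` into `x` times its
  -- predecessor, the other part does the same for `Y`.
  expTerm-+ : ∀ x y k → expTerm (x + y) k ≡ Σ< (suc k) (λ j → expTerm x j * expTerm y (k ∸ j))
  expTerm-+ x y zero = ≡-refl
  expTerm-+ x y (suc k) = begin
    expTerm (x + y) k * (x + y) * inv k  ≡⟨ cong (λ z → z * (x + y) * inv k) (expTerm-+ x y k) ⟩
    C k * (x + y) * inv k                ≡⟨ solve 4 (λ a b c d → a :* (b :+ c) :* d := (b :* a :+ c :* a) :* d)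
      ≡-refl (C k) x y (inv k) ⟩
    (x * C k + y * C k) * inv k          ≡⟨ cong₂ (λ a b → (a + b) * inv k) left right ⟨
    (Σ< (suc (suc k)) (λ j → (# j * X j) * Y (suc k ∸ j)) + Σ< (suc (suc k))
      (λ j → X j * (# (suc k ∸ j) * Y (suc k ∸ j)))) * inv k
      ≡⟨ cong (λ z → z * inv k) (Σ-+ (suc (suc k)) (λ j → (# j * X j) * Y (suc k ∸ j))
        (λ j → X j * (# (suc k ∸ j) * Y (suc k ∸ j)))) ⟨
    Σ< (suc (suc k)) (λ j → (# j * X j) * Y (suc k ∸ j) + X j * (# (suc k ∸ j) * Y (suc k ∸ j))) * inv k
      ≡⟨ cong (λ z → z * inv k) (Σ-cong (suc (suc k)) weights) ⟩
    Σ< (suc (suc k)) (λ j → # (suc k) * (X j * Y (suc k ∸ j))) * inv k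
      ≡⟨ cong (λ z → z * inv k) (Σ-* (suc (suc k)) (# (suc k)) (λ j → X j * Y (suc k ∸ j))) ⟩
    # (suc k) * C (suc k) * inv k        ≡⟨ solve 3 (λ a b c → a :* b :* c := c :* a :* b) ≡-refl (# (suc k))
      (C (suc k)) (inv k) ⟩
    inv k * # (suc k) * C (suc k)        ≡⟨ cong (λ z → z * C (suc k)) (inv-suc k) ⟩
    1ℚ * C (suc k)                       ≡⟨ ℚP.*-identityˡ (C (suc k)) ⟩
    C (suc k)                            ∎
    where
    open ≡.≡-Reasoning
    X Y C : ℕ → ℚ
    X = expTerm x
    Y = expTerm y
    C k = Σ< (suc k) (λ j → X j * Y (k ∸ j))
    left : Σ< (suc (suc k)) (λ j → (# j * X j) * Y (suc k ∸ j)) ≡ x * C k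
    left = trans (Σ-front (suc k) _) (trans (cong (λ z → # 0 * X 0 * Y (suc k) + z)
      (trans (Σ-cong (suc k) λ j _ → trans (cong (λ z → z * Y (k ∸ j)) (expTerm-suc x j))
        (ℚP.*-assoc x (X j) (Y (k ∸ j))))
             (Σ-* (suc k) x (λ j → X j * Y (k ∸ j)))))
      (solve 4 (λ a b c d → con 0ℚ :* a :* b :+ c :* d := c :* d) ≡-refl (X 0) (Y (suc k)) x (C k)))
    right : Σ< (suc (suc k)) (λ j → X j * (# (suc k ∸ j) * Y (suc k ∸ j))) ≡ y * C k
    right = trans (cong₂ (λ a b → a + X (suc k) * (# b * Y b))
        (trans (Σ-cong (suc k) λ j j≤k → trans (cong (λ z → X j * (# z * Y z)) (ℕP.+-∸-assoc 1 (ℕP.≤-pred j≤k)))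
                 (trans (cong (λ z → X j * z) (expTerm-suc y (k ∸ j)))
                   (solve 3 (λ a b c → a :* (b :* c) := b :* (a :* c)) ≡-refl (X j) y (Y (k ∸ j)))))
               (Σ-* (suc k) y (λ j → X j * Y (k ∸ j))))
        (ℕP.n∸n≡0 (suc k)))
      (solve 4 (λ a b c d → a :* b :+ c :* (con 0ℚ :* d) := a :* b) ≡-refl y (C k) (X (suc k)) (Y 0))
    weights : ∀ j → j ℕ.< suc (suc k) → (# j * X j) * Y (suc k ∸ j) + X j * (# (suc k ∸ j) * Y (suc k ∸ j))
                  ≡ # (suc k) * (X j * Y (suc k ∸ j))
    weights j j≤ = trans (solve 4 (λ a b c d → a :* b :* c :+ b :* (d :* c) := (a :+ d) :* (b :* c)) ≡-refl
      (# j) (X j) (Y (suc k ∸ j)) (# (suc k ∸ j)))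
      (cong (λ z → z * (X j * Y (suc k ∸ j)))
        (trans (sym (#-+ j (suc k ∸ j))) (cong # (ℕP.m+[n∸m]≡n (ℕP.≤-pred j≤)))))

  -- `square` is what products of partial sums yield. `triangle` retains the terms with `j + l < n`,
  -- which regroup into the partial sum at `x + y`.
  triangle square : (ℕ → ℚ) → ℚ → ℚ → ℕ → ℚ
  triangle e x y n = Σ< n (λ j → expTerm x j * Σ< (n ∸ j) (λ l → e (j ℕ.+ l) * expTerm y l))
  square   e x y n = Σ< n (λ j → expTerm x j * Σ< n (λ l → e (j ℕ.+ l) * expTerm y l))

  triangle≡expSum : ∀ e x y n → triangle e x y n ≡ expSum e (x + y) n
  triangle≡expSum e x y zero = ≡-refl
  triangle≡expSum e x y (suc n) = begin
    Σ< n (λ j → X j * Σ< (suc n ∸ j) (h j)) + X n * Σ< (suc n ∸ n) (h n)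
      ≡⟨ cong₂ (λ a b → a + b) (Σ-cong n row) last ⟩
    Σ< n (λ j → X j * Σ< (n ∸ j) (h j) + e n * (X j * Y (n ∸ j))) + e n * (X n * Y (n ∸ n))
      ≡⟨ cong (λ z → z + e n * (X n * Y (n ∸ n)))
        (Σ-+ n (λ j → X j * Σ< (n ∸ j) (h j)) (λ j → e n * (X j * Y (n ∸ j)))) ⟩
    triangle e x y n + Σ< n (λ j → e n * (X j * Y (n ∸ j))) + e n * (X n * Y (n ∸ n))
      ≡⟨ ℚP.+-assoc (triangle e x y n) _ _ ⟩
    triangle e x y n + Σ< (suc n) (λ j → e n * (X j * Y (n ∸ j)))
      ≡⟨ cong₂ (λ a b → a + b) (triangle≡expSum e x y n)
           (trans (Σ-* (suc n) (e n) (λ j → X j * Y (n ∸ j))) (cong (λ z → e n * z) (sym (expTerm-+ x y n)))) ⟩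
    expSum e (x + y) (suc n) ∎
    where
    open ≡.≡-Reasoning
    X Y : ℕ → ℚ
    X = expTerm x
    Y = expTerm y
    h : ℕ → ℕ → ℚ
    h j l = e (j ℕ.+ l) * Y l
    row : ∀ j → j ℕ.< n → X j * Σ< (suc n ∸ j) (h j) ≡ X j * Σ< (n ∸ j) (h j) + e n * (X j * Y (n ∸ j))
    row j j<n = trans (cong (λ z → X j * Σ< z (h j)) (ℕP.+-∸-assoc 1 (ℕP.<⇒≤ j<n)))
      (trans (cong (λ z → X j * (Σ< (n ∸ j) (h j) + e z * Y (n ∸ j))) (ℕP.m+[n∸m]≡n (ℕP.<⇒≤ j<n)))
        (solve 4 (λ a b c d → a :* (b :+ c :* d) := a :* b :+ c :* (a :* d)) ≡-refl (X j) (Σ< (n ∸ j) (h j))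
          (e n) (Y (n ∸ j))))
    last : X n * Σ< (suc n ∸ n) (h n) ≡ e n * (X n * Y (n ∸ n))
    last = trans (cong (λ z → X n * Σ< z (h n)) (ℕP.m+n∸n≡m 1 n))
      (trans (cong₂ (λ a b → X n * (0ℚ + e a * Y b)) (ℕP.+-identityʳ n) (sym (ℕP.n∸n≡0 n)))
        (solve 3 (λ a b c → a :* (con 0ℚ :+ b :* c) := b :* (a :* c)) ≡-refl (X n) (e n) (Y (n ∸ n))))

  -- Serves the three addition theorems at once, with `σ` equal to 0 for `exp`, to -1 for `cos` and
  -- to 1 for `sin`.
  square-split : ∀ e a b c d σ → (∀ j l → e (j ℕ.+ l) ≡ a j * b l + σ * (c j * d l)) → ∀ x y n →
    square e x y n ≡ expSum a x n * expSum b y n + σ * (expSum c x n * expSum d y n)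
  square-split e a b c d σ split x y n = begin
    square e x y n
      ≡⟨ Σ-cong n (λ j _ → trans (cong (λ z → X j * z) (inner j))
           (solve 6 (λ a b c d e f → a :* (b :* c :+ d :* e :* f) := c :* (b :* a) :+ d :* f :* (e :* a)) ≡-refl
             (X j) (a j) (expSum b y n) σ (c j) (expSum d y n))) ⟩
    Σ< n (λ j → expSum b y n * (a j * X j) + σ * expSum d y n * (c j * X j))
      ≡⟨ Σ-linear n (expSum b y n) (λ j → a j * X j) (σ * expSum d y n) (λ j → c j * X j) ⟩
    expSum b y n * expSum a x n + σ * expSum d y n * expSum c x n
      ≡⟨ solve 5 (λ a b c d e → a :* b :+ c :* d :* e := b :* a :+ c :* (e :* d)) ≡-refl (expSum b y n)
        (expSum a x n) σ (expSum d y n) (expSum c x n) ⟩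
    expSum a x n * expSum b y n + σ * (expSum c x n * expSum d y n) ∎
    where
    open ≡.≡-Reasoning
    X Y : ℕ → ℚ
    X = expTerm x
    Y = expTerm y
    inner : ∀ j → Σ< n (λ l → e (j ℕ.+ l) * Y l) ≡ a j * expSum b y n + σ * c j * expSum d y n
    inner j = trans (Σ-cong n (λ l _ → trans (cong (λ z → z * Y l) (split j l))
        (solve 6 (λ a b c d e f → (a :* b :+ c :* (d :* e)) :* f := a :* (b :* f) :+ c :* d :* (e :* f)) ≡-refl
          (a j) (b l) σ (c j) (d l) (Y l))))
      (Σ-linear n (a j) (λ l → b l * Y l) (σ * c j) (λ l → d l * Y l))

  expTerm-nonneg : ∀ {B} → 0ℚ ≤ B → ∀ k → 0ℚ ≤ expTerm B k
  expTerm-nonneg 0≤B zero    = 0≤1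
  expTerm-nonneg 0≤B (suc k) = 0≤* (0≤* (expTerm-nonneg 0≤B k) 0≤B) (ℚP.<⇒≤ (0<inv k))

  ∣expTerm∣≤ : ∀ {a B} → ∣ a ∣ ≤ B → ∀ k → ∣ expTerm a k ∣ ≤ expTerm B k
  ∣expTerm∣≤ a≤B zero    = ℚP.≤-refl
  ∣expTerm∣≤ a≤B (suc k) = ∣*∣≤ (∣*∣≤ (∣expTerm∣≤ a≤B k) a≤B) (ℚP.≤-reflexive (ℚP.0≤p⇒∣p∣≡p (ℚP.<⇒≤ (0<inv k))))

  ∣coeff*expTerm∣≤ : ∀ {q a B} → ∣ q ∣ ≤ 1ℚ → ∣ a ∣ ≤ B → ∀ k → ∣ q * expTerm a k ∣ ≤ expTerm B k
  ∣coeff*expTerm∣≤ {q} {a} {B} q≤1 a≤B k = subst (∣ q * expTerm a k ∣ ≤_) (ℚP.*-identityˡ (expTerm B k))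
    (∣*∣≤ q≤1 (∣expTerm∣≤ a≤B k))

  module _ (B : ℚ) (0≤B : 0ℚ ≤ B) where
    private
      b E : ℕ → ℚ
      b = expTerm B
      E n = Σ< n b

      E-step : ∀ {m n} → m ℕ.≤ n → E m ≤ E n
      E-step {m} {n} m≤n = ≤-by (ℚP.≤-trans (ℚP.0≤∣p∣ _)
        (∣Σ∣-tail b b (λ k → ℚP.≤-reflexive (ℚP.0≤p⇒∣p∣≡p (expTerm-nonneg 0≤B k))) m≤n)) ≡-refl

      E-nonneg : ∀ n → 0ℚ ≤ E n
      E-nonneg n = E-step {0} {n} ℕ.z≤n

      E-cauchy : ∀ ε → 0ℚ < ε → ∃[ N ] ∀ m n → N ℕ.≤ m → N ℕ.≤ n → E m - E n ≤ ε
      E-cauchy ε 0<ε = let N , f = cauchy-expSum (λ _ → 1ℚ) (λ _ → ℚP.≤-refl) (λ _ → B) (cauchy-const B) ε 0<ε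
                             in
        N , λ m n N≤m N≤n → ℚP.≤-trans (≤∣∣ (E m - E n))
          (subst (_≤ ε) (cong₂ (λ u v → ∣ u - v ∣) (one m) (one n)) (ℚP.<⇒≤ (f m n N≤m N≤n)))
        where
        one : ∀ n → expSum (λ _ → 1ℚ) B n ≡ E n
        one n = Σ-cong n λ k _ → ℚP.*-identityˡ (b k)

      E-bounded : ∃[ G ] (0ℚ ≤ G × ∀ n → E n ≤ G)
      E-bounded = let N , f = E-cauchy 1ℚ 0<1 in E N + 1ℚ , 0≤+ (E-nonneg N) 0≤1 , λ n →
        ℚP.≤-trans (E-step (ℕP.m≤m⊔n n N))
          (≤-by (0≤- (f (n ℕ.⊔ N) N (ℕP.m≤n⊔m n N) ℕP.≤-refl))
            (solve 2 (λ a b → a :+ con 1ℚ :- b := con 1ℚ :- (b :- a)) ≡-refl (E N) (E (n ℕ.⊔ N))))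

    module _ (e : ℕ → ℚ) (∣e∣≤1 : ∀ k → ∣ e k ∣ ≤ 1ℚ) where
      -- Row `j` of the square exceeds that of the triangle by the terms with `n - j ≤ l < n`, a
      -- stretch of a series dominated by the one with partial sums `E`.
      square-triangle : ∀ x y → ∣ x ∣ ≤ B → ∣ y ∣ ≤ B → ∀ n →
        ∣ square e x y n - triangle e x y n ∣ ≤ Σ< n (λ j → b j * (E n - E (n ∸ j)))
      square-triangle x y x≤B y≤B n = begin
        ∣ square e x y n - triangle e x y n ∣
          ≡⟨ cong ∣_∣ (trans (solve 2 (λ a b → a :- b := con 1ℚ :* a :+ (:- (con 1ℚ)) :* b) ≡-refl
            (square e x y n) (triangle e x y n))
                (sym (Σ-linear n 1ℚ (λ j → X j * Σ< n (h j)) (- 1ℚ) (λ j → X j * Σ< (n ∸ j) (h j))))) ⟩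
        ∣ Σ< n (λ j → 1ℚ * (X j * Σ< n (h j)) + - 1ℚ * (X j * Σ< (n ∸ j) (h j))) ∣
          ≤⟨ ∣Σ∣≤ n _ _ (λ j _ → subst (λ z → ∣ z ∣ ≤ b j * (E n - E (n ∸ j)))
               (solve 3 (λ a b c → a :* (b :- c) := con 1ℚ :* (a :* b) :+ (:- (con 1ℚ)) :* (a :* c)) ≡-refl
                 (X j) (Σ< n (h j)) (Σ< (n ∸ j) (h j)))
               (∣*∣≤ (∣expTerm∣≤ x≤B j) (∣Σ∣-tail (h j) b (λ l → ∣coeff*expTerm∣≤ (∣e∣≤1 (j ℕ.+ l)) y≤B l)
                 (ℕP.m∸n≤m n j)))) ⟩
        Σ< n (λ j → b j * (E n - E (n ∸ j))) ∎
        where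
        open ℚP.≤-Reasoning
        X : ℕ → ℚ
        X = expTerm x
        h : ℕ → ℕ → ℚ
        h j l = e (j ℕ.+ l) * expTerm y l

      -- For j < p the gap E n - E (n - j) is small, for j ≥ p the weights b j are.
      module Gap (n p : ℕ) (η : ℚ) (p+p≤n : p ℕ.+ p ℕ.≤ n)
                 (close : ∀ m n → p ℕ.≤ m → p ℕ.≤ n → E m - E n ≤ η) where
        W : ℕ → ℚ
        W j = b j * (E n - E (n ∸ j))
        p≤n : p ℕ.≤ n
        p≤n = ℕP.≤-trans (ℕP.m≤m+n p p) p+p≤n
        head : ∀ i → i ℕ.≤ p → Σ< i W ≤ η * E i
        head zero    _   = ℚP.≤-reflexive (sym (ℚP.*-zeroʳ η))
        head (suc i) i<p = ≤-by
          (0≤+ (0≤- (head i (ℕP.<⇒≤ i<p)))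
               (0≤* (expTerm-nonneg 0≤B i)
                 (0≤- (close n (n ∸ i) p≤n
                   (ℕP.m+n≤o⇒m≤o∸n p (ℕP.≤-trans (ℕP.+-monoʳ-≤ p (ℕP.<⇒≤ i<p)) p+p≤n))))))
          (solve 6 (λ a b c d e f → a :* (b :+ c) :- (d :+ c :* (e :- f)) := a :* b :- d :+ c :*
            (a :- (e :- f))) ≡-refl η (E i) (b i) (Σ< i W) (E n) (E (n ∸ i)))
        tail : ∀ i → Σ< (i ℕ.+ p) W ≤ η * E p + E n * (E (i ℕ.+ p) - E p)
        tail zero    = ℚP.≤-trans (head p ℕP.≤-refl)
          (ℚP.≤-reflexive (solve 3 (λ a b c → a :* b := a :* b :+ c :* (b :- b)) ≡-refl η (E p) (E n)))
        tail (suc i) = ≤-by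
          (0≤+ (0≤- (tail i)) (0≤* (expTerm-nonneg 0≤B m) (E-nonneg (n ∸ m))))
          (solve 7 (λ a b c d e f g → a :* b :+ c :* (d :+ e :- b) :- (f :+ e :* (c :- g)) := a :* b :+ c :*
            (d :- b) :- f :+ e :* g) ≡-refl η (E p) (E n) (E m) (b m) (Σ< m W) (E (n ∸ m)))
          where
          m : ℕ
          m = i ℕ.+ p
        total : Σ< n W ≤ η * E p + E n * (E n - E p)
        total = subst (λ z → Σ< z W ≤ η * E p + E n * (E z - E p)) (ℕP.m∸n+n≡m p≤n) (tail (n ∸ p))

      gap-small : ∀ ε → 0ℚ < ε → ∃[ N ] ∀ n → N ℕ.≤ n → Σ< n (λ j → b j * (E n - E (n ∸ j))) ≤ ε
      gap-small ε 0<ε =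
        let G , 0≤G , E≤G = E-bounded
            η , 0<η , _ , Gη≤ε = scale (G + G) ε (0≤+ 0≤G 0≤G) 0<ε
            p , close = E-cauchy η 0<η
        in p ℕ.+ p , λ n 2p≤n →
          let open Gap n p η 2p≤n close in
          ℚP.≤-trans total
               (≤-by (0≤+ (0≤+ (0≤- Gη≤ε) (0≤* (ℚP.<⇒≤ 0<η) (0≤- (E≤G p))))
                       (0≤+ (0≤* (E-nonneg n) (0≤- (close n p p≤n ℕP.≤-refl)))
                         (0≤* (ℚP.<⇒≤ 0<η) (0≤- (E≤G n)))))
                 (solve 5 (λ a b c d e → a :- (b :* c :+ d :* (d :- c)) := a :- (e :+ e) :* b :+ b :* (e :- c)
                   :+ (d :* (b :- (d :- c)) :+ b :* (e :- d))) ≡-refl ε η (E p) (E n) G))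

      -- Uniformity in `x` and `y` is essential: for real arguments the rationals `seq x n` and
      -- `seq y n` move along with the truncation index `n`.
      expSum-+ : ∀ ε → 0ℚ < ε → ∃[ N ] ∀ n → N ℕ.≤ n → ∀ x y → ∣ x ∣ ≤ B → ∣ y ∣ ≤ B →
                 ∣ expSum e (x + y) n - square e x y n ∣ ≤ ε
      expSum-+ ε 0<ε = let N , f = gap-small ε 0<ε in N , λ n N≤n x y x≤B y≤B →
        subst (_≤ ε) (trans (∣-∣-comm (square e x y n) (triangle e x y n))
          (cong (λ z → ∣ z - square e x y n ∣) (triangle≡expSum e x y n)))
          (ℚP.≤-trans (square-triangle x y x≤B y≤B n) (f n N≤n))

  sinCoeff-suc : ∀ l → sinCoeff (suc l) ≡ cosCoeff l
  sinCoeff-suc 0 = ≡-refl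
  sinCoeff-suc 1 = ≡-refl
  sinCoeff-suc (suc (suc l)) = cong -_ (sinCoeff-suc l)

  cosCoeff-suc : ∀ l → cosCoeff (suc l) ≡ - sinCoeff l
  cosCoeff-suc 0 = ≡-refl
  cosCoeff-suc 1 = ≡-refl
  cosCoeff-suc (suc (suc l)) = cong -_ (cosCoeff-suc l)

  cosCoeff-+ : ∀ j l → cosCoeff (j ℕ.+ l) ≡ cosCoeff j * cosCoeff l + - 1ℚ * (sinCoeff j * sinCoeff l)
  cosCoeff-+ 0 l = solve 2 (λ a b → a := con 1ℚ :* a :+ (:- (con 1ℚ)) :* (con 0ℚ :* b)) ≡-refl (cosCoeff l)
    (sinCoeff l)
  cosCoeff-+ 1 l = trans (cosCoeff-suc l) (solve 2 (λ a b → (:- a) := con 0ℚ :* b :+ (:- (con 1ℚ)) :*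
    (con 1ℚ :* a)) ≡-refl (sinCoeff l) (cosCoeff l))
  cosCoeff-+ (suc (suc j)) l = trans (cong -_ (cosCoeff-+ j l))
    (solve 4 (λ a b c d → (:- (a :* b :+ (:- (con 1ℚ)) :* (c :* d))) := (:- a) :* b :+ (:- (con 1ℚ)) :*
      ((:- c) :* d)) ≡-refl (cosCoeff j) (cosCoeff l) (sinCoeff j) (sinCoeff l))

  sinCoeff-+ : ∀ j l → sinCoeff (j ℕ.+ l) ≡ sinCoeff j * cosCoeff l + 1ℚ * (cosCoeff j * sinCoeff l)
  sinCoeff-+ 0 l = solve 2 (λ a b → a := con 0ℚ :* b :+ con 1ℚ :* (con 1ℚ :* a)) ≡-refl (sinCoeff l)
    (cosCoeff l)
  sinCoeff-+ 1 l = trans (sinCoeff-suc l) (solve 2 (λ a b → a := con 1ℚ :* a :+ con 1ℚ :* (con 0ℚ :* b)) ≡-refl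
    (cosCoeff l) (sinCoeff l))
  sinCoeff-+ (suc (suc j)) l = trans (cong -_ (sinCoeff-+ j l))
    (solve 4 (λ a b c d → (:- (a :* b :+ con 1ℚ :* (c :* d))) := (:- a) :* b :+ con 1ℚ :* ((:- c) :* d)) ≡-refl
      (sinCoeff j) (cosCoeff l) (cosCoeff j) (sinCoeff l))

  one : ℕ → ℚ
  one _ = 1ℚ

  exp-square : ∀ x y n → expSum one x n * expSum one y n ≡ square one x y n
  exp-square x y n = trans
    (solve 2 (λ a b → a :* b := a :* b :+ con 0ℚ :* (a :* b)) ≡-refl (expSum one x n) (expSum one y n))
    (sym (square-split one one one one one 0ℚ (λ _ _ → ≡-refl) x y n))

  cos-square : ∀ x y n → expSum cosCoeff x n * expSum cosCoeff y n + -
    (expSum sinCoeff x n * expSum sinCoeff y n)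
                       ≡ square cosCoeff x y n
  cos-square x y n = trans
    (solve 4 (λ a b c d → a :* b :+ (:- (c :* d)) := a :* b :+ (:- (con 1ℚ)) :* (c :* d)) ≡-refl
      (expSum cosCoeff x n) (expSum cosCoeff y n) (expSum sinCoeff x n) (expSum sinCoeff y n))
    (sym (square-split cosCoeff cosCoeff cosCoeff sinCoeff sinCoeff (- 1ℚ) cosCoeff-+ x y n))

  sin-square : ∀ x y n → expSum sinCoeff x n * expSum cosCoeff y n + expSum cosCoeff x n * expSum sinCoeff y n
                       ≡ square sinCoeff x y n
  sin-square x y n = trans
    (solve 4 (λ a b c d → a :* b :+ c :* d := a :* b :+ con 1ℚ :* (c :* d)) ≡-refl (expSum sinCoeff x n)
      (expSum cosCoeff y n) (expSum cosCoeff x n) (expSum sinCoeff y n))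
    (sym (square-split sinCoeff sinCoeff cosCoeff cosCoeff sinCoeff 1ℚ sinCoeff-+ x y n))

  expSum-even : ∀ q n → expSum cosCoeff (- q) n ≡ expSum cosCoeff q n
  expSum-even q n = Σ-cong n (λ k _ → term k)
    where
    term : ∀ k → cosCoeff k * expTerm (- q) k ≡ cosCoeff k * expTerm q k
    term 0 = ≡-refl
    term 1 = trans (ℚP.*-zeroˡ (expTerm (- q) 1)) (sym (ℚP.*-zeroˡ (expTerm q 1)))
    term (suc (suc k)) = trans
      (solve 5 (λ a b c d e → (:- a) :* (b :* (:- c) :* d :* (:- c) :* e) := (:- (a :* b :* c :* d :* c :* e)))
        ≡-refl (cosCoeff k) (expTerm (- q) k) q (inv k) (inv (suc k)))
      (trans (cong (λ z → - (z * q * inv k * q * inv (suc k))) (term k))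
        (solve 5 (λ a b c d e → (:- (a :* b :* c :* d :* c :* e)) := (:- a) :* (b :* c :* d :* c :* e)) ≡-refl
          (cosCoeff k) (expTerm q k) q (inv k) (inv (suc k))))

  expSum-odd : ∀ q n → expSum sinCoeff (- q) n ≡ - expSum sinCoeff q n
  expSum-odd q n = trans (Σ-cong n (λ k _ → term k)) (trans (Σ-* n (- 1ℚ) (λ k → sinCoeff k * expTerm q k))
    (solve 1 (λ a → (:- (con 1ℚ)) :* a := (:- a)) ≡-refl (expSum sinCoeff q n)))
    where
    term : ∀ k → sinCoeff k * expTerm (- q) k ≡ - 1ℚ * (sinCoeff k * expTerm q k)
    term 0 = ≡-refl
    term 1 = solve 2 (λ a b → con 1ℚ :* (con 1ℚ :* (:- a) :* b) := (:- (con 1ℚ)) :*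
      (con 1ℚ :* (con 1ℚ :* a :* b))) ≡-refl q (inv 0)
    term (suc (suc k)) = trans
      (solve 5 (λ a b c d e → (:- a) :* (b :* (:- c) :* d :* (:- c) :* e) := (:- (a :* b :* c :* d :* c :* e)))
        ≡-refl (sinCoeff k) (expTerm (- q) k) q (inv k) (inv (suc k)))
      (trans (cong (λ z → - (z * q * inv k * q * inv (suc k))) (term k))
        (solve 5 (λ a b c d e → (:- ((:- (con 1ℚ)) :* (a :* b) :* c :* d :* c :* e)) := (:- (con 1ℚ)) :*
          ((:- a) :* (b :* c :* d :* c :* e))) ≡-refl (sinCoeff k) (expTerm q k) q (inv k) (inv (suc k))))

  -- A real within 1 has terms that are eventually within 3/2, but possibly never within 1. From
  -- `k = 2` on, the ratio of consecutive terms is then still at most 3/2 times 1/3.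
  module _ (q : ℚ) (∣q∣≤3/2 : ∣ q ∣ ≤ + 3 Q./ 2) where
    private
      b : ℕ → ℚ
      b = expTerm ∣ q ∣

      inv≤⅓ : ∀ k → inv (suc (suc k)) ≤ + 1 Q./ 3
      inv≤⅓ k = inv-anti {2} {suc (suc k)} (ℕ.s≤s (ℕ.s≤s ℕ.z≤n))

      halving : ∀ k → 2 ℕ.≤ k → b (suc k) ≤ b k * ½
      halving k@(suc (suc k′)) (ℕ.s≤s (ℕ.s≤s _)) = ≤-by
        (0≤* (expTerm-nonneg (ℚP.0≤∣p∣ q) k)
          (0≤+ (0≤* (0≤- ∣q∣≤3/2) (ℚP.nonNegative⁻¹ (+ 1 Q./ 3))) (0≤* (ℚP.0≤∣p∣ q) (0≤- (inv≤⅓ k′)))))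
        (solve 3 (λ a b c → a :* con ½ :- a :* b :* c := a :* ((con (+ 3 Q./ 2) :- b) :* con (+ 1 Q./ 3) :+ b :*
          (con (+ 1 Q./ 3) :- c))) ≡-refl (b k) (∣ q ∣) (inv k))

      -- Halving terms make the tail telescope, since `b m ≤ 2 * b m - 2 * b (suc m)`.
      geometric : ∀ p → 2 ℕ.≤ p → ∀ j → Σ< (j ℕ.+ p) b - Σ< p b ≤ b p + b p - (b (j ℕ.+ p) + b (j ℕ.+ p))
      geometric p 2≤p zero = ℚP.≤-reflexive (trans (ℚP.+-inverseʳ (Σ< p b)) (sym (ℚP.+-inverseʳ (b p + b p))))
      geometric p 2≤p (suc j) = ≤-by
        (0≤+ (0≤- (geometric p 2≤p j)) (0≤* (0≤# 2) (0≤- (halving m (ℕP.≤-trans 2≤p (ℕP.m≤n+m p j))))))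
        (solve 5 (λ a b c d e → a :+ a :- (b :+ b) :- (c :+ d :- e) := a :+ a :- (d :+ d) :- (c :- e) :+ con
          (# 2) :* (d :* con ½ :- b)) ≡-refl (b p) (b (suc m)) (Σ< m b) (b m) (Σ< p b))
        where
        m : ℕ
        m = j ℕ.+ p

    expSum-tail : ∀ c → (∀ k → ∣ c k ∣ ≤ 1ℚ) → ∀ p → 2 ℕ.≤ p → ∀ n → p ℕ.≤ n →
                  ∣ expSum c q n - expSum c q p ∣ ≤ # 2 * expTerm ∣ q ∣ p
    expSum-tail c ∣c∣≤1 p 2≤p n p≤n = ℚP.≤-trans
      (∣Σ∣-tail _ b (λ k → ∣coeff*expTerm∣≤ (∣c∣≤1 k) ℚP.≤-refl k) p≤n)
      (≤-by (0≤+ (0≤- (subst (λ z → Σ< z b - Σ< p b ≤ b p + b p - (b z + b z)) (ℕP.m∸n+n≡m p≤n)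
        (geometric p 2≤p (n ∸ p))))
               (0≤+ (expTerm-nonneg (ℚP.0≤∣p∣ q) n) (expTerm-nonneg (ℚP.0≤∣p∣ q) n)))
        (solve 4 (λ a b c d → con (# 2) :* a :- (b :- c) := a :+ a :- (d :+ d) :- (b :- c) :+ (d :+ d)) ≡-refl
          (b p) (Σ< n b) (Σ< p b) (b n)))

    private
      ∣q∣² : ∣ q ∣ * ∣ q ∣ ≡ q * q
      ∣q∣² = trans (sym (ℚP.∣p*q∣≡∣p∣*∣q∣ q q)) (ℚP.0≤p⇒∣p∣≡p (0≤sq q))

    tail₂ : # 2 * expTerm ∣ q ∣ 2 ≡ q * q
    tail₂ = trans (solve 1 (λ a → con (# 2) :* (con 1ℚ :* a :* con (+ 1 Q./ 1) :* a :* con (+ 1 Q./ 2))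
      := a :* a) ≡-refl (∣ q ∣)) ∣q∣²

    -- Twice the leading term `q⁴ / 24` is `q⁴ / 12`, which leaves 11/12 of the bound.
    tail₄ : # 2 * expTerm ∣ q ∣ 4 ≤ q * q * (q * q)
    tail₄ = ≤-by (0≤* (ℚP.nonNegative⁻¹ (+ 11 Q./ 12)) (0≤sq (q * q)))
      (trans (cong (λ z → z - # 2 * expTerm ∣ q ∣ 4) (cong₂ (λ a b → a * b) (sym ∣q∣²) (sym ∣q∣²)))
      (trans (solve 1 (λ a → a :* a :* (a :* a) :- con (# 2) :* (con 1ℚ :* a :* con (+ 1 Q./ 1) :* a :* con
        (+ 1 Q./ 2) :* a :* con (+ 1 Q./ 3) :* a :* con (+ 1 Q./ 4)) := con (+ 11 Q./ 12) :*
        (a :* a :* (a :* a))) ≡-refl (∣ q ∣))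
      (cong₂ (λ a b → + 11 Q./ 12 * (a * b)) ∣q∣² ∣q∣²)))

  taylor-cos₂ : ∀ q → 1ℚ ≡ expSum cosCoeff q 2
  taylor-cos₂ q = solve 1 (λ a → con 1ℚ := con 0ℚ :+ con 1ℚ :* con 1ℚ :+ con 0ℚ :*
    (con 1ℚ :* a :* con (+ 1 Q./ 1))) ≡-refl q

  taylor-sin₂ : ∀ q → q ≡ expSum sinCoeff q 2
  taylor-sin₂ q = solve 1 (λ a → a := con 0ℚ :+ con 0ℚ :* con 1ℚ :+ con 1ℚ :* (con 1ℚ :* a :* con (+ 1 Q./ 1)))
    ≡-refl q

  taylor-exp₂ : ∀ q → 1ℚ + q ≡ expSum one q 2
  taylor-exp₂ q = solve 1 (λ a → con 1ℚ :+ a := con 0ℚ :+ con 1ℚ :* con 1ℚ :+ con 1ℚ :*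
    (con 1ℚ :* a :* con (+ 1 Q./ 1))) ≡-refl q

  taylor-cos₄ : ∀ q → 1ℚ + - (½ * (q * q)) ≡ expSum cosCoeff q 4
  taylor-cos₄ q = solve 1 (λ a → con 1ℚ :+ (:- (con ½ :* (a :* a))) := con 0ℚ :+ con 1ℚ :* con 1ℚ :+ con 0ℚ :*
    (con 1ℚ :* a :* con (+ 1 Q./ 1)) :+ (:- (con 1ℚ)) :* (con 1ℚ :* a :* con (+ 1 Q./ 1) :* a :* con
    (+ 1 Q./ 2)) :+ (:- (con 0ℚ)) :* (con 1ℚ :* a :* con (+ 1 Q./ 1) :* a :* con (+ 1 Q./ 2) :* a :* con
    (+ 1 Q./ 3))) ≡-refl q

  taylor-exp₄ : ∀ q → 1ℚ + q + ½ * (q * q) + (+ 1 Q./ 6) * (q * q * q) ≡ expSum one q 4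
  taylor-exp₄ q = solve 1 (λ a → con 1ℚ :+ a :+ con ½ :* (a :* a) :+ con (+ 1 Q./ 6) :* (a :* a :* a) := con 0ℚ
    :+ con 1ℚ :* con 1ℚ :+ con 1ℚ :* (con 1ℚ :* a :* con (+ 1 Q./ 1)) :+ con 1ℚ :*
    (con 1ℚ :* a :* con (+ 1 Q./ 1) :* a :* con (+ 1 Q./ 2)) :+ con 1ℚ :*
    (con 1ℚ :* a :* con (+ 1 Q./ 1) :* a :* con (+ 1 Q./ 2) :* a :* con (+ 1 Q./ 3))) ≡-refl q

-- Exponential, trigonometric and hyperbolic functions

module Elementary where
  open Bounds public
  open PowerSeries
  open import Defs using (sinCoeff; cosCoeff)
  open D.Sequences using (expSum; expTerm)

  opaque
    unfolding R seq cauchy ι _+_ _*_ -_ _≤_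

    series : (c : ℕ → ℚ) → (∀ k → Q.∣ c k ∣ Q.≤ 1ℚ) → R → R
    series = D.expSeries

  opaque
    unfolding R seq cauchy ι _+_ _*_ -_ _≤_ series

    seq-series : ∀ c ∣c∣≤1 x n → seq (series c ∣c∣≤1 x) n ≡ expSum c (seq x n) n
    seq-series c ∣c∣≤1 x n = ≡-refl

    seq-ι : ∀ q n → seq (ι q) n ≡ q
    seq-ι q n = ≡-refl

    seq-+ : ∀ x y n → seq (x + y) n ≡ seq x n Q.+ seq y n
    seq-+ x y n = ≡-refl

    seq-* : ∀ x y n → seq (x * y) n ≡ seq x n Q.* seq y n
    seq-* x y n = ≡-refl

    seq-neg : ∀ x n → seq (- x) n ≡ Q.- seq x n
    seq-neg x n = ≡-refl

    seq-1 : ∀ n → seq 1# n ≡ 1ℚ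
    seq-1 n = ≡-refl

    seq-exp₂ : ∀ x n → seq (1# + x) n ≡ 1ℚ Q.+ seq x n
    seq-exp₂ x n = ≡-refl

    seq-cos₄ : ∀ x n → seq (1# - ι ½ * (x * x)) n ≡ 1ℚ Q.+ Q.- (½ Q.* (seq x n Q.* seq x n))
    seq-cos₄ x n = ≡-refl

    seq-exp₄ : ∀ x n → seq (1# + x + ι ½ * (x * x) + ι (+ 1 Q./ 6) * (x * x * x)) n
             ≡ 1ℚ Q.+ seq x n Q.+ ½ Q.* (seq x n Q.* seq x n) Q.+ (+ 1 Q./ 6) Q.*
               (seq x n Q.* seq x n Q.* seq x n)
    seq-exp₄ x n = ≡-refl

    close⇒≈ : ∀ {x y} → (∀ ε → 0ℚ Q.< ε → Ev (λ n → Q.∣ seq x n Q.- seq y n ∣ Q.≤ ε)) → x ≈ y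
    close⇒≈ {x} {y} f = both
      (λ ε 0<ε → ev (f ε 0<ε) λ n c → ≤-by (0≤- (ℚP.≤-trans (≤∣∣ (seq x n Q.- seq y n)) c))
        (S.solve 3 (λ a b c → a S.:+ b S.:- c S.:= b S.:- (c S.:- a)) ≡-refl (seq y n) ε (seq x n)))
      (λ ε 0<ε → ev (f ε 0<ε) λ n c → ≤-by (0≤- (ℚP.≤-trans (-≤∣∣ (seq x n Q.- seq y n)) c))
        (S.solve 3 (λ a b c → a S.:+ b S.:- c S.:= b S.:- (S.:- (a S.:- c))) ≡-refl (seq x n) ε (seq y n)))

    seq-within : ∀ {u v} → Ev (λ n → Q.∣ seq u n ∣ Q.≤ seq v n) → u within v
    seq-within {u} {v} E = bounds
      (λ ε 0<ε → ev E λ n c → ≤-by (0≤+ (0≤- (ℚP.≤-trans (-≤∣∣ (seq u n)) c)) (ℚP.<⇒≤ 0<ε))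
        (S.solve 3 (λ a b c → a S.:+ b S.:- (S.:- c) S.:= c S.:- (S.:- a) S.:+ b) ≡-refl (seq u n) ε (seq v n)))
      (λ ε 0<ε → ev E λ n c → ≤-by (0≤+ (0≤- (ℚP.≤-trans (≤∣∣ (seq u n)) c)) (ℚP.<⇒≤ 0<ε))
        (S.solve 3 (λ a b c → a S.:+ b S.:- c S.:= a S.:- c S.:+ b) ≡-refl (seq v n) ε (seq u n)))

    within-seq : ∀ {x} → x within 1# → Ev (λ n → Q.∣ seq x n ∣ Q.≤ + 3 Q./ 2)
    within-seq {x} (bounds l u) = ev (l ½ 0<½ & u ½ 0<½) λ n (a , b) → ∣∣≤ b
      (≤-by (0≤- a) (S.solve 1 (λ a → S.con (+ 3 Q./ 2) S.:- (S.:- a) S.:= a S.:+ S.con ½ S.:-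
        (S.:- (S.con 1ℚ))) ≡-refl (seq x n)))

    ∣seq∣-bound : ∀ x → ∃[ B ] (0ℚ Q.< B × Ev (λ n → Q.∣ seq x n ∣ Q.≤ B))
    ∣seq∣-bound x = let B , 0<B , bd = bound-seq x in B , 0<B , ev bd λ n (a , b) → ∣∣≤ a
      (≤-by (0≤- b) (S.solve 2 (λ a b → a S.:- (S.:- b) S.:= b S.:- (S.:- a)) ≡-refl B (seq x n)))

    series-+ : ∀ e (∣e∣≤1 : ∀ k → Q.∣ e k ∣ Q.≤ 1ℚ) x y z →
               (∀ n → seq z n ≡ square e (seq x n) (seq y n) n) → series e ∣e∣≤1 (x + y) ≈ z
    series-+ e ∣e∣≤1 x y z eq = close⇒≈ {series e ∣e∣≤1 (x + y)} {z} λ ε 0<ε →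
      let A , 0<A , a = ∣seq∣-bound x
          B , 0<B , b = ∣seq∣-bound y
          0≤A+B = 0≤+ (ℚP.<⇒≤ 0<A) (ℚP.<⇒≤ 0<B)
      in ev (a & b & expSum-+ (A Q.+ B) 0≤A+B e ∣e∣≤1 ε 0<ε) λ n (p , q , f) →
        subst (λ z → Q.∣ expSum e (seq x n Q.+ seq y n) n Q.- z ∣ Q.≤ ε) (≡-sym (eq n))
          (f (seq x n) (seq y n)
            (ℚP.≤-trans p (≤-by (ℚP.<⇒≤ 0<B) (S.solve 2 (λ a b → a S.:+ b S.:- a S.:= b) ≡-refl A B)))
            (ℚP.≤-trans q (≤-by (ℚP.<⇒≤ 0<A) (S.solve 2 (λ a b → a S.:+ b S.:- b S.:= a) ≡-refl A B))))

    taylor₂ : ∀ c (∣c∣≤1 : ∀ k → Q.∣ c k ∣ Q.≤ 1ℚ) x p → (∀ n → seq p n ≡ expSum c (seq x n) 2) →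
              x within 1# → series c ∣c∣≤1 x - p within x * x
    taylor₂ c ∣c∣≤1 x p eq w = seq-within {series c ∣c∣≤1 x - p} {x * x}
      (ev (within-seq w & (2 , λ _ le → le)) λ n (b , 2≤n) →
        subst (λ z → Q.∣ expSum c (seq x n) n Q.- z ∣ Q.≤ seq x n Q.* seq x n) (≡-sym (eq n))
          (ℚP.≤-trans (expSum-tail (seq x n) b c ∣c∣≤1 2 ℕP.≤-refl n 2≤n) (ℚP.≤-reflexive (tail₂ (seq x n) b))))

    taylor₄ : ∀ c (∣c∣≤1 : ∀ k → Q.∣ c k ∣ Q.≤ 1ℚ) x p → (∀ n → seq p n ≡ expSum c (seq x n) 4) →
              x within 1# → series c ∣c∣≤1 x - p within (x * x) * (x * x)
    taylor₄ c ∣c∣≤1 x p eq w = seq-within {series c ∣c∣≤1 x - p} {(x * x) * (x * x)}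
      (ev (within-seq w & (4 , λ _ le → le)) λ n (b , 4≤n) →
        subst (λ z → Q.∣ expSum c (seq x n) n Q.- z ∣ Q.≤ seq x n Q.* seq x n Q.* (seq x n Q.* seq x n))
          (≡-sym (eq n))
          (ℚP.≤-trans (expSum-tail (seq x n) b c ∣c∣≤1 4 (ℕ.s≤s (ℕ.s≤s ℕ.z≤n)) n 4≤n) (tail₄ (seq x n) b)))

    -- Both sides evaluate the series at the same rationals. Together with the addition theorems
    -- this reduces a comparison of the values at `x` and `y` to an estimate at `y - x`.
    series-shift : ∀ c (∣c∣≤1 : ∀ k → Q.∣ c k ∣ Q.≤ 1ℚ) x y →
                   series c ∣c∣≤1 (x + (y - x)) ≈ series c ∣c∣≤1 y
    series-shift c ∣c∣≤1 x y = pointwise {series c ∣c∣≤1 (x + (y - x))} {series c ∣c∣≤1 y} λ n →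
      cong (λ q → expSum c q n) (S.solve 2 (λ a b → a S.:+ (b S.:+ (S.:- a)) S.:= b) ≡-refl (seq x n) (seq y n))

  opaque
    exp cos sin : R → R
    exp = series one (λ _ → ℚP.≤-refl)
    cos = series cosCoeff D.∣cosCoeff∣≤1
    sin = series sinCoeff D.∣sinCoeff∣≤1

  cosh : R → R
  cosh x = ι ½ * (exp x + exp (- x))

  opaque
    unfolding exp cos sin

    seq-exp : ∀ x n → seq (exp x) n ≡ expSum one (seq x n) n
    seq-exp x n = seq-series one _ x n

    seq-cos : ∀ x n → seq (cos x) n ≡ expSum cosCoeff (seq x n) n
    seq-cos x n = seq-series cosCoeff _ x n

    seq-sin : ∀ x n → seq (sin x) n ≡ expSum sinCoeff (seq x n) n
    seq-sin x n = seq-series sinCoeff _ x n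

    exp-+ : ∀ x y → exp (x + y) ≈ exp x * exp y
    exp-+ x y = series-+ one _ x y (exp x * exp y) λ n →
      ≡-trans (seq-* (exp x) (exp y) n)
        (≡-trans (cong₂ Q._*_ (seq-series one _ x n) (seq-series one _ y n)) (exp-square (seq x n) (seq y n) n))

    cos-+ : ∀ x y → cos (x + y) ≈ cos x * cos y - sin x * sin y
    cos-+ x y = series-+ cosCoeff _ x y (cos x * cos y - sin x * sin y) λ n →
      ≡-trans (seq-+ (cos x * cos y) (- (sin x * sin y)) n) (≡-trans (cong₂ Q._+_
          (≡-trans (seq-* (cos x) (cos y) n) (cong₂ Q._*_ (seq-series cosCoeff _ x n)
            (seq-series cosCoeff _ y n)))
          (≡-trans (seq-neg (sin x * sin y) n) (cong Q.-_
            (≡-trans (seq-* (sin x) (sin y) n) (cong₂ Q._*_ (seq-series sinCoeff _ x n)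
              (seq-series sinCoeff _ y n))))))
        (cos-square (seq x n) (seq y n) n))

    sin-+ : ∀ x y → sin (x + y) ≈ sin x * cos y + cos x * sin y
    sin-+ x y = series-+ sinCoeff _ x y (sin x * cos y + cos x * sin y) λ n →
      ≡-trans (seq-+ (sin x * cos y) (cos x * sin y) n) (≡-trans (cong₂ Q._+_
          (≡-trans (seq-* (sin x) (cos y) n) (cong₂ Q._*_ (seq-series sinCoeff _ x n)
            (seq-series cosCoeff _ y n)))
          (≡-trans (seq-* (cos x) (sin y) n) (cong₂ Q._*_ (seq-series cosCoeff _ x n)
            (seq-series sinCoeff _ y n))))
        (sin-square (seq x n) (seq y n) n))

    cos-neg : ∀ x → cos (- x) ≈ cos x
    cos-neg x = pointwise λ n → ≡-trans (seq-series cosCoeff _ (- x) n)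
      (≡-trans (cong (λ q → expSum cosCoeff q n) (seq-neg x n))
        (≡-trans (expSum-even (seq x n) n) (≡-sym (seq-series cosCoeff _ x n))))

    sin-neg : ∀ x → sin (- x) ≈ - sin x
    sin-neg x = pointwise λ n → ≡-trans (seq-series sinCoeff _ (- x) n)
      (≡-trans (cong (λ q → expSum sinCoeff q n) (seq-neg x n))
        (≡-trans (expSum-odd (seq x n) n) (≡-sym
          (≡-trans (seq-neg (sin x) n) (cong Q.-_ (seq-series sinCoeff _ x n))))))

    cos-taylor₂ : ∀ x → x within 1# → cos x - 1# within x * x
    cos-taylor₂ x = taylor₂ cosCoeff _ x 1# λ n → ≡-trans (seq-1 n) (taylor-cos₂ (seq x n))

    sin-taylor₂ : ∀ x → x within 1# → sin x - x within x * x
    sin-taylor₂ x = taylor₂ sinCoeff _ x x λ n → taylor-sin₂ (seq x n)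

    exp-taylor₂ : ∀ x → x within 1# → exp x - (1# + x) within x * x
    exp-taylor₂ x = taylor₂ one _ x (1# + x) λ n → ≡-trans (seq-exp₂ x n) (taylor-exp₂ (seq x n))

    cos-taylor₄ : ∀ x → x within 1# → cos x - (1# - ι ½ * (x * x)) within (x * x) * (x * x)
    cos-taylor₄ x = taylor₄ cosCoeff _ x (1# - ι ½ * (x * x)) λ n → ≡-trans (seq-cos₄ x n)
      (taylor-cos₄ (seq x n))

    exp-taylor₄ : ∀ x → x within 1# →
      exp x - (1# + x + ι ½ * (x * x) + ι (+ 1 Q./ 6) * (x * x * x)) within (x * x) * (x * x)
    exp-taylor₄ x = taylor₄ one _ x (1# + x + ι ½ * (x * x) + ι (+ 1 Q./ 6) * (x * x * x)) λ n → ≡-trans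
      (seq-exp₄ x n) (taylor-exp₄ (seq x n))

    exp-shift : ∀ x y → exp (x + (y - x)) ≈ exp y
    exp-shift = series-shift one _

    cos-shift : ∀ x y → cos (x + (y - x)) ≈ cos y
    cos-shift = series-shift cosCoeff _

    sin-shift : ∀ x y → sin (x + (y - x)) ≈ sin y
    sin-shift = series-shift sinCoeff _

  within-≈0 : ∀ {x e} → e ≈ 0# → x within e → x ≈ 0#
  within-≈0 {x} {e} e≈0 (bounds l u) = both (≤-trans u (to e≈0))
    (≤-trans (from (trans (neg-cong e≈0) (solve 0 ((:- (con 0ℚ)) := con 0ℚ) refl))) l)

  0≤1# : 0# ≤ 1#
  0≤1# = ι-mono 0≤1

  ≈0⇒within : ∀ {d e} → 0# ≤ e → d ≈ 0# → d within e
  ≈0⇒within 0≤e d≈0 = within-resp (sym d≈0) (within-0 0≤e)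

  private
    sq≈0 : ∀ {d} → d ≈ 0# → d * d ≈ 0#
    sq≈0 d≈0 = trans (*-cong d≈0 d≈0) (solve 0 (con 0ℚ :* con 0ℚ := con 0ℚ) refl)

    diff≈0 : ∀ {x y} → x ≈ y → y - x ≈ 0#
    diff≈0 {x} {y} e = trans (-‿-cong refl e) (solve 1 (λ a → a :- a := con 0ℚ) refl y)

    moved : ∀ {x y} → x - y ≈ 0# → x ≈ y
    moved {x} {y} e = trans (solve 2 (λ a b → a := a :- b :+ b) refl x y)
      (trans (+-cong e refl) (solve 1 (λ a → con 0ℚ :+ a := a) refl y))

  exp-≈0 : ∀ {d} → d ≈ 0# → exp d ≈ 1#
  exp-≈0 {d} e = trans (moved (within-≈0 (sq≈0 e) (exp-taylor₂ d (≈0⇒within 0≤1# e))))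
    (trans (+-cong refl e) (solve 0 (con 1ℚ :+ con 0ℚ := con 1ℚ) refl))

  cos-≈0 : ∀ {d} → d ≈ 0# → cos d ≈ 1#
  cos-≈0 {d} e = moved (within-≈0 (sq≈0 e) (cos-taylor₂ d (≈0⇒within 0≤1# e)))

  sin-≈0 : ∀ {d} → d ≈ 0# → sin d ≈ 0#
  sin-≈0 {d} e = trans (moved (within-≈0 (sq≈0 e) (sin-taylor₂ d (≈0⇒within 0≤1# e)))) e

  -- Equal reals may have different sequences, so the definition does not give this directly. The
  -- addition theorem isolates the factor `exp (y - x)`, and the Taylor estimate at `y - x ≈ 0`
  -- makes it 1.
  exp-cong : ∀ {x y} → x ≈ y → exp x ≈ exp y
  exp-cong {x} {y} e = sym (trans (sym (exp-shift x y)) (trans (exp-+ x (y - x))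
    (trans (*-cong refl (exp-≈0 (diff≈0 e))) (solve 1 (λ a → a :* con 1ℚ := a) refl (exp x)))))

  cos-cong : ∀ {x y} → x ≈ y → cos x ≈ cos y
  cos-cong {x} {y} e = sym (trans (sym (cos-shift x y)) (trans (cos-+ x (y - x))
    (trans (-‿-cong (*-cong refl (cos-≈0 (diff≈0 e))) (*-cong refl (sin-≈0 (diff≈0 e))))
      (solve 2 (λ a b → a :* con 1ℚ :- b :* con 0ℚ := a) refl (cos x) (sin x)))))

  sin-cong : ∀ {x y} → x ≈ y → sin x ≈ sin y
  sin-cong {x} {y} e = sym (trans (sym (sin-shift x y)) (trans (sin-+ x (y - x))
    (trans (+-cong (*-cong refl (cos-≈0 (diff≈0 e))) (*-cong refl (sin-≈0 (diff≈0 e))))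
      (solve 2 (λ a b → a :* con 1ℚ :+ b :* con 0ℚ := a) refl (sin x) (cos x)))))

  cosh-cong : ∀ {x y} → x ≈ y → cosh x ≈ cosh y
  cosh-cong e = *-cong refl (+-cong (exp-cong e) (exp-cong (neg-cong e)))

  exp-inverse : ∀ x → exp x * exp (- x) ≈ 1#
  exp-inverse x = trans (sym (exp-+ x (- x))) (exp-≈0 (solve 1 (λ a → a :+ (:- a) := con 0ℚ) refl x))

  cos²+sin² : ∀ x → cos x * cos x + sin x * sin x ≈ 1#
  cos²+sin² x = begin
    cos x * cos x + sin x * sin x              ≈⟨ solve 2 (λ a b → a :* a :+ b :* b := a :* a :- b :* (:- b))
      refl (cos x) (sin x) ⟩
    cos x * cos x - sin x * - sin x            ≈⟨ -‿-cong (*-cong refl (cos-neg x)) (*-cong refl (sin-neg x)) ⟨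
    cos x * cos (- x) - sin x * sin (- x)      ≈⟨ cos-+ x (- x) ⟨
    cos (x + - x)                              ≈⟨ cos-≈0 (solve 1 (λ a → a :+ (:- a) := con 0ℚ) refl x) ⟩
    1#                                         ∎
    where open ≈-Reasoning

  -- Square roots are avoided: after inserting `s² = 1 - c²`, the difference `1 - c` is half of
  -- `(1 - c)² + s²`, and similarly for `1 + c`.
  unit-within : ∀ {c s} → c * c + s * s ≈ 1# → c within 1#
  unit-within {c} {s} e = bounds
    (by (½-nn nn* (sq-nonneg (1# + c) nn+ sq-nonneg s))
      (trans (solve 1 (λ a → a :- (:- (con 1ℚ)) := con ½ :*
        ((con 1ℚ :+ a) :* (con 1ℚ :+ a) :+ (con 1ℚ :- a :* a))) refl c)
        (*-cong refl (+-cong refl (trans (-‿-cong (sym e) refl)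
          (solve 2 (λ a b → a :* a :+ b :* b :- a :* a := b :* b) refl c s))))))
    (by (½-nn nn* (sq-nonneg (1# - c) nn+ sq-nonneg s))
      (trans (solve 1 (λ a → con 1ℚ :- a := con ½ :* ((con 1ℚ :- a) :* (con 1ℚ :- a) :+ (con 1ℚ :- a :* a)))
        refl c)
        (*-cong refl (+-cong refl (trans (-‿-cong (sym e) refl)
          (solve 2 (λ a b → a :* a :+ b :* b :- a :* a := b :* b) refl c s))))))

  cos-within : ∀ x → cos x within 1#
  cos-within x = unit-within (cos²+sin² x)

  sin-within : ∀ x → sin x within 1#
  sin-within x = unit-within (trans (+-comm _ _) (cos²+sin² x))

  cosh-taylor₂ : ∀ x → x within 1# → cosh x - 1# within x * x
  cosh-taylor₂ x w = within-weaken (to (solve 1 (λ a → con ½ :* (a :* a :+ (:- a) :* (:- a)) := a :* a) refl x))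
    (within-resp (solve 3 (λ a b c → con ½ :* (a :- (con 1ℚ :+ b) :+ (c :- (con 1ℚ :+ (:- b)))) := con ½ :*
      (a :+ c) :- con 1ℚ) refl (exp x) x (exp (- x)))
      (within-* (within-self ½-nn) (within-+ (exp-taylor₂ x w) (exp-taylor₂ (- x) (within-neg w)))))

  -- The expansion of `exp` is taken up to the cubic term in order to have an error of fourth order;
  -- the odd terms cancel between `x` and `- x`.
  cosh-taylor₄ : ∀ x → x within 1# → cosh x - (1# + ι ½ * (x * x)) within (x * x) * (x * x)
  cosh-taylor₄ x w = within-weaken (to (solve 1
    (λ a → con ½ :* (a :* a :* (a :* a) :+ (:- a) :* (:- a) :* ((:- a) :* (:- a))) := a :* a :* (a :* a))
    refl x))
    (within-resp (solve 3 (λ a b c → con ½ :* (a :- (con 1ℚ :+ b :+ con ½ :* (b :* b) :+ con (+ 1 Q./ 6) :*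
      (b :* b :* b)) :+ (c :- (con 1ℚ :+ (:- b) :+ con ½ :* ((:- b) :* (:- b)) :+ con (+ 1 Q./ 6) :*
      ((:- b) :* (:- b) :* (:- b))))) := con ½ :* (a :+ c) :- (con 1ℚ :+ con ½ :* (b :* b))) refl (exp x) x
      (exp (- x)))
      (within-* (within-self ½-nn) (within-+ (exp-taylor₄ x w) (exp-taylor₄ (- x) (within-neg w)))))

-- Partial sums of the arctangent series

module Arctangent where
  open Elementary public
  open D.Sequences using (sign; leibnizSum; cauchy-leibnizSum)

  infixl 9 _↑_
  _↑_ : R → ℕ → R
  t ↑ zero  = 1#
  t ↑ suc k = t ↑ k * t

  N : ℕ → R
  N k = ι (# k)

  N-suc : ∀ k → N (suc k) ≈ 1# + N k
  N-suc k = trans (≡⇒≈ (cong ι (#-suc k))) (ι-+ 1ℚ (# k))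

  0≤N : ∀ k → 0# ≤ N k
  0≤N k = ι-mono (0≤# k)

  inv*N : ∀ k → ι (inv k) * N (suc k) ≈ 1#
  inv*N k = trans (sym (ι-* (inv k) (# (suc k)))) (≡⇒≈ (cong ι (inv-suc k)))

  within-≤ : ∀ {x e} → 0# ≤ x → x ≤ e → x within e
  within-≤ 0≤x x≤e = within-weaken x≤e (within-self 0≤x)

  coeff : ℕ → ℚ
  coeff k = sign k Q.* inv (2 ℕ.* k)

  arctanSum geometricSum : ℕ → R → R
  arctanSum zero    t = 0#
  arctanSum (suc n) t = arctanSum n t + ι (coeff n) * t ↑ suc (2 ℕ.* n)
  geometricSum zero    t = 0#
  geometricSum (suc n) t = geometricSum n t + ι (sign n) * t ↑ (2 ℕ.* n)

  private
    2+ : ∀ n → 2 ℕ.* suc n ≡ suc (suc (2 ℕ.* n))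
    2+ n = cong suc (ℕP.+-suc n (n ℕ.+ 0))

  ↑-even : ∀ t n → t ↑ (2 ℕ.* suc n) ≈ t ↑ (2 ℕ.* n) * (t * t)
  ↑-even t n = trans (≡⇒≈ (cong (t ↑_) (2+ n))) (solve 2 (λ a b → a :* b :* b := a :* (b :* b)) refl
    (t ↑ (2 ℕ.* n)) t)

  -- `geometricSum` is the derivative of `arctanSum`, a geometric sum of ratio `- t²`; the last term
  -- measures its distance from the derivative 1/(1 + t²) of the full arctangent.
  geometricSum-closed : ∀ n t → (1# + t * t) * geometricSum n t ≈ 1# - ι (sign n) * t ↑ (2 ℕ.* n)
  geometricSum-closed zero t = solve 1 (λ a → (con 1ℚ :+ a :* a) :* con 0ℚ := con 1ℚ :- con 1ℚ :* con 1ℚ) refl t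
  geometricSum-closed (suc n) t = begin
    (1# + t * t) * (g + s * p)            ≈⟨ solve 4 (λ a b c d → (con 1ℚ :+ a :* a) :* (b :+ c :* d) :=
      (con 1ℚ :+ a :* a) :* b :+ (con 1ℚ :+ a :* a) :* (c :* d)) refl t g s p ⟩
    (1# + t * t) * g + (1# + t * t) * (s * p) ≈⟨ +-cong (geometricSum-closed n t) refl ⟩
    1# - s * p + (1# + t * t) * (s * p)   ≈⟨ solve 3 (λ a b c → con 1ℚ :- a :* b :+ (con 1ℚ :+ c :* c) :*
      (a :* b) := con 1ℚ :- (:- a) :* (b :* (c :* c))) refl s p t ⟩
    1# - (- s) * (p * (t * t))            ≈⟨ -‿-cong refl (*-cong (ι-neg (sign n)) (↑-even t n)) ⟨
    1# - ι (sign (suc n)) * t ↑ (2 ℕ.* suc n) ∎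
    where
    open ≈-Reasoning
    g s p : R
    g = geometricSum n t
    s = ι (sign n)
    p = t ↑ (2 ℕ.* n)

  ι-sign-within : ∀ n → ι (sign n) within 1#
  ι-sign-within zero    = within-self 0≤1#
  ι-sign-within (suc n) = within-resp (sym (ι-neg (sign n))) (within-neg (ι-sign-within n))

  inv≤1 : ∀ k → ι (inv k) ≤ 1#
  inv≤1 k = by (ι-mono (ℚP.<⇒≤ (0<inv k)) nn* 0≤N k) (begin
    1# - ι (inv k)                      ≈⟨ -‿-cong (trans (sym (inv*N k)) (*-cong refl (N-suc k))) refl ⟩
    ι (inv k) * (1# + N k) - ι (inv k)  ≈⟨ solve 2 (λ a b → a :* (con 1ℚ :+ b) :- a := a :* b) refl (ι (inv k))
      (N k) ⟩
    ι (inv k) * N k                     ∎)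
    where open ≈-Reasoning

  0≤inv : ∀ k → 0# ≤ ι (inv k)
  0≤inv k = ι-mono (ℚP.<⇒≤ (0<inv k))

  coeff-within : ∀ n → ι (coeff n) within 1#
  coeff-within n = within-weaken (to (solve 0 (con 1ℚ :* con 1ℚ := con 1ℚ) refl))
    (within-resp (sym (ι-* (sign n) (inv (2 ℕ.* n))))
    (within-* (ι-sign-within n) (within-≤ (0≤inv (2 ℕ.* n)) (inv≤1 (2 ℕ.* n)))))

  -- The binomial coefficient `m (m - 1) / 2`, which bounds the second-order remainder of `t ↑ m` on
  -- the unit interval.
  κ : ℕ → ℚ
  κ zero    = 0ℚ
  κ (suc m) = κ m Q.+ # m

  -- Adds `κ` over the exponents of `arctanSum`, whose coefficients have absolute value at most 1.
  K : ℕ → ℚ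
  K zero    = 0ℚ
  K (suc n) = K n Q.+ κ (suc (2 ℕ.* n))

  0≤κ : ∀ m → 0ℚ Q.≤ κ m
  0≤κ zero    = ℚP.≤-refl
  0≤κ (suc m) = 0≤+ (0≤κ m) (0≤# m)

  0≤K : ∀ m → 0ℚ Q.≤ K m
  0≤K zero    = ℚP.≤-refl
  0≤K (suc m) = 0≤+ (0≤K m) (0≤κ (suc (2 ℕ.* m)))

  -- One step t ↦ t + h of the partial sums of arctan, to first order in h.
  module Step (t h : R) (0≤t : 0# ≤ t) (0≤h : 0# ≤ h) (t+h≤1 : t + h ≤ 1#) where
    t≤1 : t ≤ 1#
    t≤1 = ≤-trans (by 0≤h (solve 2 (λ a b → a :+ b :- a := b) refl t h)) t+h≤1

    0≤t+h : 0# ≤ t + h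
    0≤t+h = 0≤t nn+ 0≤h

    0≤↑ : ∀ m → 0# ≤ t ↑ m
    0≤↑ zero    = 0≤1#
    0≤↑ (suc m) = 0≤↑ m nn* 0≤t

    ↑≤1 : ∀ m → t ↑ m ≤ 1#
    ↑≤1 zero    = ≤-refl
    ↑≤1 (suc m) = ≤-trans (*-mono (0≤↑ m) 0≤1# (↑≤1 m) t≤1) (to (solve 0 (con 1ℚ :* con 1ℚ := con 1ℚ) refl))

    -- The derivative of t ↑ m.
    d : ℕ → R
    d zero    = 0#
    d (suc m) = t * d m + t ↑ m

    d-suc : ∀ m → d (suc m) ≈ N (suc m) * t ↑ m
    d-suc zero    = solve 1 (λ a → a :* con 0ℚ :+ con 1ℚ := con 1ℚ :* con 1ℚ) refl t
    d-suc (suc m) = begin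
      t * d (suc m) + t ↑ m * t             ≈⟨ +-cong (*-cong refl (d-suc m)) refl ⟩
      t * (N (suc m) * t ↑ m) + t ↑ m * t   ≈⟨ solve 3 (λ a b c → a :* (b :* c) :+ c :* a := (con 1ℚ :+ b) :*
        (c :* a)) refl t (N (suc m)) (t ↑ m) ⟩
      (1# + N (suc m)) * (t ↑ m * t)        ≈⟨ *-cong (N-suc (suc m)) refl ⟨
      N (suc (suc m)) * t ↑ suc m           ∎
      where open ≈-Reasoning

    0≤d : ∀ m → 0# ≤ d m
    0≤d zero    = ≤-refl
    0≤d (suc m) = 0≤t nn* 0≤d m nn+ 0≤↑ m

    d≤ : ∀ m → d m ≤ N m
    d≤ zero    = ≤-refl
    d≤ (suc m) = ≤-trans (to (d-suc m)) (≤-trans (*-mono (0≤N (suc m)) 0≤1# ≤-refl (↑≤1 m))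
      (to (solve 1 (λ a → a :* con 1ℚ := a) refl (N (suc m)))))

    rem : ℕ → R
    rem m = (t + h) ↑ m - t ↑ m - h * d m

    rem-suc : ∀ m → rem (suc m) ≈ (t + h) * rem m + h * h * d m
    rem-suc m = solve 5 (λ a b c d e → a :* (b :+ c) :- d :* b :- c :* (b :* e :+ d) := (b :+ c) :*
      (a :- d :- c :* e) :+ c :* c :* e) refl ((t + h) ↑ m) t h (t ↑ m) (d m)

    -- Convexity of the power. It makes each increment of `t ↑ m` at least its linear part, the
    -- discrete substitute for integrating `t ↑ (2 * n)` in `potential-step`.
    0≤rem : ∀ m → 0# ≤ rem m
    0≤rem zero    = from (solve 1 (λ a → con 1ℚ :- con 1ℚ :- a :* con 0ℚ := con 0ℚ) refl h)
    0≤rem (suc m) = ≤-trans (0≤t+h nn* 0≤rem m nn+ 0≤h nn* 0≤h nn* 0≤d m) (from (rem-suc m))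

    rem≤ : ∀ m → rem m ≤ ι (κ m) * (h * h)
    rem≤ zero    = to (solve 1 (λ a → con 1ℚ :- con 1ℚ :- a :* con 0ℚ := con 0ℚ :* (a :* a)) refl h)
    rem≤ (suc m) = begin
      rem (suc m)                                      ≲⟨ to (rem-suc m) ⟩
      (t + h) * rem m + h * h * d m
        ≲⟨ +-mono (*-mono 0≤t+h (ι0≤ (0≤κ m) nn* (0≤h nn* 0≤h)) t+h≤1 (rem≤ m))
                                                                 (*-mono (0≤h nn* 0≤h) (0≤N m) ≤-refl (d≤ m)) ⟩
      1# * (ι (κ m) * (h * h)) + h * h * N m
        ≈⟨ solve 3 (λ a b c → con 1ℚ :* (a :* (b :* b)) :+ b :* b :* c := (a :+ c) :* (b :* b)) refl (ι (κ m)) h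
        (N m) ⟩
      (ι (κ m) + N m) * (h * h)                        ≈⟨ *-cong (ι-+ (κ m) (# m)) refl ⟨
      ι (κ (suc m)) * (h * h)                          ∎
      where open ≤-Reasoning

    coeff-d : ∀ n → ι (coeff n) * d (suc (2 ℕ.* n)) ≈ ι (sign n) * t ↑ (2 ℕ.* n)
    coeff-d n = begin
      ι (coeff n) * d (suc (2 ℕ.* n))          ≈⟨ *-cong (ι-* (sign n) (inv (2 ℕ.* n))) (d-suc (2 ℕ.* n)) ⟩
      s * i * (N (suc (2 ℕ.* n)) * p)          ≈⟨ solve 4 (λ a b c d → a :* b :* (c :* d) := a :* (b :* c) :* d)
        refl s i (N (suc (2 ℕ.* n))) p ⟩
      s * (i * N (suc (2 ℕ.* n))) * p          ≈⟨ *-cong (*-cong refl (inv*N (2 ℕ.* n))) refl ⟩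
      s * 1# * p                               ≈⟨ solve 2 (λ a b → a :* con 1ℚ :* b := a :* b) refl s p ⟩
      s * p                                    ∎
      where
      open ≈-Reasoning
      s i p : R
      s = ι (sign n)
      i = ι (inv (2 ℕ.* n))
      p = t ↑ (2 ℕ.* n)

    arctan-rem : ∀ n → arctanSum n (t + h) - arctanSum n t - h * geometricSum n t within ι (K n) * (h * h)
    arctan-rem zero = within-weaken (to (solve 1 (λ a → con 0ℚ := con 0ℚ :* (a :* a)) refl h))
      (within-resp (solve 1 (λ a → con 0ℚ := con 0ℚ :- con 0ℚ :- a :* con 0ℚ) refl h) (within-0 ≤-refl))
    arctan-rem (suc n) = within-weaken
      (to (trans (solve 3 (λ a b c → a :* (b :* b) :+ con 1ℚ :* (c :* (b :* b)) := (a :+ c) :* (b :* b)) refl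
        (ι (K n)) h (ι (κ m))) (*-cong (sym (ι-+ (K n) (κ m))) refl)))
      (within-resp
        (trans (solve 8 (λ a b c d e f g h → a :- b :- c :* d :+ e :* (f :- g :- c :* h) := a :+ e :* f :-
          (b :+ e :* g) :- c :* (d :+ e :* h)) refl (arctanSum n (t + h)) (arctanSum n t) h (geometricSum n t)
          (ι (coeff n)) ((t + h) ↑ m) (t ↑ m) (d m))
               (-‿-cong refl (*-cong refl (+-cong refl (coeff-d n)))))
        (within-+ (arctan-rem n) (within-* (coeff-within n) (within-≤ (0≤rem m) (rem≤ m)))))
      where
      m : ℕ
      m = suc (2 ℕ.* n)

    geometricSum-within : ∀ n → geometricSum n t within N n
    geometricSum-within zero    = within-0 ≤-refl
    geometricSum-within (suc n) = within-weaken
      (to (trans (solve 1 (λ a → a :+ con 1ℚ :* con 1ℚ := con 1ℚ :+ a) refl (N n)) (sym (N-suc n))))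
      (within-+ (geometricSum-within n) (within-* (ι-sign-within n) (within-≤ (0≤↑ (2 ℕ.* n)) (↑≤1 (2 ℕ.* n)))))

-- Sine against cosine at the Leibniz sums

module ArctangentAtOne where
  open Arctangent public
  open D.Sequences using (sign; leibnizSum; cauchy-leibnizSum; Σ<)

  2# : R
  2# = ι (# 2)

  lim-unique : ∀ {f L K} → Lim f L → Lim f K → L ≈ K
  lim-unique p q = both (lim-≤ (always λ _ → ≤-refl) p q) (lim-≤ (always λ _ → ≤-refl) q p)

  lim-within-≤ : ∀ {x f e} → Ev (λ m → x within f m) → Lim f e → x within e
  lim-within-≤ {x} E p = bounds
    (lim-≤ (ev E λ m → lower) (lim-neg p) (lim-const x))
    (lim-≤ (ev E λ m → upper) (lim-const x) p)

  sq-within : ∀ {d e} → d within e → d * d ≤ e * e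
  sq-within w = upper (within-* w w)

  private
    lip : ∀ {a b x y e} → a within 1# → b within 1# → x within e * e → y within e * e → ∀ {d} → d within e →
          a * x + b * y + b * d within e * e + e * e + e
    lip {e = e} a b x y d = within-weaken (to (solve 1 (λ a → con 1ℚ :* (a :* a) :+ con 1ℚ :* (a :* a)
      :+ con 1ℚ :* a := a :* a :+ a :* a :+ a) refl e))
      (within-+ (within-+ (within-* a x) (within-* b y)) (within-* b d))

    within-1 : ∀ {d δ} → δ Q.≤ 1ℚ → d within ι δ → d within 1#
    within-1 δ≤1 = within-weaken (ι-mono δ≤1)

    module Lip {f : ℕ → R} {L : R} (p : Lim f L) (ε : ℚ) (0<ε : 0ℚ Q.< ε) where
      δ : ℚ
      δ = proj₁ (scale (# 3) ε (0≤# 3) 0<ε)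
      0<δ : 0ℚ Q.< δ
      0<δ = proj₁ (proj₂ (scale (# 3) ε (0≤# 3) 0<ε))
      δ≤1 : δ Q.≤ 1ℚ
      δ≤1 = proj₁ (proj₂ (proj₂ (scale (# 3) ε (0≤# 3) 0<ε)))
      3δ≤ε : # 3 Q.* δ Q.≤ ε
      3δ≤ε = proj₂ (proj₂ (proj₂ (scale (# 3) ε (0≤# 3) 0<ε)))
      total : ι δ * ι δ + ι δ * ι δ + ι δ ≤ ι ε
      total = ≤-trans (by {b = ι (# 3) * ι δ} (ι-mono (0≤# 2) nn* (ι-mono (ℚP.<⇒≤ 0<δ) nn* nn (ι-mono δ≤1)))
          (solve 1 (λ a → con (# 3) :* a :- (a :* a :+ a :* a :+ a) := con (# 2) :* (a :* (con 1ℚ :- a))) refl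
            (ι δ)))
        (≤-trans (from (ι-* (# 3) δ)) (ι-mono 3δ≤ε))
      close : Ev (λ m → f m - L within ι δ)
      close = p δ 0<δ

  -- By the addition theorem with `d = f m - L`, the error is `sin L * (cos d - 1) + cos L * (sin d
  -- - d) + cos L * d`, at most `δ² + δ² + δ ≤ 3 δ`.
  lim-sin : ∀ {f L} → Lim f L → Lim (λ m → sin (f m)) (sin L)
  lim-sin {f} {L} p ε 0<ε = ev close λ m w →
    let d = f m - L
        w₁ = within-1 δ≤1 w
    in within-weaken total (within-resp
      (trans (solve 5 (λ a b c d e → a :* (b :- con 1ℚ) :+ c :* (d :- e) :+ c :* e := a :* b :+ c :* d :- a)
        refl (sin L) (cos d) (cos L) (sin d) d)
        (-‿-cong (trans (sym (sin-+ L d)) (sin-shift L (f m))) refl))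
      (lip (sin-within L) (cos-within L) (within-weaken (sq-within w) (cos-taylor₂ d w₁))
           (within-weaken (sq-within w) (sin-taylor₂ d w₁)) w))
    where open Lip p ε 0<ε

  lim-cos : ∀ {f L} → Lim f L → Lim (λ m → cos (f m)) (cos L)
  lim-cos {f} {L} p ε 0<ε = ev close λ m w →
    let d = f m - L
        w₁ = within-1 δ≤1 w
    in within-weaken total (within-resp
      (trans (solve 5 (λ a b c d e → a :* (b :- con 1ℚ) :+ (:- c) :* (d :- e) :+ (:- c) :* e := a :* b :- c :* d
        :- a) refl (cos L) (cos d) (sin L) (sin d) d)
        (-‿-cong (trans (sym (cos-+ L d)) (cos-shift L (f m))) refl))
      (lip (cos-within L) (within-neg (sin-within L)) (within-weaken (sq-within w) (cos-taylor₂ d w₁))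
           (within-weaken (sq-within w) (sin-taylor₂ d w₁)) w))
    where open Lip p ε 0<ε

  ↑-cong : ∀ {x y} m → x ≈ y → x ↑ m ≈ y ↑ m
  ↑-cong zero    e = refl
  ↑-cong (suc m) e = *-cong (↑-cong m e) e

  arctanSum-cong : ∀ {x y} n → x ≈ y → arctanSum n x ≈ arctanSum n y
  arctanSum-cong zero    e = refl
  arctanSum-cong (suc n) e = +-cong (arctanSum-cong n e) (*-cong refl (↑-cong (suc (2 ℕ.* n)) e))

  arctanSum-0 : ∀ n → arctanSum n 0# ≈ 0#
  arctanSum-0 zero    = refl
  arctanSum-0 (suc n) = trans (+-cong (arctanSum-0 n) refl)
    (solve 2 (λ a b → con 0ℚ :+ a :* (b :* con 0ℚ) := con 0ℚ) refl (ι (coeff n)) (0# ↑ (2 ℕ.* n)))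

  1↑ : ∀ m → 1# ↑ m ≈ 1#
  1↑ zero    = refl
  1↑ (suc m) = trans (*-cong (1↑ m) refl) (solve 0 (con 1ℚ :* con 1ℚ := con 1ℚ) refl)

  arctanSum-1 : ∀ n → arctanSum n 1# ≈ ι (leibnizSum n)
  arctanSum-1 zero    = refl
  arctanSum-1 (suc n) = trans (+-cong (arctanSum-1 n) (trans (*-cong refl (1↑ (suc (2 ℕ.* n))))
    (solve 1 (λ a → a :* con 1ℚ := a) refl (ι (coeff n)))))
    (sym (ι-+ (leibnizSum n) (coeff n)))

  -- sin (A t) - t cos (A t) vanishes for A = arctan; here A is an even partial
  -- sum of the arctangent series, and the deviation is followed along t = j h.
  module Deviation (n : ℕ) (even : sign n ≡ 1ℚ) (m : ℕ) where
    -- `L` bounds the slope of the partial sum. `C` counts the second-order terms of `g-expand`: the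
    -- two with `E`, each under a factor of size at most 2, give `4 K`; the five with `u` or `v`
    -- give `5 L²`; and `h * (s * δ)` gives `L`.
    h Kₙ L C : R
    h  = ι (inv m)
    Kₙ = ι (K n)
    L  = N n + Kₙ
    C  = ι (# 4) * Kₙ + ι (# 5) * (L * L) + L

    module _ (Lh≤1 : L * h ≤ 1#) where
      private
        0≤h : 0# ≤ h
        0≤h = 0≤inv m
        h≤1 : h ≤ 1#
        h≤1 = inv≤1 m
        0≤K′ : 0# ≤ Kₙ
        0≤K′ = ι-mono (0≤K n)
        0≤L : 0# ≤ L
        0≤L = 0≤N n nn+ 0≤K′
        0≤C : 0# ≤ C
        0≤C = (ι-mono (0≤# 4) nn* 0≤K′) nn+ (ι-mono (0≤# 5) nn* (0≤L nn* 0≤L)) nn+ 0≤L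

      g : R → R
      g t = sin (arctanSum n t) - t * cos (arctanSum n t)

      module _ (t : R) (0≤t : 0# ≤ t) (t+h≤1 : t + h ≤ 1#) where
        open Step t h 0≤t 0≤h t+h≤1
        private
          p A δ Dₙ E s c u v : R
          p = t ↑ (2 ℕ.* n)
          A = arctanSum n t
          δ = arctanSum n (t + h) - A
          Dₙ = geometricSum n t
          E = δ - h * Dₙ
          s = sin A
          c = cos A
          u = cos δ - 1#
          v = sin δ - δ

          sw : s within 1#
          sw = sin-within A
          cw : c within 1#
          cw = cos-within A
          tw : t within 1#
          tw = within-≤ 0≤t t≤1
          hw : h within h
          hw = within-self 0≤h
          h1 : h within 1#
          h1 = within-≤ 0≤h h≤1

          closed : (1# + t * t) * Dₙ ≈ 1# - p
          closed = trans (geometricSum-closed n t)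
            (-‿-cong refl (trans (*-cong (≡⇒≈ (cong ι even)) refl) (solve 1 (λ a → con 1ℚ :* a := a) refl p)))

          pos : Pos (1# + t * t)
          pos = 1ℚ , 0<1 , by (sq-nonneg t) (solve 1 (λ a → con 1ℚ :+ a :* a :- con 1ℚ := a :* a) refl t)

          0≤D : 0# ≤ Dₙ
          0≤D = pos-cancel pos (≤-trans (to (solve 1 (λ a → (con 1ℚ :+ a :* a) :* con 0ℚ := con 0ℚ) refl t))
            (≤-trans (nn (↑≤1 (2 ℕ.* n))) (from closed)))

          -- From `(1 + t²) * Dₙ = 1 - p` and `1 + t² = 2 t + (1 - t)²`. The value ½ is the growth
          -- rate of the deviation per unit of `t`.
          tD≤½ : t * Dₙ ≤ ι ½
          tD≤½ = by (½-nn nn* 0≤↑ (2 ℕ.* n) nn+ ½-nn nn* (sq-nonneg (1# - t) nn* 0≤D))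
            (begin
              ι ½ - t * Dₙ
                ≈⟨ solve 3 (λ a b c → con ½ :- a :* b := con ½ :* c :+ (con ½ :* (con 1ℚ :- c) :- a :* b))
                refl t Dₙ p ⟩
              ι ½ * p + (ι ½ * (1# - p) - t * Dₙ)
                ≈⟨ +-cong refl (-‿-cong (*-cong refl closed) refl) ⟨
              ι ½ * p + (ι ½ * ((1# + t * t) * Dₙ) - t * Dₙ)
                ≈⟨ solve 3 (λ a b c → con ½ :* a :+ (con ½ :* ((con 1ℚ :+ b :* b) :* c) :- b :* c) := con ½ :* a
                :+ con ½ :* ((con 1ℚ :- b) :* (con 1ℚ :- b) :* c)) refl p t Dₙ ⟩
              ι ½ * p + ι ½ * ((1# - t) * (1# - t) * Dₙ)          ∎)
            where open ≈-Reasoning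

          growth : 1# + h * (t * Dₙ) within 1# + ι ½ * h
          growth = within-≤ (0≤1# nn+ 0≤h nn* (0≤t nn* 0≤D))
            (by (0≤h nn* nn tD≤½) (solve 3 (λ a b c → con 1ℚ :+ con ½ :* a :- (con 1ℚ :+ a :* (b :* c)) := a :*
              (con ½ :- b :* c)) refl h t Dₙ))

          Ew : E within Kₙ * (h * h)
          Ew = arctan-rem n

          δw : δ within L * h
          δw = within-weaken
            (by (0≤K′ nn* (0≤h nn* nn h≤1)) (solve 3 (λ a b c → (a :+ b) :* c :- (c :* a :+ b :* (c :* c))
              := b :* (c :* (con 1ℚ :- c))) refl (N n) Kₙ h))
            (within-resp (solve 3 (λ a b c → a :* b :+ (c :- a :* b) := c) refl h Dₙ δ)
              (within-+ (within-* hw (geometricSum-within n)) Ew))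

          uw : u within (L * h) * (L * h)
          uw = within-weaken (sq-within δw) (cos-taylor₂ δ (within-weaken Lh≤1 δw))
          vw : v within (L * h) * (L * h)
          vw = within-weaken (sq-within δw) (sin-taylor₂ δ (within-weaken Lh≤1 δw))

          -- The discrete form of `g' = t D g - p cos A`, the differential equation of
          -- `g = sin A - t cos A` when `A' = D` and `(1 + t²) D = 1 - p`. The terms with `E`, `u`,
          -- `v` or `δ` are of second order in `h`.
          g-expand : g (t + h) ≈ (1# + h * (t * Dₙ)) * g t + t * (E * g t)
            + c * (h * (- p) + (1# + t * t) * E)
            + (s * u + c * v - t * (c * u) - h * (c * u) + h * (s * δ) + (t + h) * (s * v))
          g-expand = begin
            sin A⁺ - (t + h) * cos A⁺
              ≈⟨ -‿-cong (trans (sym (sin-shift A A⁺)) (sin-+ A δ))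
                (*-cong refl (trans (sym (cos-shift A A⁺)) (cos-+ A δ))) ⟩
            s * cos δ + c * sin δ - (t + h) * (c * cos δ - s * sin δ)
              ≈⟨ solve 8 (λ a b c d e f g h → a :* b :+ c :* d :- (e :+ f) :* (c :* b :- a :* d) :=
                (con 1ℚ :+ f :* (e :* g)) :* (a :- e :* c) :+ e :* ((h :- f :* g) :* (a :- e :* c)) :+ c :*
                (f :* ((con 1ℚ :+ e :* e) :* g :- con 1ℚ) :+ (con 1ℚ :+ e :* e) :* (h :- f :* g)) :+
                (a :* (b :- con 1ℚ) :+ c :* (d :- h) :- e :* (c :* (b :- con 1ℚ)) :- f :* (c :* (b :- con 1ℚ))
                :+ f :* (a :* h) :+ (e :+ f) :* (a :* (d :- h)))) refl s (cos δ) c (sin δ) t h Dₙ δ ⟩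
            (1# + h * (t * Dₙ)) * g t + t * (E * g t)
              + c * (h * ((1# + t * t) * Dₙ - 1#) + (1# + t * t) * E)
              + (s * u + c * v - t * (c * u) - h * (c * u) + h * (s * δ) + (t + h) * (s * v))
              ≈⟨ +-cong (+-cong refl (*-cong refl
                (+-cong (*-cong refl (trans (-‿-cong closed refl)
                (solve 1 (λ a → con 1ℚ :- a :- con 1ℚ := (:- a)) refl p))) refl))) refl ⟩
            (1# + h * (t * Dₙ)) * g t + t * (E * g t)
              + c * (h * (- p) + (1# + t * t) * E)
              + (s * u + c * v - t * (c * u) - h * (c * u) + h * (s * δ) + (t + h) * (s * v)) ∎
            where
            open ≈-Reasoning
            A⁺ : R
            A⁺ = arctanSum n (t + h)

        g-step : ∀ {G} → g t within G → g (t + h) within (1# + ι ½ * h) * G + (h * p + C * (h * h))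
        g-step {G} w = within-weaken
          (to (solve 5 (λ a b c d e → (con 1ℚ :+ con ½ :* a) :* b :+ con 1ℚ :*
            (c :* (a :* a) :* (con 1ℚ :+ con 1ℚ :* con 1ℚ)) :+ con 1ℚ :*
            (a :* d :+ (con 1ℚ :+ con 1ℚ :* con 1ℚ) :* (c :* (a :* a))) :+
            (con 1ℚ :* (e :* a :* (e :* a)) :+ con 1ℚ :* (e :* a :* (e :* a)) :+ con 1ℚ :*
            (con 1ℚ :* (e :* a :* (e :* a))) :+ con 1ℚ :* (con 1ℚ :* (e :* a :* (e :* a))) :+ a :*
            (con 1ℚ :* (e :* a)) :+ con 1ℚ :* (con 1ℚ :* (e :* a :* (e :* a)))) := (con 1ℚ :+ con ½ :* a) :* b
            :+ (a :* d :+ (con (# 4) :* c :+ con (# 5) :* (e :* e) :+ e) :* (a :* a))) refl h G Kₙ p L))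
          (within-resp (sym g-expand)
            (within-+ (within-+ (within-+ (within-* growth w) (within-* tw (within-* Ew gw)))
              (within-* cw (within-+ (within-* hw (within-neg (within-self (0≤↑ (2 ℕ.* n)))))
                                     (within-* (within-+ (within-self 0≤1#) (within-* tw tw)) Ew))))
              (within-+ (within-+ (within-+ (within-+ (within-+ (within-* sw uw) (within-* cw vw))
                (within-neg (within-* tw (within-* cw uw)))) (within-neg (within-* h1 (within-* cw uw))))
                (within-* hw (within-* sw δw)))
                (within-* (within-≤ 0≤t+h t+h≤1) (within-* sw vw)))))
          where
          gw : g t within 1# + 1# * 1#
          gw = within-+ sw (within-neg (within-* tw cw))

        a : R
        a = ι (inv (2 ℕ.* n))

        -- `1 - ½ t` is a discrete integrating factor: its value at `t + h`, times the growth
        -- `1 + ½ h`, does not exceed its value at `t`. The terms `h * p` are absorbed by the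
        -- increments of `a * t ↑ suc (2 * n)`, thanks to convexity.
        potential-step : ∀ {G} → 0# ≤ G → (1# - ι ½ * t) * G ≤ a * t ↑ suc (2 ℕ.* n) + C * h * t →
          (1# - ι ½ * (t + h)) * ((1# + ι ½ * h) * G + (h * p + C * (h * h)))
            ≤ a * (t + h) ↑ suc (2 ℕ.* n) + C * h * (t + h)
        potential-step {G} 0≤G q = by
          (nn q nn+ 0≤G nn* (ι-mono {0ℚ} {+ 1 Q./ 4} (ℚP.nonNegative⁻¹ (+ 1 Q./ 4)) nn* (0≤h nn* 0≤t+h))
                nn+ ½-nn nn* (0≤t+h nn* (0≤h nn* 0≤↑ (2 ℕ.* n) nn+ 0≤C nn* (0≤h nn* 0≤h)))
                nn+ 0≤inv (2 ℕ.* n) nn* 0≤rem (suc (2 ℕ.* n)))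
          (begin
            a * T⁺ + C * h * (t + h) - (1# - ι ½ * (t + h)) * ((1# + ι ½ * h) * G + (h * p + C * (h * h)))
              ≈⟨ solve 8 (λ a b c d e f g h → a :* b :+ c :* d :* (e :+ d) :- (con 1ℚ :- con ½ :* (e :+ d)) :*
                ((con 1ℚ :+ con ½ :* d) :* f :+ (d :* g :+ c :* (d :* d))) := a :* h :+ c :* d :* e :-
                (con 1ℚ :- con ½ :* e) :* f :+ f :* (con (+ 1 Q./ 4) :* (d :* (e :+ d))) :+ con ½ :*
                ((e :+ d) :* (d :* g :+ c :* (d :* d))) :+ (a :* (b :- h) :- d :* g)) refl a T⁺ C h t G p T ⟩
            a * T + C * h * t - (1# - ι ½ * t) * G + G * (ι (+ 1 Q./ 4) * (h * (t + h)))
              + ι ½ * ((t + h) * (h * p + C * (h * h))) + (a * (T⁺ - T) - h * p)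
              ≈⟨ +-cong refl (-‿-cong refl (*-cong refl (sym a*d))) ⟩
            a * T + C * h * t - (1# - ι ½ * t) * G + G * (ι (+ 1 Q./ 4) * (h * (t + h)))
              + ι ½ * ((t + h) * (h * p + C * (h * h))) + (a * (T⁺ - T) - h * (a * d (suc (2 ℕ.* n))))
              ≈⟨ +-cong refl (solve 5 (λ a b c d e → a :* (b :- c) :- d :* (a :* e) := a :* (b :- c :- d :* e))
                refl a T⁺ T h (d (suc (2 ℕ.* n)))) ⟩
            a * T + C * h * t - (1# - ι ½ * t) * G + G * (ι (+ 1 Q./ 4) * (h * (t + h)))
              + ι ½ * ((t + h) * (h * p + C * (h * h))) + a * rem (suc (2 ℕ.* n)) ∎)
          where
          open ≈-Reasoning
          T T⁺ : R
          T  = t ↑ suc (2 ℕ.* n)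
          T⁺ = (t + h) ↑ suc (2 ℕ.* n)
          a*d : a * d (suc (2 ℕ.* n)) ≈ p
          a*d = begin
            a * d (suc (2 ℕ.* n))           ≈⟨ *-cong
              (≡⇒≈ (cong ι (≡-trans (≡-sym (ℚP.*-identityˡ (inv (2 ℕ.* n))))
              (cong (Q._* inv (2 ℕ.* n)) (≡-sym even))))) refl ⟩
            ι (coeff n) * d (suc (2 ℕ.* n)) ≈⟨ coeff-d n ⟩
            ι (sign n) * p                  ≈⟨ *-cong (≡⇒≈ (cong ι even)) refl ⟩
            1# * p                          ≈⟨ solve 1 (λ a → con 1ℚ :* a := a) refl p ⟩
            p                               ∎

      grid : ℕ → R
      grid zero    = 0#
      grid (suc j) = grid j + h

      grid≈ : ∀ j → grid j ≈ N j * h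
      grid≈ zero    = solve 1 (λ a → con 0ℚ := con 0ℚ :* a) refl h
      grid≈ (suc j) = trans (+-cong (grid≈ j) refl)
        (trans (solve 2 (λ a b → a :* b :+ b := (con 1ℚ :+ a) :* b) refl (N j) h) (*-cong (sym (N-suc j)) refl))

      grid-end : grid (suc m) ≈ 1#
      grid-end = trans (grid≈ (suc m)) (trans (*-comm _ _) (inv*N m))

      0≤grid : ∀ j → 0# ≤ grid j
      0≤grid zero    = ≤-refl
      0≤grid (suc j) = 0≤grid j nn+ 0≤h

      grid-mono : ∀ i j → grid j ≤ grid (i ℕ.+ j)
      grid-mono zero    j = ≤-refl
      grid-mono (suc i) j = ≤-trans (grid-mono i j)
        (by 0≤h (solve 2 (λ a b → a :+ b :- a := b) refl (grid (i ℕ.+ j)) h))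

      grid≤1 : ∀ j → j ℕ.≤ suc m → grid j ≤ 1#
      grid≤1 j j≤M = ≤-trans (subst (λ z → grid j ≤ grid z) (ℕP.m∸n+n≡m j≤M) (grid-mono (suc m ℕ.∸ j) j))
        (to grid-end)

      G : ℕ → R
      G zero    = 0#
      G (suc j) = (1# + ι ½ * h) * G j + (h * grid j ↑ (2 ℕ.* n) + C * (h * h))

      0≤grid↑ : ∀ j k → 0# ≤ grid j ↑ k
      0≤grid↑ j zero    = 0≤1#
      0≤grid↑ j (suc k) = 0≤grid↑ j k nn* 0≤grid j

      0≤G : ∀ j → 0# ≤ G j
      0≤G zero    = ≤-refl
      0≤G (suc j) = (0≤1# nn+ ½-nn nn* 0≤h) nn* 0≤G j nn+ (0≤h nn* 0≤grid↑ j (2 ℕ.* n) nn+ 0≤C nn*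
        (0≤h nn* 0≤h))

      g-within : ∀ j → j ℕ.≤ suc m → g (grid j) within G j
      g-within zero    _ = within-resp
        (trans (solve 1 (λ a → con 0ℚ := con 0ℚ :- con 0ℚ :* a) refl (cos (arctanSum n 0#)))
          (-‿-cong (sym (sin-≈0 (arctanSum-0 n))) refl)) (within-0 ≤-refl)
      g-within (suc j) j<M = g-step (grid j) (0≤grid j) (grid≤1 (suc j) j<M) (g-within j (ℕP.<⇒≤ j<M))

      potential : ∀ j → j ℕ.≤ suc m → (1# - ι ½ * grid j) * G j ≤ ι (inv (2 ℕ.* n)) * grid j ↑ suc
        (2 ℕ.* n) + C * h * grid j
      potential zero    _ = to (solve 4 (λ a b c d → (con 1ℚ :- con ½ :* con 0ℚ) :* con 0ℚ := a :* (b :* con 0ℚ)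
        :+ c :* d :* con 0ℚ) refl (ι (inv (2 ℕ.* n))) (0# ↑ (2 ℕ.* n)) C h)
      potential (suc j) j<M = potential-step (grid j) (0≤grid j) (grid≤1 (suc j) j<M) (0≤G j)
        (potential j (ℕP.<⇒≤ j<M))

      -- The last grid point is `t = 1`, where the integrating factor has the value ½; this explains
      -- the factors 2.
      deviation : sin (ι (leibnizSum n)) - cos (ι (leibnizSum n)) within 2# * ι (inv (2 ℕ.* n)) + 2# * C * h
      deviation = within-weaken
        (by (ι-mono (0≤# 2) nn* nn (potential (suc m) ℕP.≤-refl))
          (begin
            2# * a′ + 2# * C * h - G (suc m)
              ≈⟨ solve 4 (λ a b c d → con (# 2) :* a :+ con (# 2) :* b :* c :- d := con (# 2) :*
                (a :* con 1ℚ :+ b :* c :* con 1ℚ :- (con 1ℚ :- con ½ :* con 1ℚ) :* d)) refl a′ C h (G (suc m)) ⟩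
            2# * (a′ * 1# + C * h * 1# - (1# - ι ½ * 1#) * G (suc m))
              ≈⟨ *-cong refl (-‿-cong (+-cong (*-cong refl (trans (↑-cong (suc (2 ℕ.* n)) grid-end)
                (1↑ (suc (2 ℕ.* n))))) (*-cong refl grid-end))
                   (*-cong (-‿-cong refl (*-cong refl grid-end)) refl)) ⟨
            2# * (a′ * grid (suc m) ↑ suc (2 ℕ.* n) + C * h * grid (suc m) - (1# - ι ½ * grid (suc m)) * G
              (suc m)) ∎))
        (within-resp
          (begin
            sin (arctanSum n T) - T * cos (arctanSum n T)
              ≈⟨ -‿-cong (sin-cong A≈) (*-cong grid-end (cos-cong A≈)) ⟩
            sin (ι (leibnizSum n)) - 1# * cos (ι (leibnizSum n))
              ≈⟨ -‿-cong refl (*-identityˡ _) ⟩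
            sin (ι (leibnizSum n)) - cos (ι (leibnizSum n)) ∎)
          (g-within (suc m) ℕP.≤-refl))
        where
        open ≈-Reasoning
        a′ T : R
        a′ = ι (inv (2 ℕ.* n))
        T  = grid (suc m)
        A≈ : arctanSum n T ≈ ι (leibnizSum n)
        A≈ = trans (arctanSum-cong n grid-end) (arctanSum-1 n)

-- The number π: periodicity and rational bounds

module Pi where
  open ArctangentAtOne public
  open D.Sequences using (sign; leibnizSum; cauchy-leibnizSum; Σ<)

  opaque
    unfolding R seq ι _+_ _*_ -_ _≤_

    leib : R
    leib = D.real leibnizSum cauchy-leibnizSum

    seq-leib : ∀ n → seq leib n ≡ leibnizSum n
    seq-leib n = ≡-refl

  π : R
  π = ι (# 4) * leib

  lim-sub : ∀ {f L} (φ : ℕ → ℕ) → (∀ m → m ℕ.≤ φ m) → Lim f L → Lim (λ m → f (φ m)) L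
  lim-sub φ le p ε 0<ε = let M , h = p ε 0<ε in M , λ m M≤m → h (φ m) (ℕP.≤-trans M≤m (le m))

  lim-leib : Lim (λ m → ι (leibnizSum m)) leib
  lim-leib ε 0<ε = ev (approx leib ε 0<ε) λ m (a , b) →
    let s≡ = seq-leib m in bounds
    (by (nn (subst (λ z → leib ≤ ι z + ι ε) s≡ a)) (solve 3 (λ a b c → a :- b :- (:- c) := a :+ c :- b) refl
      (ι (leibnizSum m)) leib (ι ε)))
    (by (nn (subst (λ z → ι z ≤ leib + ι ε) s≡ b)) (solve 3 (λ a b c → a :- (b :- c) := c :+ a :- b) refl (ι ε)
      (ι (leibnizSum m)) leib))

  sign-even : ∀ p → sign (p ℕ.+ p) ≡ 1ℚ
  sign-even zero    = ≡-refl
  sign-even (suc p) = ≡-trans (cong (λ z → Q.- sign z) (ℕP.+-suc p p))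
    (cong (λ z → Q.- (Q.- z)) (sign-even p))

  m≤m+m : ∀ m → m ℕ.≤ m ℕ.+ m
  m≤m+m m = ℕP.m≤m+n m m

  -- For fixed `n` the mesh is refined until the term with `C * h` disappears. Only afterwards may
  -- `n` grow, because `C` grows with it.
  deviation-limit : ∀ n → sign n ≡ 1ℚ →
    sin (ι (leibnizSum n)) - cos (ι (leibnizSum n)) within 2# * ι (inv (2 ℕ.* n))
  deviation-limit n even = lim-within-≤
    (ev (lim-0* L lim-inv 1ℚ 0<1) λ m w → deviation m
      (≤-trans (to (solve 2 (λ a b → a :* b := a :* b :- con 0ℚ) refl L (ι (inv m)))) (upper w)))
    (lim-cong (λ _ → refl) (solve 2 (λ a b → a :* b :+ con 0ℚ := a :* b) refl 2# (ι (inv (2 ℕ.* n))))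
      (lim-+ (lim-const _) (lim-0* (2# * C) lim-inv)))
    where
    open module Dev m = Deviation n even m using (deviation)
    -- `L` and `C` do not involve the mesh, so the instance at 0 stands for all of them.
    open Deviation n even 0 using (L; C)

  -- The limit is taken along even indices, for which `(1 + t²) * D = 1 - p` keeps `t * D` at most
  -- ½.
  sin-leib≈cos-leib : sin leib ≈ cos leib
  sin-leib≈cos-leib = begin
    sin leib                       ≈⟨ solve 2 (λ a b → a := a :- b :+ b) refl (sin leib) (cos leib) ⟩
    sin leib - cos leib + cos leib ≈⟨ +-cong (lim-unique difference vanish) refl ⟩
    0# + cos leib                  ≈⟨ solve 1 (λ a → con 0ℚ :+ a := a) refl (cos leib) ⟩
    cos leib                       ∎
    where
    open ≈-Reasoning
    f : ℕ → R
    f p = sin (ι (leibnizSum (p ℕ.+ p))) - cos (ι (leibnizSum (p ℕ.+ p)))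
    along : Lim (λ p → ι (leibnizSum (p ℕ.+ p))) leib
    along = lim-sub (λ p → p ℕ.+ p) m≤m+m lim-leib
    difference : Lim f (sin leib - cos leib)
    difference = lim-- (lim-sin along) (lim-cos along)
    vanish : Lim f 0#
    vanish = lim-within
      (always λ p → within-resp (solve 1 (λ a → a := a :- con 0ℚ) refl (f p))
        (deviation-limit (p ℕ.+ p) (sign-even p)))
      (lim-0* 2# (lim-sub (λ p → 2 ℕ.* (p ℕ.+ p)) (λ p → ℕP.≤-trans (m≤m+m p) (ℕP.m≤n*m (p ℕ.+ p) 2)) lim-inv))

  -- This is π/2. Equality of sine and cosine at π/4 yields its cosine 0 and sine 1 by the addition
  -- theorems, without computing √½.
  quarter : R
  quarter = leib + leib

  cos-quarter : cos quarter ≈ 0#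
  cos-quarter = begin
    cos (leib + leib)                         ≈⟨ cos-+ leib leib ⟩
    cos leib * cos leib - sin leib * sin leib ≈⟨ -‿-cong refl (*-cong sin-leib≈cos-leib sin-leib≈cos-leib) ⟩
    cos leib * cos leib - cos leib * cos leib ≈⟨ solve 1 (λ a → a :* a :- a :* a := con 0ℚ) refl (cos leib) ⟩
    0#                                        ∎
    where open ≈-Reasoning

  sin-quarter : sin quarter ≈ 1#
  sin-quarter = begin
    sin (leib + leib)                         ≈⟨ sin-+ leib leib ⟩
    sin leib * cos leib + cos leib * sin leib ≈⟨ +-cong (*-cong sin-leib≈cos-leib refl)
      (*-cong (sym sin-leib≈cos-leib) refl) ⟩
    cos leib * cos leib + sin leib * sin leib ≈⟨ cos²+sin² leib ⟩
    1#                                        ∎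
    where open ≈-Reasoning

  π≈quarters : π ≈ quarter + quarter
  π≈quarters = solve 1 (λ a → con (# 4) :* a := a :+ a :+ (a :+ a)) refl leib

  cos-π : cos π ≈ - 1#
  cos-π = begin
    cos π                                                 ≈⟨ trans (cos-cong π≈quarters)
      (cos-+ quarter quarter) ⟩
    cos quarter * cos quarter - sin quarter * sin quarter ≈⟨ -‿-cong (*-cong cos-quarter cos-quarter)
      (*-cong sin-quarter sin-quarter) ⟩
    0# * 0# - 1# * 1#
      ≈⟨ solve 0 (con 0ℚ :* con 0ℚ :- con 1ℚ :* con 1ℚ := (:- (con 1ℚ))) refl ⟩
    - 1#                                                  ∎
    where open ≈-Reasoning

  sin-π : sin π ≈ 0#
  sin-π = begin
    sin π                                                 ≈⟨ trans (sin-cong π≈quarters)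
      (sin-+ quarter quarter) ⟩
    sin quarter * cos quarter + cos quarter * sin quarter ≈⟨ +-cong (*-cong refl cos-quarter)
      (*-cong cos-quarter refl) ⟩
    sin quarter * 0# + 0# * sin quarter
      ≈⟨ solve 1 (λ a → a :* con 0ℚ :+ con 0ℚ :* a := con 0ℚ) refl (sin quarter) ⟩
    0#                                                    ∎
    where open ≈-Reasoning

  2π : R
  2π = 2# * π

  private
    2π≈ : 2π ≈ π + π
    2π≈ = solve 1 (λ a → con (# 2) :* a := a :+ a) refl π

  cos-2π : cos 2π ≈ 1#
  cos-2π = begin
    cos 2π                        ≈⟨ trans (cos-cong 2π≈) (cos-+ π π) ⟩
    cos π * cos π - sin π * sin π ≈⟨ -‿-cong (*-cong cos-π cos-π) (*-cong sin-π sin-π) ⟩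
    (- 1#) * (- 1#) - 0# * 0#     ≈⟨ solve 0 ((:- (con 1ℚ)) :* (:- (con 1ℚ)) :- con 0ℚ :* con 0ℚ := con 1ℚ)
      refl ⟩
    1#                            ∎
    where open ≈-Reasoning

  sin-2π : sin 2π ≈ 0#
  sin-2π = begin
    sin 2π                        ≈⟨ trans (sin-cong 2π≈) (sin-+ π π) ⟩
    sin π * cos π + cos π * sin π ≈⟨ +-cong (*-cong sin-π refl) (*-cong refl sin-π) ⟩
    0# * cos π + cos π * 0#       ≈⟨ solve 1 (λ a → con 0ℚ :* a :+ a :* con 0ℚ := con 0ℚ) refl (cos π) ⟩
    0#                            ∎
    where open ≈-Reasoning

  cos-period : ∀ x → cos (x + 2π) ≈ cos x
  cos-period x = begin
    cos (x + 2π)                    ≈⟨ cos-+ x 2π ⟩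
    cos x * cos 2π - sin x * sin 2π ≈⟨ -‿-cong (*-cong refl cos-2π) (*-cong refl sin-2π) ⟩
    cos x * 1# - sin x * 0#         ≈⟨ solve 2 (λ a b → a :* con 1ℚ :- b :* con 0ℚ := a) refl (cos x) (sin x) ⟩
    cos x                           ∎
    where open ≈-Reasoning

  sin-period : ∀ x → sin (x + 2π) ≈ sin x
  sin-period x = begin
    sin (x + 2π)                    ≈⟨ sin-+ x 2π ⟩
    sin x * cos 2π + cos x * sin 2π ≈⟨ +-cong (*-cong refl cos-2π) (*-cong refl sin-2π) ⟩
    sin x * 1# + cos x * 0#         ≈⟨ solve 2 (λ a b → a :* con 1ℚ :+ b :* con 0ℚ := a) refl (sin x) (cos x) ⟩
    sin x                           ∎
    where open ≈-Reasoning

  period-multiple : ∀ x k → cos (x + N k * 2π) ≈ cos x × sin (x + N k * 2π) ≈ sin x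
  period-multiple x zero    = cos-cong e , sin-cong e
    where
    e : x + 0# * 2π ≈ x
    e = solve 3 (λ a b c → a :+ con 0ℚ :* (b :* c) := a) refl x 2# π
  period-multiple x (suc k) =
    trans (cos-cong e) (trans (cos-period _) (proj₁ (period-multiple x k))) ,
    trans (sin-cong e) (trans (sin-period _) (proj₂ (period-multiple x k)))
    where
    e : x + N (suc k) * 2π ≈ x + N k * 2π + 2π
    e = trans (+-cong refl (*-cong (N-suc k) refl))
      (solve 4 (λ a b c d → a :+ (con 1ℚ :+ b) :* (c :* d) := a :+ b :* (c :* d) :+ c :* d) refl x (N k) 2# π)

  -- Consecutive partial sums of the alternating Leibniz series bracket its limit.

  private
    pair-up : ∀ n → sign n ≡ 1ℚ → leibnizSum n Q.≤ leibnizSum (suc (suc n))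
    pair-up n e = ≤-by (0≤- (inv-anti (ℕP.*-monoʳ-≤ 2 (ℕP.n≤1+n n))))
      (≡-trans (cong (λ s → leibnizSum n Q.+ s Q.* inv (2 ℕ.* n) Q.+ (Q.- s) Q.* inv (2 ℕ.* suc n) Q.-
        leibnizSum n) e)
        (S.solve 3 (λ a b c → a S.:+ S.con 1ℚ S.:* b S.:+ (S.:- (S.con 1ℚ)) S.:* c S.:- a S.:= b S.:- c) ≡-refl
          (leibnizSum n) (inv (2 ℕ.* n)) (inv (2 ℕ.* suc n))))

    pair-down : ∀ n → sign n ≡ Q.- 1ℚ → leibnizSum (suc (suc n)) Q.≤ leibnizSum n
    pair-down n e = ≤-by (0≤- (inv-anti (ℕP.*-monoʳ-≤ 2 (ℕP.n≤1+n n))))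
      (≡-trans (cong (λ s → leibnizSum n Q.- (leibnizSum n Q.+ s Q.* inv (2 ℕ.* n) Q.+ (Q.- s) Q.* inv
        (2 ℕ.* suc n))) e)
        (S.solve 3 (λ a b c → a S.:- (a S.:+ (S.:- (S.con 1ℚ)) S.:* b S.:+ (S.:- (S.:- (S.con 1ℚ))) S.:* c) S.:=
          b S.:- c) ≡-refl (leibnizSum n) (inv (2 ℕ.* n)) (inv (2 ℕ.* suc n))))

    +-suc-suc : ∀ c j → c ℕ.+ (suc j ℕ.+ suc j) ≡ suc (suc (c ℕ.+ (j ℕ.+ j)))
    +-suc-suc c j = ≡-trans (cong (c ℕ.+_) (cong suc (ℕP.+-suc j j)))
      (≡-trans (ℕP.+-suc c _) (cong suc (ℕP.+-suc c _)))

    leib-lower : ∀ j → ½ Q.≤ leibnizSum (2 ℕ.+ (j ℕ.+ j))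
    leib-lower zero    = ℚP.≤ᵇ⇒≤ _
    leib-lower (suc j) = subst (λ z → ½ Q.≤ leibnizSum z) (≡-sym (+-suc-suc 2 j))
      (ℚP.≤-trans (leib-lower j) (pair-up (2 ℕ.+ (j ℕ.+ j)) (cong (λ z → Q.- (Q.- z)) (sign-even j))))

    leib-upper : ∀ j → leibnizSum (5 ℕ.+ (j ℕ.+ j)) Q.≤ + 17 Q./ 20
    leib-upper zero    = ℚP.≤ᵇ⇒≤ _
    leib-upper (suc j) = subst (λ z → leibnizSum z Q.≤ + 17 Q./ 20) (≡-sym (+-suc-suc 5 j))
      (ℚP.≤-trans (pair-down (5 ℕ.+ (j ℕ.+ j)) (cong (λ z → Q.- (Q.- (Q.- (Q.- (Q.- z))))) (sign-even j)))
        (leib-upper j))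

  -- The even partial sums increase from `1 - 1/3`, which exceeds ½.
  2≤π : 2# ≤ π
  2≤π = by (ι-mono (0≤# 4) nn* nn (lim-≤ (always λ j → ι-mono (leib-lower j)) (lim-const (ι ½))
      (lim-sub (λ j → 2 ℕ.+ (j ℕ.+ j)) (λ j → ℕP.≤-trans (m≤m+m j) (ℕP.m≤n+m (j ℕ.+ j) 2)) lim-leib)))
    (solve 1 (λ a → con (# 4) :* a :- con (# 2) := con (# 4) :* (a :- con ½)) refl leib)

  -- Five terms of the series give 263/315, just below 17/20. The consequence `2π ≤ 34/5 < 7` is the
  -- source of the bound 7 on arguments.
  π≤17/5 : π ≤ ι (+ 17 Q./ 5)
  π≤17/5 = by (ι-mono (0≤# 4) nn* nn (lim-≤ (always λ j → ι-mono (leib-upper j))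
      (lim-sub (λ j → 5 ℕ.+ (j ℕ.+ j)) (λ j → ℕP.≤-trans (m≤m+m j) (ℕP.m≤n+m (j ℕ.+ j) 5)) lim-leib)
        (lim-const (ι (+ 17 Q./ 20)))))
    (solve 1 (λ a → con (+ 17 Q./ 5) :- con (# 4) :* a := con (# 4) :* (con (+ 17 Q./ 20) :- a)) refl leib)

-- Complex numbers and factorisation over given roots

module Complex where
  open Pi public
  open import Algebra.Bundles using (CommutativeRing)
  open import Algebra.Solver.Ring.AlmostCommutativeRing using (fromCommutativeRing; _-Raw-AlmostCommutative⟶_)
  import Algebra.Solver.Ring
  open import Data.Maybe using (Maybe; just; nothing)
  open import Data.Vec using (Vec; []; _∷_; replicate)
  open import Relation.Binary using (IsEquivalence)
  open import Relation.Binary.Bundles using (Setoid)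

  record ℂ : Set where
    constructor _+i_
    field
      re im : R
  open ℂ public

  infix  4 _≈ᶜ_
  infixl 6 _+ᶜ_ _-ᶜ_
  infixl 7 _*ᶜ_
  infix  8 -ᶜ_

  record _≈ᶜ_ (z w : ℂ) : Set where
    constructor _,_
    field
      re≈ : re z ≈ re w
      im≈ : im z ≈ im w
  open _≈ᶜ_ public

  opaque
    _+ᶜ_ _*ᶜ_ : ℂ → ℂ → ℂ
    z +ᶜ w = (re z + re w) +i (im z + im w)
    z *ᶜ w = (re z * re w - im z * im w) +i (re z * im w + im z * re w)

    -ᶜ_ : ℂ → ℂ
    -ᶜ z = (- re z) +i (- im z)

    ιᶜ : ℚ → ℂ
    ιᶜ q = ι q +i 0#

    norm² : ℂ → R
    norm² z = re z * re z + im z * im z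

  _-ᶜ_ : ℂ → ℂ → ℂ
  z -ᶜ w = z +ᶜ (-ᶜ w)

  0ᶜ 1ᶜ : ℂ
  0ᶜ = ιᶜ 0ℚ
  1ᶜ = ιᶜ 1ℚ

  reflᶜ : ∀ {z} → z ≈ᶜ z
  reflᶜ = refl , refl

  symᶜ : ∀ {z w} → z ≈ᶜ w → w ≈ᶜ z
  symᶜ (a , b) = sym a , sym b

  transᶜ : ∀ {z w u} → z ≈ᶜ w → w ≈ᶜ u → z ≈ᶜ u
  transᶜ (a , b) (c , d) = trans a c , trans b d

  opaque
    unfolding _+ᶜ_

    +ᶜ-cong : ∀ {x y u v} → x ≈ᶜ y → u ≈ᶜ v → x +ᶜ u ≈ᶜ y +ᶜ v
    +ᶜ-cong (a , b) (c , d) = +-cong a c , +-cong b d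

    -ᶜ-cong : ∀ {x y} → x ≈ᶜ y → -ᶜ x ≈ᶜ -ᶜ y
    -ᶜ-cong (a , b) = neg-cong a , neg-cong b

    *ᶜ-cong : ∀ {x y u v} → x ≈ᶜ y → u ≈ᶜ v → x *ᶜ u ≈ᶜ y *ᶜ v
    *ᶜ-cong (a , b) (c , d) = -‿-cong (*-cong a c) (*-cong b d) , +-cong (*-cong a d) (*-cong b c)

    +ᶜ-assoc : ∀ x y z → (x +ᶜ y) +ᶜ z ≈ᶜ x +ᶜ (y +ᶜ z)
    +ᶜ-assoc x y z = +-assoc _ _ _ , +-assoc _ _ _

    +ᶜ-comm : ∀ x y → x +ᶜ y ≈ᶜ y +ᶜ x
    +ᶜ-comm x y = +-comm _ _ , +-comm _ _

    +ᶜ-identityˡ : ∀ x → 0ᶜ +ᶜ x ≈ᶜ x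
    +ᶜ-identityˡ x = +-identityˡ _ , +-identityˡ _

    +ᶜ-inverseˡ : ∀ x → -ᶜ x +ᶜ x ≈ᶜ 0ᶜ
    +ᶜ-inverseˡ x = +-inverseˡ _ , +-inverseˡ _

    *ᶜ-assoc : ∀ x y z → (x *ᶜ y) *ᶜ z ≈ᶜ x *ᶜ (y *ᶜ z)
    *ᶜ-assoc (a +i b) (c +i d) (e +i f) =
      (solve 6 (λ a b c d e f → (a :* b :- c :* d) :* e :- (a :* d :+ c :* b) :* f := a :* (b :* e :- d :* f)
        :- c :* (b :* f :+ d :* e)) refl a c b d e f) ,
      (solve 6 (λ a b c d e f → (a :* b :- c :* d) :* e :+ (a :* d :+ c :* b) :* f := a :* (b :* e :+ d :* f)
        :+ c :* (b :* f :- d :* e)) refl a c b d f e)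

    *ᶜ-comm : ∀ x y → x *ᶜ y ≈ᶜ y *ᶜ x
    *ᶜ-comm (a +i b) (c +i d) = (solve 4 (λ a b c d → a :* b :- c :* d := b :* a :- d :* c) refl a c b d) ,
      (solve 4 (λ a b c d → a :* b :+ c :* d := d :* c :+ b :* a) refl a d b c)

    *ᶜ-identityˡ : ∀ x → 1ᶜ *ᶜ x ≈ᶜ x
    *ᶜ-identityˡ (a +i b) = (solve 2 (λ a b → con 1ℚ :* a :- con 0ℚ :* b := a) refl a b) ,
      (solve 2 (λ a b → con 1ℚ :* a :+ con 0ℚ :* b := a) refl b a)

    *ᶜ-distribˡ : ∀ x y z → x *ᶜ (y +ᶜ z) ≈ᶜ x *ᶜ y +ᶜ x *ᶜ z
    *ᶜ-distribˡ (a +i b) (c +i d) (e +i f) =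
      (solve 6 (λ a b c d e f → a :* (b :+ c) :- d :* (e :+ f) := a :* b :- d :* e :+ (a :* c :- d :* f))
        refl a c e b d f) ,
      (solve 6 (λ a b c d e f → a :* (b :+ c) :+ d :* (e :+ f) := a :* b :+ d :* e :+ (a :* c :+ d :* f))
        refl a d f b c e)

    ιᶜ-+ : ∀ p q → ιᶜ (p Q.+ q) ≈ᶜ ιᶜ p +ᶜ ιᶜ q
    ιᶜ-+ p q = ι-+ p q , (solve 0 (con 0ℚ := con 0ℚ :+ con 0ℚ) refl)

    ιᶜ-* : ∀ p q → ιᶜ (p Q.* q) ≈ᶜ ιᶜ p *ᶜ ιᶜ q
    ιᶜ-* p q = trans (ι-* p q) (solve 2 (λ a b → a :* b := a :* b :- con 0ℚ :* con 0ℚ) refl (ι p) (ι q)) ,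
      (solve 2 (λ a b → con 0ℚ := a :* con 0ℚ :+ con 0ℚ :* b) refl (ι p) (ι q))

    ιᶜ-neg : ∀ p → ιᶜ (Q.- p) ≈ᶜ -ᶜ ιᶜ p
    ιᶜ-neg p = ι-neg p , (solve 0 (con 0ℚ := (:- (con 0ℚ))) refl)

    norm²-cong : ∀ {z w} → z ≈ᶜ w → norm² z ≈ norm² w
    norm²-cong (a , b) = +-cong (*-cong a a) (*-cong b b)

    norm²-* : ∀ z w → norm² (z *ᶜ w) ≈ norm² z * norm² w
    norm²-* (a +i b) (c +i d) =
      (solve 4 (λ a b c d → (a :* b :- c :* d) :* (a :* b :- c :* d) :+ (a :* d :+ c :* b) :* (a :* d :+ c :* b)
        := (a :* a :+ c :* c) :* (b :* b :+ d :* d)) refl a c b d)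

    norm²-1 : norm² 1ᶜ ≈ 1#
    norm²-1 = solve 0 (con 1ℚ :* con 1ℚ :+ con 0ℚ :* con 0ℚ := con 1ℚ) refl

    -- Multiplication by the conjugate of `w`: two combinations of the real and the imaginary
    -- equation isolate `norm² w` times each component of `v`.
    norm²-regular : ∀ {w} → Pos (norm² w) → ∀ v → w *ᶜ v ≈ᶜ 0ᶜ → v ≈ᶜ 0ᶜ
    norm²-regular {a +i b} pos (c +i d) (e , f) =
      pos-cancel-≈ pos (trans (solve 4 (λ a b c d → (a :* a :+ b :* b) :* c := a :* (a :* c :- b :* d) :+ b :*
        (a :* d :+ b :* c)) refl a b c d)
        (trans (+-cong (*-cong refl e) (*-cong refl f))
          (solve 2 (λ a b → a :* con 0ℚ :+ b :* con 0ℚ := (a :* a :+ b :* b) :* con 0ℚ) refl a b))) ,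
      pos-cancel-≈ pos (trans (solve 4 (λ a b c d → (a :* a :+ b :* b) :* c := a :* (a :* c :+ b :* d) :- b :*
        (a :* d :- b :* c)) refl a b d c)
        (trans (-‿-cong (*-cong refl f) (*-cong refl e))
          (solve 2 (λ a b → a :* con 0ℚ :- b :* con 0ℚ := (a :* a :+ b :* b) :* con 0ℚ) refl a b)))

  isEquivalenceᶜ : IsEquivalence _≈ᶜ_
  isEquivalenceᶜ = record { refl = reflᶜ ; sym = symᶜ ; trans = transᶜ }

  setoidᶜ : Setoid 0ℓ 0ℓ
  setoidᶜ = record { isEquivalence = isEquivalenceᶜ }

  commutativeRingᶜ : CommutativeRing 0ℓ 0ℓ
  commutativeRingᶜ = record
    { Carrier = ℂ ; _≈_ = _≈ᶜ_ ; _+_ = _+ᶜ_ ; _*_ = _*ᶜ_ ; -_ = -ᶜ_ ; 0# = 0ᶜ ; 1# = 1ᶜ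
    ; isCommutativeRing = record
      { isRing = record
        { +-isAbelianGroup = record
          { isGroup = record
            { isMonoid = record
              { isSemigroup = record
                { isMagma = record { isEquivalence = isEquivalenceᶜ ; ∙-cong = +ᶜ-cong }
                ; assoc = +ᶜ-assoc }
              ; identity = +ᶜ-identityˡ , λ x → transᶜ (+ᶜ-comm x 0ᶜ) (+ᶜ-identityˡ x) }
            ; inverse = +ᶜ-inverseˡ , (λ x → transᶜ (+ᶜ-comm x (-ᶜ x)) (+ᶜ-inverseˡ x))
            ; ⁻¹-cong = -ᶜ-cong }
          ; comm = +ᶜ-comm }
        ; *-cong = *ᶜ-cong
        ; *-assoc = *ᶜ-assoc
        ; *-identity = *ᶜ-identityˡ , (λ x → transᶜ (*ᶜ-comm x 1ᶜ) (*ᶜ-identityˡ x))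
        ; distrib = *ᶜ-distribˡ , λ x y z → transᶜ (*ᶜ-comm (y +ᶜ z) x)
            (transᶜ (*ᶜ-distribˡ x y z) (+ᶜ-cong (*ᶜ-comm x y) (*ᶜ-comm x z)))
        }
      ; *-comm = *ᶜ-comm } }

  private
    almostᶜ = fromCommutativeRing commutativeRingᶜ
    ιᶜ-morphism : Q.+-*-rawRing -Raw-AlmostCommutative⟶ almostᶜ
    ιᶜ-morphism = record { ⟦_⟧ = ιᶜ ; +-homo = ιᶜ-+ ; *-homo = ιᶜ-* ; -‿homo = ιᶜ-neg ; 0-homo =
      reflᶜ ; 1-homo = reflᶜ }
    ιᶜ-≟ : ∀ p q → Maybe (ιᶜ p ≈ᶜ ιᶜ q)
    ιᶜ-≟ p q with p ℚP.≟ q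
    ... | yes ≡-refl = just reflᶜ
    ... | no  _      = nothing

  module C = Algebra.Solver.Ring Q.+-*-rawRing almostᶜ ιᶜ-morphism ιᶜ-≟

  module ≈ᶜ-Reasoning where
    open import Relation.Binary.Reasoning.Setoid setoidᶜ public

  -- Monic polynomials of degree n, given by their lower coefficients.

  eval : ∀ {n} → Vec ℂ n → ℂ → ℂ
  eval []       z = 1ᶜ
  eval (a ∷ as) z = a +ᶜ z *ᶜ eval as z

  -- Synthetic division by `z - r`: the successive coefficients are the Horner values at `r`.
  quotient : ∀ {n} → Vec ℂ (suc n) → ℂ → Vec ℂ n
  quotient (a ∷ [])      r = []
  quotient (a ∷ as@(_ ∷ _)) r = eval as r ∷ quotient as r

  division : ∀ {n} (as : Vec ℂ (suc n)) r z → eval as z ≈ᶜ eval as r +ᶜ (z -ᶜ r) *ᶜ eval (quotient as r) z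
  division (a ∷ []) r z = C.solve 3 (λ a b c → a C.:+ b C.:* C.con 1ℚ C.:= a C.:+ c C.:* C.con 1ℚ C.:+
    (b C.:- c) C.:* C.con 1ℚ) reflᶜ a z r
  division (a ∷ as@(_ ∷ _)) r z = transᶜ (+ᶜ-cong reflᶜ (*ᶜ-cong reflᶜ (division as r z)))
    (C.solve 5 (λ a b c d e → a C.:+ b C.:* (c C.:+ (b C.:- d) C.:* e) C.:= a C.:+ d C.:* c C.:+ (b C.:- d) C.:*
      (c C.:+ b C.:* e)) reflᶜ a z (eval as r) r (eval (quotient as r) z))

  ∏ᶜ : ℕ → (ℕ → ℂ) → ℂ
  ∏ᶜ zero    f = 1ᶜ
  ∏ᶜ (suc n) f = f 0 *ᶜ ∏ᶜ n (f ∘ suc)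

  -- Cancellability is all that the factor theorem asks of a difference of roots, so no complex
  -- inverse is formed.
  Regular : ℂ → Set
  Regular w = ∀ v → w *ᶜ v ≈ᶜ 0ᶜ → v ≈ᶜ 0ᶜ

  -- Each further root of `as` is a root of `quotient as (r 0)`, because the difference of the two
  -- roots can be cancelled in `division`. Constructively this asks more than that the roots differ.
  roots⇒product : ∀ n (as : Vec ℂ n) (r : ℕ → ℂ) →
    (∀ i → i ℕ.< n → eval as (r i) ≈ᶜ 0ᶜ) →
    (∀ i j → i ℕ.< j → j ℕ.< n → Regular (r j -ᶜ r i)) →
    ∀ z → eval as z ≈ᶜ ∏ᶜ n (λ i → z -ᶜ r i)
  roots⇒product zero    []          r root apart z = reflᶜ
  roots⇒product (suc n) as@(_ ∷ _) r root apart z = begin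
    eval as z                                ≈⟨ division as (r 0) z ⟩
    eval as (r 0) +ᶜ (z -ᶜ r 0) *ᶜ eval q z  ≈⟨ +ᶜ-cong (root 0 (ℕ.s≤s ℕ.z≤n)) (*ᶜ-cong reflᶜ ih) ⟩
    0ᶜ +ᶜ (z -ᶜ r 0) *ᶜ P                    ≈⟨ C.solve 3 (λ a b c → C.con 0ℚ C.:+ (a C.:- b) C.:* c C.:=
      (a C.:- b) C.:* c) reflᶜ z (r 0) P ⟩
    (z -ᶜ r 0) *ᶜ P                          ∎
    where
    open ≈ᶜ-Reasoning
    q : Vec ℂ n
    q = quotient as (r 0)
    P : ℂ
    P = ∏ᶜ n (λ i → z -ᶜ r (suc i))
    root′ : ∀ i → i ℕ.< n → eval q (r (suc i)) ≈ᶜ 0ᶜ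
    root′ i i<n = apart 0 (suc i) (ℕ.s≤s ℕ.z≤n) (ℕ.s≤s i<n) (eval q (r (suc i))) (begin
      (r (suc i) -ᶜ r 0) *ᶜ eval q (r (suc i))
        ≈⟨ C.solve 3 (λ a b c → (a C.:- b) C.:* c C.:= C.con 0ℚ C.:+ (a C.:- b) C.:* c) reflᶜ (r (suc i)) (r 0)
          (eval q (r (suc i))) ⟩
      0ᶜ +ᶜ (r (suc i) -ᶜ r 0) *ᶜ eval q (r (suc i))
        ≈⟨ +ᶜ-cong (root 0 (ℕ.s≤s ℕ.z≤n)) reflᶜ ⟨
      eval as (r 0) +ᶜ (r (suc i) -ᶜ r 0) *ᶜ eval q (r (suc i))
        ≈⟨ division as (r 0) (r (suc i)) ⟨
      eval as (r (suc i))
        ≈⟨ root (suc i) (ℕ.s≤s i<n) ⟩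
      0ᶜ ∎)
    ih : eval q z ≈ᶜ P
    ih = roots⇒product n q (r ∘ suc) root′ (λ i j i<j j<n → apart (suc i) (suc j) (ℕ.s≤s i<j) (ℕ.s≤s j<n)) z

  infixl 9 _↑ᶜ_
  _↑ᶜ_ : ℂ → ℕ → ℂ
  z ↑ᶜ zero  = 1ᶜ
  z ↑ᶜ suc n = z *ᶜ z ↑ᶜ n

  eval-zeros : ∀ n z → eval (replicate n 0ᶜ) z ≈ᶜ z ↑ᶜ n
  eval-zeros zero    z = reflᶜ
  eval-zeros (suc n) z = transᶜ (+ᶜ-cong reflᶜ (*ᶜ-cong reflᶜ (eval-zeros n z)))
    (C.solve 2 (λ a b → C.con 0ℚ C.:+ a C.:* b C.:= a C.:* b) reflᶜ z (z ↑ᶜ n))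

  power-difference : ∀ n c (r : ℕ → ℂ) → (∀ i → i ℕ.< suc n → r i ↑ᶜ suc n ≈ᶜ c) →
    (∀ i j → i ℕ.< j → j ℕ.< suc n → Regular (r j -ᶜ r i)) →
    ∀ z → z ↑ᶜ suc n -ᶜ c ≈ᶜ ∏ᶜ (suc n) (λ i → z -ᶜ r i)
  power-difference n c r root apart z = transᶜ (symᶜ (poly z))
    (roots⇒product (suc n) (-ᶜ c ∷ replicate n 0ᶜ) r
      (λ i i<n → transᶜ (poly (r i)) (transᶜ (+ᶜ-cong (root i i<n) reflᶜ)
        (C.solve 1 (λ a → a C.:- a C.:= C.con 0ℚ) reflᶜ c))) apart z)
    where
    poly : ∀ z → eval (-ᶜ c ∷ replicate n 0ᶜ) z ≈ᶜ z ↑ᶜ suc n -ᶜ c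
    poly z = transᶜ (+ᶜ-cong reflᶜ (*ᶜ-cong reflᶜ (eval-zeros n z))) (+ᶜ-comm _ _)

  ∏ : ℕ → (ℕ → R) → R
  ∏ zero    f = 1#
  ∏ (suc n) f = f 0 * ∏ n (f ∘ suc)

  ∏-cong : ∀ n {f g} → (∀ i → i ℕ.< n → f i ≈ g i) → ∏ n f ≈ ∏ n g
  ∏-cong zero    e = refl
  ∏-cong (suc n) e = *-cong (e 0 (ℕ.s≤s ℕ.z≤n)) (∏-cong n λ i i<n → e (suc i) (ℕ.s≤s i<n))

  norm²-∏ : ∀ n f → norm² (∏ᶜ n f) ≈ ∏ n (norm² ∘ f)
  norm²-∏ zero    f = norm²-1
  norm²-∏ (suc n) f = trans (norm²-* _ _) (*-cong refl (norm²-∏ n (f ∘ suc)))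

  polar : R → R → ℂ
  polar q φ = (q * cos φ) +i (q * sin φ)

  opaque
    unfolding _+ᶜ_

    polar-* : ∀ p q φ ψ → polar p φ *ᶜ polar q ψ ≈ᶜ polar (p * q) (φ + ψ)
    polar-* p q φ ψ =
      trans (solve 6 (λ a b c d e f → a :* b :* (c :* d) :- a :* e :* (c :* f) := a :* c :* (b :* d :- e :* f))
        refl p (cos φ) q (cos ψ) (sin φ) (sin ψ))
        (*-cong refl (sym (cos-+ φ ψ))) ,
      trans (solve 6 (λ a b c d e f → a :* b :* (c :* d) :+ a :* e :* (c :* f) := a :* c :* (e :* f :+ b :* d))
        refl p (cos φ) q (sin ψ) (sin φ) (cos ψ))
        (*-cong refl (sym (sin-+ φ ψ)))

    polar-1 : 1ᶜ ≈ᶜ polar 1# 0#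
    polar-1 = sym (trans (*-cong refl (cos-≈0 refl)) (solve 0 (con 1ℚ :* con 1ℚ := con 1ℚ) refl)) ,
              sym (trans (*-cong refl (sin-≈0 refl)) (solve 0 (con 1ℚ :* con 0ℚ := con 0ℚ) refl))

    -- The law of cosines.
    norm²-real-polar : ∀ p q φ → norm² ((p +i 0#) -ᶜ polar q φ) ≈ p * p + q * q - 2# * (p * q) * cos φ
    norm²-real-polar p q φ = begin
      (p + - (q * cos φ)) * (p + - (q * cos φ)) + (0# + - (q * sin φ)) * (0# + - (q * sin φ))
        ≈⟨ solve 4 (λ a b c d → (a :+ (:- (b :* c))) :* (a :+ (:- (b :* c))) :+ (con 0ℚ :+ (:- (b :* d))) :*
          (con 0ℚ :+ (:- (b :* d))) := a :* a :- con (# 2) :* (a :* b) :* c :+ b :* b :* (c :* c :+ d :* d))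
          refl p q (cos φ) (sin φ) ⟩
      p * p - 2# * (p * q) * cos φ + q * q * (cos φ * cos φ + sin φ * sin φ)
        ≈⟨ +-cong refl (*-cong refl (cos²+sin² φ)) ⟩
      p * p - 2# * (p * q) * cos φ + q * q * 1#
        ≈⟨ solve 3 (λ a b c → a :* a :- con (# 2) :* (a :* b) :* c :+ b :* b :* con 1ℚ := a :* a :+ b :* b
          :- con (# 2) :* (a :* b) :* c) refl p q (cos φ) ⟩
      p * p + q * q - 2# * (p * q) * cos φ ∎
      where open ≈-Reasoning

    norm²-polar-difference : ∀ q φ ψ → norm² (polar q φ -ᶜ polar q ψ) ≈ 2# * (q * q) * (1# - cos (φ - ψ))
    norm²-polar-difference q φ ψ = begin
      (q * cos φ + - (q * cos ψ)) * (q * cos φ + - (q * cos ψ)) + (q * sin φ + - (q * sin ψ)) *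
        (q * sin φ + - (q * sin ψ))
        ≈⟨ solve 5 (λ a b c d e → (a :* b :+ (:- (a :* c))) :* (a :* b :+ (:- (a :* c))) :+
          (a :* d :+ (:- (a :* e))) :* (a :* d :+ (:- (a :* e))) := a :* a :*
          (b :* b :+ d :* d :+ (c :* c :+ e :* e) :- con (# 2) :* (b :* c :- d :* (:- e)))) refl q (cos φ)
          (cos ψ) (sin φ) (sin ψ) ⟩
      q * q * ((cos φ * cos φ + sin φ * sin φ) + (cos ψ * cos ψ + sin ψ * sin ψ) - 2# *
        (cos φ * cos ψ - sin φ * - sin ψ))
        ≈⟨ *-cong refl (-‿-cong (+-cong (cos²+sin² φ) (cos²+sin² ψ))
             (*-cong refl (-‿-cong (*-cong refl (sym (cos-neg ψ))) (*-cong refl (sym (sin-neg ψ)))))) ⟩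
      q * q * (1# + 1# - 2# * (cos φ * cos (- ψ) - sin φ * sin (- ψ)))
        ≈⟨ *-cong refl (-‿-cong refl (*-cong refl (sym (cos-+ φ (- ψ))))) ⟩
      q * q * (1# + 1# - 2# * cos (φ - ψ))
        ≈⟨ solve 2 (λ a b → a :* a :* (con 1ℚ :+ con 1ℚ :- con (# 2) :* b) := con (# 2) :* (a :* a) :*
          (con 1ℚ :- b)) refl q (cos (φ - ψ)) ⟩
      2# * (q * q) * (1# - cos (φ - ψ)) ∎
      where open ≈-Reasoning

    real-↑ᶜ : ∀ p n → (p +i 0#) ↑ᶜ n ≈ᶜ (p ↑ n) +i 0#
    real-↑ᶜ p zero    = reflᶜ
    real-↑ᶜ p (suc n) = transᶜ (*ᶜ-cong reflᶜ (real-↑ᶜ p n))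
      ((solve 2 (λ a b → a :* b :- con 0ℚ :* con 0ℚ := b :* a) refl p (p ↑ n)) ,
        (solve 2 (λ a b → a :* con 0ℚ :+ con 0ℚ :* b := con 0ℚ) refl p (p ↑ n)))

  polar-cong : ∀ {p q φ ψ} → p ≈ q → φ ≈ ψ → polar p φ ≈ᶜ polar q ψ
  polar-cong e f = *-cong e (cos-cong f) , *-cong e (sin-cong f)

  polar-↑ᶜ : ∀ q φ n → polar q φ ↑ᶜ n ≈ᶜ polar (q ↑ n) (N n * φ)
  polar-↑ᶜ q φ zero    = transᶜ polar-1 (polar-cong refl (solve 1 (λ a → con 0ℚ := con 0ℚ :* a) refl φ))
  polar-↑ᶜ q φ (suc n) = transᶜ (*ᶜ-cong reflᶜ (polar-↑ᶜ q φ n)) (transᶜ (polar-* q (q ↑ n) φ (N n * φ))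
    (polar-cong (*-comm _ _) (trans (solve 2 (λ a b → a :+ b :* a := (con 1ℚ :+ b) :* a) refl φ (N n))
      (*-cong (sym (N-suc n)) refl))))

-- Roots of unity and chord lengths

module Chords where
  open Complex public

  N-+ : ∀ m n → N (m ℕ.+ n) ≈ N m + N n
  N-+ m n = trans (≡⇒≈ (cong ι (#-+ m n))) (ι-+ (# m) (# n))

  N-mono : ∀ {m n} → m ℕ.≤ n → N m ≤ N n
  N-mono m≤n = ι-mono (#-mono m≤n)

  0≤ι : ∀ q {{_ : Q.NonNegative q}} → 0# ≤ ι q
  0≤ι q = ι-mono (ℚP.nonNegative⁻¹ q)

  Pos-1 : Pos 1#
  Pos-1 = pos-ι 0<1

  -- An upper bound `B` of `exp (- x)` and `exp x * exp (- x) = 1` give the lower bound `1 / B`.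
  -- That `exp x` is nonnegative comes from its being the square of `exp (½ x)`.
  exp-pos : ∀ x → Pos (exp x)
  exp-pos x =
    let B , 0<B , w = within-bounded (exp (- x))
        r , 0<r , Br≡1 = reciprocal B 0<B
    in r , 0<r , pos-cancel (pos-ι 0<B) (begin
      ι B * ι r               ≈⟨ trans (sym (ι-* B r)) (≡⇒≈ (cong ι Br≡1)) ⟩
      1#                      ≈⟨ exp-inverse x ⟨
      exp x * exp (- x)       ≲⟨ *-mono 0≤exp (ι-mono (ℚP.<⇒≤ 0<B)) ≤-refl (upper w) ⟩
      exp x * ι B             ≈⟨ *-comm _ _ ⟩
      ι B * exp x             ∎)
    where
    open ≤-Reasoning
    0≤exp : 0# ≤ exp x
    0≤exp = ≤-trans (sq-nonneg (exp (ι ½ * x)))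
      (to (trans (sym (exp-+ (ι ½ * x) (ι ½ * x)))
        (exp-cong (solve 1 (λ a → con ½ :* a :+ con ½ :* a := a) refl x))))

  cos-double : ∀ x → cos (x + x) ≈ 2# * (cos x * cos x) - 1#
  cos-double x = begin
    cos (x + x)                       ≈⟨ cos-+ x x ⟩
    cos x * cos x - sin x * sin x     ≈⟨ solve 2 (λ a b → a :* a :- b :* b := con (# 2) :* (a :* a) :-
      (a :* a :+ b :* b)) refl (cos x) (sin x) ⟩
    2# * (cos x * cos x) - (cos x * cos x + sin x * sin x) ≈⟨ -‿-cong refl (cos²+sin² x) ⟩
    2# * (cos x * cos x) - 1#         ∎
    where open ≈-Reasoning

  -- With x = u / 8 the Taylor estimates at x apply, and three duplications give
  -- 1 - cos 8x = 32 (1 - c) (1 + c) c² (2c² - 1)² for c = cos x.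
  cos-gap : ∀ u → 0# ≤ u → u ≤ ι (+ 17 Q./ 5) → ι (+ 1 Q./ 512) * (u * u) ≤ 1# - cos u
  cos-gap u 0≤u u≤ = begin
    -- Here `c ≥ 1 - x² ≥ 4/5`, so `c²` and `e = 2 c² - 1 ≥ 7/25` both exceed ¼, while
    -- `1 - c ≥ x²/4` and `x² = u²/64`. The constant is `32 · ¼ · ¼ · ¼² / 64 = 1/512`.
    ι (+ 1 Q./ 512) * (u * u)
      ≈⟨ solve 1 (λ a → con (+ 1 Q./ 512) :* (a :* a) := con (# 32) :*
        (con (+ 1 Q./ 4) :* (con (+ 1 Q./ 8) :* a :* (con (+ 1 Q./ 8) :* a)) :*
        (con 1ℚ :* (con (+ 1 Q./ 4) :* (con (+ 1 Q./ 4) :* con (+ 1 Q./ 4)))))) refl u ⟩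
    ι (# 32) * (¼ * (x * x) * (1# * (¼ * (¼ * ¼))))
      ≲⟨ *-mono (0≤ι (# 32)) (0≤1-c nn* (0≤1+c nn* (sq-nonneg c nn* sq-nonneg e))) ≤-refl
           (*-mono (0≤¼ nn* sq-nonneg x) (0≤1+c nn* (sq-nonneg c nn* sq-nonneg e)) 1-c≥
             (*-mono 0≤1# (sq-nonneg c nn* sq-nonneg e) 1+c≥
               (*-mono 0≤¼ (sq-nonneg e) c²≥ (*-mono 0≤¼ 0≤e e≥ e≥)))) ⟩
    ι (# 32) * ((1# - c) * ((1# + c) * (c * c * (e * e))))
      ≈⟨ solve 1 (λ a → con (# 32) :* ((con 1ℚ :- a) :*
        ((con 1ℚ :+ a) :* (a :* a :* ((con (# 2) :* (a :* a) :- con 1ℚ) :* (con (# 2) :* (a :* a) :- con 1ℚ)))))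
        := con 1ℚ :- (con (# 2) :* ((con (# 2) :*
        ((con (# 2) :* (a :* a) :- con 1ℚ) :* (con (# 2) :* (a :* a) :- con 1ℚ)) :- con 1ℚ) :*
        (con (# 2) :* ((con (# 2) :* (a :* a) :- con 1ℚ) :* (con (# 2) :* (a :* a) :- con 1ℚ)) :- con 1ℚ))
        :- con 1ℚ)) refl c ⟩
    1# - (2# * ((2# * (e * e) - 1#) * (2# * (e * e) - 1#)) - 1#)
      ≈⟨ -‿-cong refl cos-u ⟨
    1# - cos u ∎
    where
    open ≤-Reasoning
    x c e ¼ : R
    x = ι (+ 1 Q./ 8) * u
    c = cos x
    e = 2# * (c * c) - 1#
    ¼ = ι (+ 1 Q./ 4)
    0≤¼ : 0# ≤ ¼
    0≤¼ = 0≤ι (+ 1 Q./ 4)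
    0≤x : 0# ≤ x
    0≤x = 0≤ι (+ 1 Q./ 8) nn* 0≤u
    x≤ : x ≤ ι (+ 17 Q./ 40)
    x≤ = by (0≤ι (+ 1 Q./ 8) nn* nn u≤) (solve 1 (λ a → con (+ 17 Q./ 40) :- con (+ 1 Q./ 8) :* a := con
      (+ 1 Q./ 8) :* (con (+ 17 Q./ 5) :- a)) refl u)
    x²≤ : x * x ≤ ι (+ 1 Q./ 5)
    x²≤ = by (0≤ι (+ 31 Q./ 1600) nn+ nn x≤ nn* (0≤x nn+ 0≤ι (+ 17 Q./ 40)))
      (solve 1 (λ a → con (+ 1 Q./ 5) :- a :* a := con (+ 31 Q./ 1600) :+ (con (+ 17 Q./ 40) :- a) :*
        (a :+ con (+ 17 Q./ 40))) refl x)
    w : x within 1#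
    w = within-≤ 0≤x (≤-trans x≤ (by (0≤ι (+ 23 Q./ 40))
      (solve 0 (con 1ℚ :- con (+ 17 Q./ 40) := con (+ 23 Q./ 40)) refl)))
    c≥ : ι (+ 4 Q./ 5) ≤ c
    c≥ = by (nn (lower (cos-taylor₂ x w)) nn+ nn x²≤)
      (solve 2 (λ a b → a :- con (+ 4 Q./ 5) := a :- con 1ℚ :- (:- (b :* b)) :+ (con (+ 1 Q./ 5) :- b :* b))
        refl c x)
    1-c≥ : ¼ * (x * x) ≤ 1# - c
    1-c≥ = by (nn (upper (cos-taylor₄ x w)) nn+ sq-nonneg x nn* (nn x²≤ nn+ 0≤ι (+ 1 Q./ 20)))
      (solve 2 (λ a b → con 1ℚ :- a :- con (+ 1 Q./ 4) :* (b :* b) := b :* b :* (b :* b) :-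
        (a :- (con 1ℚ :- con ½ :* (b :* b))) :+ b :* b :* (con (+ 1 Q./ 5) :- b :* b :+ con (+ 1 Q./ 20)))
        refl c x)
    0≤1-c : 0# ≤ 1# - c
    0≤1-c = ≤-trans (0≤¼ nn* sq-nonneg x) 1-c≥
    0≤c : 0# ≤ c
    0≤c = ≤-trans (0≤ι (+ 4 Q./ 5)) c≥
    1+c≥ : 1# ≤ 1# + c
    1+c≥ = by 0≤c (solve 1 (λ a → con 1ℚ :+ a :- con 1ℚ := a) refl c)
    0≤1+c : 0# ≤ 1# + c
    0≤1+c = 0≤1# nn+ 0≤c
    c²≥ : ¼ ≤ c * c
    c²≥ = by (nn c≥ nn* (0≤c nn+ 0≤ι (+ 4 Q./ 5)) nn+ 0≤ι (+ 39 Q./ 100))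
      (solve 1 (λ a → a :* a :- con (+ 1 Q./ 4) := (a :- con (+ 4 Q./ 5)) :* (a :+ con (+ 4 Q./ 5)) :+ con
        (+ 39 Q./ 100)) refl c)
    e≥ : ¼ ≤ e
    e≥ = by (0≤ι (# 2) nn* (nn c≥ nn* (0≤c nn+ 0≤ι (+ 4 Q./ 5))) nn+ 0≤ι (+ 3 Q./ 100))
      (solve 1 (λ a → con (# 2) :* (a :* a) :- con 1ℚ :- con (+ 1 Q./ 4) := con (# 2) :*
        ((a :- con (+ 4 Q./ 5)) :* (a :+ con (+ 4 Q./ 5))) :+ con (+ 3 Q./ 100)) refl c)
    0≤e : 0# ≤ e
    0≤e = ≤-trans 0≤¼ e≥
    double : ∀ {y v} → cos y ≈ v → cos (y + y) ≈ 2# * (v * v) - 1#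
    double {y} h = trans (cos-double y) (-‿-cong (*-cong refl (*-cong h h)) refl)
    cos-u : cos u ≈ 2# * ((2# * (e * e) - 1#) * (2# * (e * e) - 1#)) - 1#
    cos-u = trans (cos-cong (solve 1 (λ a → a := con (+ 1 Q./ 8) :* a :+ con (+ 1 Q./ 8) :* a :+
      (con (+ 1 Q./ 8) :* a :+ con (+ 1 Q./ 8) :* a) :+ (con (+ 1 Q./ 8) :* a :+ con (+ 1 Q./ 8) :* a :+
      (con (+ 1 Q./ 8) :* a :+ con (+ 1 Q./ 8) :* a))) refl u))
      (double (double (double refl)))

  Pos-π : Pos π
  Pos-π = pos-mono 2≤π (pos-ι (ℚP.positive⁻¹ (# 2)))

  Pos-2π : Pos 2π
  Pos-2π = pos-* (pos-ι (ℚP.positive⁻¹ (# 2))) Pos-π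

  module Angles (m : ℕ) where
    τ : R
    τ = ι (inv m) * 2π

    N*τ : N (suc m) * τ ≈ 2π
    N*τ = begin
      N (suc m) * (ι (inv m) * 2π) ≈⟨ solve 4 (λ a b c d → a :* (b :* (c :* d)) := b :* a :* (c :* d)) refl
        (N (suc m)) (ι (inv m)) 2# π ⟩
      ι (inv m) * N (suc m) * 2π   ≈⟨ *-cong (inv*N m) refl ⟩
      1# * 2π                      ≈⟨ *-identityˡ 2π ⟩
      2π                           ∎
      where open ≈-Reasoning

    Pos-τ : Pos τ
    Pos-τ = pos-* (pos-ι (0<inv m)) Pos-2π

    half-turn : ∀ d → d ℕ.+ d ℕ.≤ suc m → N d * τ ≤ π
    half-turn d 2d≤n = by (½-nn nn* (nn (N-mono 2d≤n) nn* pos⇒nn Pos-τ)) (begin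
      π - N d * τ
        ≈⟨ solve 3 (λ a b c → a :- b :* c := con ½ :* (con (# 2) :* a :- (b :+ b) :* c)) refl π (N d) τ ⟩
      ι ½ * (2π - (N d + N d) * τ)
        ≈⟨ *-cong refl (-‿-cong N*τ (*-cong (N-+ d d) refl)) ⟨
      ι ½ * (N (suc m) * τ - N (d ℕ.+ d) * τ)
        ≈⟨ solve 3 (λ a b c → con ½ :* (a :* b :- c :* b) := con ½ :* ((a :- c) :* b)) refl (N (suc m)) τ
          (N (d ℕ.+ d)) ⟩
      ι ½ * ((N (suc m) - N (d ℕ.+ d)) * τ) ∎)
      where open ≈-Reasoning

    gap : ∀ d → d ℕ.+ d ℕ.≤ suc m → ι (+ 1 Q./ 512) * ((N d * τ) * (N d * τ)) ≤ 1# - cos (N d * τ)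
    gap d 2d≤n = cos-gap (N d * τ) (0≤N d nn* pos⇒nn Pos-τ) (≤-trans (half-turn d 2d≤n) π≤17/5)

    private
      Pos-N : ∀ d → 0 ℕ.< d → Pos (N d)
      Pos-N (suc d) _ = pos-mono (N-mono {1} {suc d} (ℕ.s≤s ℕ.z≤n)) Pos-1

      near : ∀ d → 0 ℕ.< d → d ℕ.+ d ℕ.≤ suc m → Pos (1# - cos (N d * τ))
      near d 0<d 2d≤n = pos-mono (gap d 2d≤n)
        (pos-* (pos-ι (ℚP.positive⁻¹ (+ 1 Q./ 512))) (pos-* p p))
        where
        p : Pos (N d * τ)
        p = pos-* (Pos-N d 0<d) Pos-τ

    -- Makes the roots in `chord-product` cancellable. `gap` covers at most a half turn; a larger
    -- angle is reflected to the complementary index.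
    apart : ∀ d → 0 ℕ.< d → d ℕ.< suc m → Pos (1# - cos (N d * τ))
    apart d 0<d d<n with ℕP.≤-total (d ℕ.+ d) (suc m)
    ... | inj₁ 2d≤n = near d 0<d 2d≤n
    ... | inj₂ n≤2d = pos-mono (to (-‿-cong refl (sym reflect))) (near d′ (ℕP.m<n⇒0<n∸m d<n) 2d′≤n)
      where
      open ≈-Reasoning
      d′ : ℕ
      d′ = suc m ℕ.∸ d
      d′+d : d′ ℕ.+ d ≡ suc m
      d′+d = ℕP.m∸n+n≡m (ℕP.<⇒≤ d<n)
      2d′≤n : d′ ℕ.+ d′ ℕ.≤ suc m
      2d′≤n = ℕP.≤-trans (ℕP.+-monoʳ-≤ d′ (ℕP.m≤n+o⇒m∸n≤o (suc m) d n≤2d)) (ℕP.≤-reflexive d′+d)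
      reflect : cos (N d * τ) ≈ cos (N d′ * τ)
      reflect = begin
        cos (N d * τ)                  ≈⟨ cos-cong (begin
          N d * τ                              ≈⟨ solve 3 (λ a b c → a :* b := (:- (c :* b)) :+ (c :+ a) :* b)
            refl (N d) τ (N d′) ⟩
          - (N d′ * τ) + (N d′ + N d) * τ
            ≈⟨ +-cong refl (*-cong (trans (sym (N-+ d′ d)) (≡⇒≈ (cong N d′+d))) refl) ⟩
          - (N d′ * τ) + N (suc m) * τ         ≈⟨ +-cong refl N*τ ⟩
          - (N d′ * τ) + 2π                    ∎) ⟩
        cos (- (N d′ * τ) + 2π)        ≈⟨ cos-period _ ⟩
        cos (- (N d′ * τ))             ≈⟨ cos-neg _ ⟩
        cos (N d′ * τ)                 ∎

    -- Cotes' theorem: the squared modulus of `pⁿ - qⁿ e^(inA)`, factored over the points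
    -- `q e^(i(A + lτ))`.
    chord-product : ∀ p q A → Pos q →
      ∏ (suc m) (λ l → p * p + q * q - 2# * (p * q) * cos (A + N l * τ))
      ≈ p ↑ suc m * p ↑ suc m + q ↑ suc m * q ↑ suc m - 2# * (p ↑ suc m * q ↑ suc m) * cos (N (suc m) * A)
    chord-product p q A Pos-q = begin
      ∏ n (λ l → p * p + q * q - 2# * (p * q) * cos (A + N l * τ))
        ≈⟨ ∏-cong n (λ l _ → norm²-real-polar p q (A + N l * τ)) ⟨
      ∏ n (λ l → norm² ((p +i 0#) -ᶜ r l))
        ≈⟨ norm²-∏ n (λ l → (p +i 0#) -ᶜ r l) ⟨
      norm² (∏ᶜ n (λ l → (p +i 0#) -ᶜ r l))
        ≈⟨ norm²-cong (power-difference m (polar (q ↑ n) (N n * A)) r root regular (p +i 0#)) ⟨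
      norm² ((p +i 0#) ↑ᶜ n -ᶜ polar (q ↑ n) (N n * A))
        ≈⟨ norm²-cong (+ᶜ-cong (real-↑ᶜ p n) reflᶜ) ⟩
      norm² (((p ↑ n) +i 0#) -ᶜ polar (q ↑ n) (N n * A))
        ≈⟨ norm²-real-polar (p ↑ n) (q ↑ n) (N n * A) ⟩
      p ↑ n * p ↑ n + q ↑ n * q ↑ n - 2# * (p ↑ n * q ↑ n) * cos (N n * A) ∎
      where
      open ≈-Reasoning
      n : ℕ
      n = suc m
      r : ℕ → ℂ
      r l = polar q (A + N l * τ)
      root : ∀ i → i ℕ.< n → r i ↑ᶜ n ≈ᶜ polar (q ↑ n) (N n * A)
      root i _ = transᶜ (polar-↑ᶜ q (A + N i * τ) n)
        (*-cong refl (trans (cos-cong turn) (proj₁ (period-multiple (N n * A) i))) ,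
         *-cong refl (trans (sin-cong turn) (proj₂ (period-multiple (N n * A) i))))
        where
        turn : N n * (A + N i * τ) ≈ N n * A + N i * 2π
        turn = trans (solve 4 (λ a b c d → a :* (b :+ c :* d) := a :* b :+ c :* (a :* d)) refl (N n) A (N i) τ)
          (+-cong refl (*-cong refl N*τ))
      regular : ∀ i j → i ℕ.< j → j ℕ.< n → Regular (r j -ᶜ r i)
      regular i j i<j j<n = norm²-regular (pos-mono (from difference)
          (pos-* (pos-* (pos-ι (ℚP.positive⁻¹ (# 2))) (pos-* Pos-q Pos-q))
                 (apart (j ℕ.∸ i) (ℕP.m<n⇒0<n∸m i<j) (ℕP.≤-<-trans (ℕP.m∸n≤m j i) j<n))))
        where
        difference : norm² (r j -ᶜ r i) ≈ 2# * (q * q) * (1# - cos (N (j ℕ.∸ i) * τ))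
        difference = trans (norm²-polar-difference q (A + N j * τ) (A + N i * τ))
          (*-cong refl (-‿-cong refl (cos-cong (begin
            A + N j * τ - (A + N i * τ)
              ≈⟨ -‿-cong (+-cong refl (*-cong (trans (≡⇒≈ (cong N (≡-sym (ℕP.m∸n+n≡m (ℕP.<⇒≤ i<j)))))
                (N-+ (j ℕ.∸ i) i)) refl)) refl ⟩
            A + (N (j ℕ.∸ i) + N i) * τ - (A + N i * τ)
              ≈⟨ solve 4 (λ a b c d → a :+ (b :+ c) :* d :- (a :+ c :* d) := b :* d) refl A (N (j ℕ.∸ i))
                (N i) τ ⟩
            N (j ℕ.∸ i) * τ ∎))))

    exp-↑ : ∀ x n → exp x ↑ n ≈ exp (N n * x)
    exp-↑ x zero    = sym (exp-≈0 (solve 1 (λ a → con 0ℚ :* a := con 0ℚ) refl x))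
    exp-↑ x (suc n) = trans (*-cong (exp-↑ x n) refl) (trans (sym (exp-+ (N n * x) x))
      (exp-cong (trans (solve 2 (λ a b → a :* b :+ b := (con 1ℚ :+ a) :* b) refl (N n) x)
        (*-cong (sym (N-suc n)) refl))))

    -- The radii `exp (½ β)` and `exp (- ½ β)` have product 1 and squares with sum `2 cosh β`, so
    -- every squared chord takes the form `2 (cosh β - cos)`.
    cosh-cos-product : ∀ β A → ∏ (suc m) (λ l → 2# * (cosh β - cos (A + N l * τ)))
                             ≈ 2# * (cosh (N (suc m) * β) - cos (N (suc m) * A))
    cosh-cos-product β A = begin
      ∏ n (λ l → 2# * (cosh β - cos (A + N l * τ)))
        ≈⟨ ∏-cong n (λ l _ → sym (trans (-‿-cong (+-cong (sym (exp-+ b b)) (sym (exp-+ (- b) (- b))))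
          (*-cong (*-cong refl (exp-inverse b)) refl))
             (trans (-‿-cong (+-cong (exp-cong (solve 1 (λ a → con ½ :* a :+ con ½ :* a := a) refl β))
               (exp-cong (solve 1 (λ a → (:- (con ½ :* a)) :+ (:- (con ½ :* a)) := (:- a)) refl β))) refl)
               (solve 3 (λ a b c → a :+ b :- con (# 2) :* con 1ℚ :* c := con (# 2) :* (con ½ :* (a :+ b) :- c))
                 refl (exp β) (exp (- β)) (cos (A + N l * τ)))))) ⟩
      ∏ n (λ l → p * p + q * q - 2# * (p * q) * cos (A + N l * τ))
        ≈⟨ chord-product p q A (exp-pos (- b)) ⟩
      p ↑ n * p ↑ n + q ↑ n * q ↑ n - 2# * (p ↑ n * q ↑ n) * cos (N n * A)
        ≈⟨ -‿-cong (+-cong (power b) (power (- b))) (*-cong (*-cong refl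
             (trans (*-cong (exp-↑ b n) (exp-↑ (- b) n)) (trans (sym (exp-+ (N n * b) (N n * - b)))
               (exp-≈0 (solve 2 (λ a b → a :* b :+ a :* (:- b) := con 0ℚ) refl (N n) b))))) refl) ⟩
      exp (N n * (b + b)) + exp (N n * (- b + - b)) - 2# * 1# * cos (N n * A)
        ≈⟨ -‿-cong (+-cong (exp-cong (solve 2 (λ a b → a :* (con ½ :* b :+ con ½ :* b) := a :* b) refl (N n) β))
          (exp-cong (solve 2 (λ a b → a :* ((:- (con ½ :* b)) :+ (:- (con ½ :* b))) := (:- (a :* b))) refl
          (N n) β))) refl ⟩
      exp (N n * β) + exp (- (N n * β)) - 2# * 1# * cos (N n * A)
        ≈⟨ solve 3 (λ a b c → a :+ b :- con (# 2) :* con 1ℚ :* c := con (# 2) :* (con ½ :* (a :+ b) :- c)) refl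
          (exp (N n * β)) (exp (- (N n * β))) (cos (N n * A)) ⟩
      2# * (cosh (N n * β) - cos (N n * A)) ∎
      where
      open ≈-Reasoning
      n : ℕ
      n = suc m
      b p q : R
      b = ι ½ * β
      p = exp b
      q = exp (- b)
      power : ∀ x → exp x ↑ n * exp x ↑ n ≈ exp (N n * (x + x))
      power x = trans (*-cong (exp-↑ x n) (exp-↑ x n)) (trans (sym (exp-+ (N n * x) (N n * x)))
        (exp-cong (solve 2 (λ a b → a :* b :+ a :* b := a :* (b :+ b)) refl (N n) x)))

-- The finite product for `F` and its paired factors

module FiniteProducts where
  open Chords public

  ∏-last : ∀ n f → ∏ (suc n) f ≈ ∏ n f * f n
  ∏-last zero    f = *-comm _ _
  ∏-last (suc n) f = trans (*-cong refl (∏-last n (f ∘ suc))) (sym (*-assoc _ _ _))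

  ∏-* : ∀ n f g → ∏ n (λ i → f i * g i) ≈ ∏ n f * ∏ n g
  ∏-* zero    f g = solve 0 (con 1ℚ := con 1ℚ :* con 1ℚ) refl
  ∏-* (suc n) f g = trans (*-cong refl (∏-* n (f ∘ suc) (g ∘ suc)))
    (solve 4 (λ a b c d → a :* b :* (c :* d) := a :* c :* (b :* d)) refl (f 0) (g 0) (∏ n (f ∘ suc))
      (∏ n (g ∘ suc)))

  ∏-split : ∀ m n f → ∏ (m ℕ.+ n) f ≈ ∏ m f * ∏ n (λ i → f (m ℕ.+ i))
  ∏-split zero    n f = sym (*-identityˡ _)
  ∏-split (suc m) n f = trans (*-cong refl (∏-split m n (f ∘ suc))) (sym (*-assoc _ _ _))

  ∏-nonneg : ∀ n f → (∀ i → 0# ≤ f i) → 0# ≤ ∏ n f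
  ∏-nonneg zero    f p = 0≤1#
  ∏-nonneg (suc n) f p = p 0 nn* ∏-nonneg n (f ∘ suc) (p ∘ suc)

  ∏-pos : ∀ n f → (∀ i → i ℕ.< n → Pos (f i)) → Pos (∏ n f)
  ∏-pos zero    f p = Pos-1
  ∏-pos (suc n) f p = pos-* (p 0 (ℕ.s≤s ℕ.z≤n)) (∏-pos n (f ∘ suc) λ i i<n → p (suc i) (ℕ.s≤s i<n))

  ∏-mono : ∀ n f g → (∀ i → i ℕ.< n → 0# ≤ f i × f i ≤ g i) → 0# ≤ ∏ n f × ∏ n f ≤ ∏ n g
  ∏-mono zero    f g p = 0≤1# , ≤-refl
  ∏-mono (suc n) f g p =
    let 0≤f , f≤g = p 0 (ℕ.s≤s ℕ.z≤n)
        0≤∏ , le = ∏-mono n (f ∘ suc) (g ∘ suc) λ i i<n → p (suc i) (ℕ.s≤s i<n)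
    in 0≤f nn* 0≤∏ , *-mono 0≤f (≤-trans 0≤∏ le) f≤g le

  lim-∏ : ∀ n (f : ℕ → ℕ → R) g → (∀ i → Lim (λ m → f m i) (g i)) → Lim (λ m → ∏ n (f m)) (∏ n g)
  lim-∏ zero    f g p = lim-const 1#
  lim-∏ (suc n) f g p = lim-* (p 0) (lim-∏ n (λ m → f m ∘ suc) (g ∘ suc) (p ∘ suc))

  -- Pairs the positions equidistant from the middle one, which remains alone because the number of
  -- factors is odd.
  ∏-symmetric : ∀ m f → ∏ (suc (m ℕ.+ m)) f ≈ f m * ∏ m (λ k → f (m ℕ.+ suc k) * f (m ℕ.∸ suc k))
  ∏-symmetric zero    f = refl
  ∏-symmetric (suc m) f = begin
    f 0 * ∏ (suc (m ℕ.+ suc m)) (f ∘ suc)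
      ≈⟨ *-cong refl (≡⇒≈ (cong (λ z → ∏ (suc z) (f ∘ suc)) (ℕP.+-suc m m))) ⟩
    f 0 * ∏ (suc (suc (m ℕ.+ m))) (f ∘ suc)
      ≈⟨ *-cong refl (∏-last (suc (m ℕ.+ m)) (f ∘ suc)) ⟩
    f 0 * (∏ (suc (m ℕ.+ m)) (f ∘ suc) * last)
      ≈⟨ *-cong refl (*-cong (∏-symmetric m (f ∘ suc)) refl) ⟩
    f 0 * (f (suc m) * inner * last)
      ≈⟨ solve 4 (λ a b c d → a :* (b :* c :* d) := b :* (c :* (d :* a))) refl (f 0) (f (suc m)) inner last ⟩
    f (suc m) * (inner * (last * f 0))
      ≈⟨ *-cong refl (*-cong (∏-cong m λ k k<m → *-cong refl (≡⇒≈ (cong f (≡-sym (ℕP.+-∸-assoc 1 k<m)))))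
           (*-cong (≡⇒≈ (cong f (cong suc (≡-sym (ℕP.+-suc m m))))) (≡⇒≈ (cong f (≡-sym (ℕP.n∸n≡0 m)))))) ⟩
    f (suc m) * (∏ m g * g m)
      ≈⟨ *-cong refl (∏-last m g) ⟨
    f (suc m) * ∏ (suc m) g ∎
    where
    open ≈-Reasoning
    g : ℕ → R
    g k = f (suc m ℕ.+ suc k) * f (suc m ℕ.∸ suc k)
    inner last : R
    inner = ∏ m (λ k → f (suc (m ℕ.+ suc k)) * f (suc (m ℕ.∸ suc k)))
    last = f (suc (suc (m ℕ.+ m)))

  1≤cosh : ∀ x → 1# ≤ cosh x
  1≤cosh x = by (½-nn nn* sq-nonneg (exp b - exp (- b))) (begin
    ι ½ * (exp x + exp (- x)) - 1#
      ≈⟨ -‿-cong (*-cong refl (+-cong (trans (exp-cong (solve 1 (λ a → a := con ½ :* a :+ con ½ :* a) refl x))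
        (exp-+ b b))
           (trans (exp-cong (solve 1 (λ a → (:- a) := (:- (con ½ :* a)) :+ (:- (con ½ :* a))) refl x))
             (exp-+ (- b) (- b))))) (sym (exp-inverse b)) ⟩
    ι ½ * (exp b * exp b + exp (- b) * exp (- b)) - exp b * exp (- b)
      ≈⟨ solve 2 (λ a b → con ½ :* (a :* a :+ b :* b) :- a :* b := con ½ :* ((a :- b) :* (a :- b))) refl (exp b)
        (exp (- b)) ⟩
    ι ½ * ((exp b - exp (- b)) * (exp b - exp (- b))) ∎)
    where
    open ≈-Reasoning
    b : R
    b = ι ½ * x

  0≤cosh-cos : ∀ x y → 0# ≤ cosh x - cos y
  0≤cosh-cos x y = nn (≤-trans (upper (cos-within y)) (1≤cosh x))

  -- F α β = 2 |sin (ζ / 2)|² for ζ = α + iβ.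
  F : R → R → R
  F α β = cosh β - cos α

  -- F-product is the squared modulus of sin ζ = 2^(M-1) ∏ sin ((ζ + πl) / M), M = 2m + 1,
  -- with the factors at ± l paired.
  module Finite (m : ℕ) where
    open Angles (m ℕ.+ m) public
    h : R
    h = ι (inv (m ℕ.+ m))

    γ : R → R → R
    γ α β = cosh (β * h) - cos (α * h)

    pair : R → R → ℕ → R
    pair α β k = ι (# 4) * ((cosh (β * h) - cos (α * h + N k * τ)) * (cosh (β * h) - cos (α * h - N k * τ)))

    0≤γ : ∀ α β → 0# ≤ γ α β
    0≤γ α β = 0≤cosh-cos (β * h) (α * h)

    0≤pair : ∀ α β k → 0# ≤ pair α β k
    0≤pair α β k = 0≤ι (# 4) nn* (0≤cosh-cos _ _ nn* 0≤cosh-cos _ _)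

    N*h : N (suc (m ℕ.+ m)) * h ≈ 1#
    N*h = trans (*-comm _ _) (inv*N (m ℕ.+ m))

    F-product : ∀ α β → F α β ≈ γ α β * ∏ m (λ k → pair α β (suc k))
    F-product α β = pos-cancel-≈ (pos-ι (ℚP.positive⁻¹ (# 2))) (begin
      2# * (cosh β - cos α)
        ≈⟨ *-cong refl (-‿-cong (cosh-cong b≈) cos-a) ⟨
      2# * (cosh (N n * (β * h)) - cos (N n * A))
        ≈⟨ cosh-cos-product (β * h) A ⟨
      ∏ n f
        ≈⟨ ∏-symmetric m f ⟩
      f m * ∏ m (λ k → f (m ℕ.+ suc k) * f (m ℕ.∸ suc k))
        ≈⟨ *-cong (*-cong refl (-‿-cong refl (cos-cong
          (solve 4 (λ a b c d → a :* b :- c :* d :+ c :* d := a :* b) refl α h (N m) τ)))) (∏-cong m pairs) ⟩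
      2# * γ α β * ∏ m (λ k → pair α β (suc k))
        ≈⟨ *-assoc _ _ _ ⟩
      2# * (γ α β * ∏ m (λ k → pair α β (suc k))) ∎)
      where
      open ≈-Reasoning
      n : ℕ
      n = suc (m ℕ.+ m)
      A : R
      -- Turned back by `m` steps, so that the middle position `m` carries the unrotated angle
      -- `α * h`.
      A = α * h - N m * τ
      f : ℕ → R
      f l = 2# * (cosh (β * h) - cos (A + N l * τ))
      b≈ : N n * (β * h) ≈ β
      b≈ = trans (solve 3 (λ a b c → a :* (b :* c) := b :* (a :* c)) refl (N n) β h)
        (trans (*-cong refl N*h) (solve 1 (λ a → a :* con 1ℚ := a) refl β))
      cos-a : cos (N n * A) ≈ cos α
      cos-a = begin
        cos (N n * (α * h - N m * τ))
          ≈⟨ cos-cong (solve 5 (λ a b c d e → a :* (b :* c :- d :* e) := b :* (a :* c) :- d :* (a :* e)) refl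
          (N n) α h (N m) τ) ⟩
        cos (α * (N n * h) - N m * (N n * τ))  ≈⟨ cos-cong (-‿-cong (*-cong refl N*h) (*-cong refl N*τ)) ⟩
        cos (α * 1# - N m * 2π)                ≈⟨ proj₁ (period-multiple (α * 1# - N m * 2π) m) ⟨
        cos (α * 1# - N m * 2π + N m * 2π)
          ≈⟨ cos-cong (solve 4 (λ a b c d → a :* con 1ℚ :- b :* (c :* d) :+ b :* (c :* d) := a) refl α
          (N m) 2# π) ⟩
        cos α                                  ∎
      pairs : ∀ k → k ℕ.< m → f (m ℕ.+ suc k) * f (m ℕ.∸ suc k) ≈ pair α β (suc k)
      pairs k k<m = begin
        f (m ℕ.+ suc k) * f (m ℕ.∸ suc k)
          ≈⟨ *-cong (*-cong refl (-‿-cong refl (cos-cong (trans (+-cong refl (*-cong (N-+ m (suc k)) refl))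
                 (solve 5 (λ a b c d e → a :* b :- c :* d :+ (c :+ e) :* d := a :* b :+ e :* d) refl α h (N m) τ
                   (N (suc k)))))))
               (*-cong refl (-‿-cong refl (cos-cong
                 (trans (+-cong (-‿-cong refl (*-cong (trans (≡⇒≈ (cong N (≡-sym (ℕP.m∸n+n≡m k<m))))
                 (N-+ (m ℕ.∸ suc k) (suc k))) refl)) refl)
                 (solve 5 (λ a b c d e → a :* b :- (c :+ d) :* e :+ c :* e := a :* b :- d :* e) refl α h
                   (N (m ℕ.∸ suc k)) (N (suc k)) τ))))) ⟩
        2# * x * (2# * y)      ≈⟨ solve 2 (λ a b → con (# 2) :* a :* (con (# 2) :* b) := con (# 4) :* (a :* b))
          refl x y ⟩
        ι (# 4) * (x * y)      ∎
        where
        x y : R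
        x = cosh (β * h) - cos (α * h + N (suc k) * τ)
        y = cosh (β * h) - cos (α * h - N (suc k) * τ)

    -- With q = 1 - cos kτ the pair is (2q)² + 2 (2a) (2q) + (2γ)².
    q : ℕ → R
    q k = 1# - cos (N k * τ)

    a : R → R → R
    a α β = cosh (β * h) * cos (α * h) - 1#

    -- The sine parts of `cos (A + B)` and `cos (A - B)` differ only in sign, so the product
    -- contains only squares of sines, which are polynomials in cosines. The arguments `α` and `β`
    -- survive only in `a` and `γ`, both of order `h²`.
    pair-quadratic : ∀ α β k → pair α β k ≈ ι (# 4) * (q k * q k + 2# * (a α β * q k) + γ α β * γ α β)
    pair-quadratic α β k = *-cong refl (begin
      (C - cos (A + B)) * (C - cos (A - B))
        ≈⟨ *-cong (-‿-cong refl (cos-+ A B)) (-‿-cong refl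
          (trans (cos-+ A (- B)) (-‿-cong (*-cong refl (cos-neg B)) (*-cong refl (sin-neg B))))) ⟩
      (C - (c * ϰ - s * σ)) * (C - (c * ϰ - s * - σ))
        ≈⟨ solve 5 (λ a b c d e → (a :- (b :* c :- d :* e)) :* (a :- (b :* c :- d :* (:- e))) :=
          (a :- b :* c) :* (a :- b :* c) :- (b :* b :+ d :* d :- b :* b) :* (c :* c :+ e :* e :- c :* c))
          refl C c ϰ s σ ⟩
      (C - c * ϰ) * (C - c * ϰ) - ((c * c + s * s) - c * c) * ((ϰ * ϰ + σ * σ) - ϰ * ϰ)
        ≈⟨ -‿-cong refl (*-cong (-‿-cong (cos²+sin² A) refl) (-‿-cong (cos²+sin² B) refl)) ⟩
      (C - c * ϰ) * (C - c * ϰ) - (1# - c * c) * (1# - ϰ * ϰ)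
        ≈⟨ solve 3 (λ a b c → (a :- b :* c) :* (a :- b :* c) :- (con 1ℚ :- b :* b) :* (con 1ℚ :- c :* c) :=
          (con 1ℚ :- c) :* (con 1ℚ :- c) :+ con (# 2) :* ((a :* b :- con 1ℚ) :* (con 1ℚ :- c)) :+ (a :- b) :*
          (a :- b)) refl C c ϰ ⟩
      (1# - ϰ) * (1# - ϰ) + 2# * ((C * c - 1#) * (1# - ϰ)) + (C - c) * (C - c) ∎)
      where
      open ≈-Reasoning
      A B C c s ϰ σ : R
      A = α * h
      B = N k * τ
      C = cosh (β * h)
      c = cos A
      s = sin A
      ϰ = cos B
      σ = sin B

    -- 147 = 3 · 7², where 7 bounds |α| and |β|.
    s₀ : R
    s₀ = ι (# 147) * (h * h)

    0≤h : 0# ≤ h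
    0≤h = 0≤inv (m ℕ.+ m)

    0≤s₀ : 0# ≤ s₀
    0≤s₀ = 0≤ι (# 147) nn* (0≤h nn* 0≤h)

    module _ (7h≤1 : ι (# 7) * h ≤ 1#) {α β : R} (αw : α within ι (# 7)) (βw : β within ι (# 7)) where
      private
        small : ∀ {x} → x within ι (# 7) → x * h within ι (# 7) * h
        small w = within-* w (within-self 0≤h)
        C-1 : cosh (β * h) - 1# within ι (# 49) * (h * h)
        C-1 = within-weaken (≤-trans (sq-within (small βw))
          (to (solve 1 (λ a → con (# 7) :* a :* (con (# 7) :* a) := con (# 49) :* (a :* a)) refl h)))
          (cosh-taylor₂ (β * h) (within-weaken 7h≤1 (small βw)))
        c-1 : cos (α * h) - 1# within ι (# 49) * (h * h)
        c-1 = within-weaken (≤-trans (sq-within (small αw))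
          (to (solve 1 (λ a → con (# 7) :* a :* (con (# 7) :* a) := con (# 49) :* (a :* a)) refl h)))
          (cos-taylor₂ (α * h) (within-weaken 7h≤1 (small αw)))
        C-1′ : cosh (β * h) - 1# within 1#
        C-1′ = within-weaken (≤-trans (sq-within (within-weaken 7h≤1 (small βw)))
          (to (solve 0 (con 1ℚ :* con 1ℚ := con 1ℚ) refl)))
          (cosh-taylor₂ (β * h) (within-weaken 7h≤1 (small βw)))

      -- `C c - 1 = (C - 1) + (c - 1) + (C - 1) (c - 1)`: three terms of size at most `49 h²`,
      -- whence the 3 in 147.
      a-within : a α β within s₀
      a-within = within-weaken (to (solve 1 (λ a → con (# 49) :* (a :* a) :+ con (# 49) :* (a :* a) :+ con 1ℚ :*
        (con (# 49) :* (a :* a)) := con (# 147) :* (a :* a)) refl h))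
        (within-resp (solve 2 (λ a b → a :- con 1ℚ :+ (b :- con 1ℚ) :+ (a :- con 1ℚ) :* (b :- con 1ℚ) := a :* b
          :- con 1ℚ) refl (cosh (β * h)) (cos (α * h)))
          (within-+ (within-+ C-1 c-1) (within-* C-1′ c-1)))

      γ-within : γ α β within s₀
      γ-within = within-weaken (by (0≤ι (# 49) nn* (0≤h nn* 0≤h))
          (solve 1 (λ a → con (# 147) :* (a :* a) :- (con (# 49) :* (a :* a) :+ con (# 49) :* (a :* a)) := con
            (# 49) :* (a :* a)) refl h))
        (within-resp (solve 2 (λ a b → a :- con 1ℚ :+ (:- (b :- con 1ℚ)) := a :- b) refl (cosh (β * h))
          (cos (α * h)))
          (within-+ C-1 (within-neg c-1)))

    -- From `gap` with `τ = 2 π h` and `π ≥ 2`: `(k τ)² ≥ 16 k² h²`, so `q k ≥ k² h² / 32`, and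
    -- `4704 = 147 · 32`.
    q-lower : ∀ k → k ℕ.≤ m → N k * N k * s₀ ≤ ι (# 4704) * q k
    q-lower k k≤m = begin
      N k * N k * (ι (# 147) * (h * h))
        ≈⟨ solve 2 (λ a b → a :* a :* (con (# 147) :* (b :* b)) := con (# 4704) :*
          (con (+ 1 Q./ 512) :* (con (# 16) :* (a :* a :* (b :* b))))) refl (N k) h ⟩
      ι (# 4704) * (ι (+ 1 Q./ 512) * (ι (# 16) * (N k * N k * (h * h))))
        ≲⟨ *-mono (0≤ι (# 4704)) (0≤ι (+ 1 Q./ 512) nn* sq-nonneg (N k * τ)) ≤-refl
             (*-mono (0≤ι (+ 1 Q./ 512)) (sq-nonneg (N k * τ)) ≤-refl step) ⟩
      ι (# 4704) * (ι (+ 1 Q./ 512) * (N k * τ * (N k * τ)))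
        ≲⟨ *-mono (0≤ι (# 4704)) (≤-trans (0≤ι (+ 1 Q./ 512) nn* sq-nonneg (N k * τ)) g) ≤-refl g ⟩
      ι (# 4704) * q k ∎
      where
      open ≤-Reasoning
      g : ι (+ 1 Q./ 512) * (N k * τ * (N k * τ)) ≤ q k
      g = gap k (ℕP.≤-trans (ℕP.+-mono-≤ k≤m k≤m) (ℕP.n≤1+n _))
      step : ι (# 16) * (N k * N k * (h * h)) ≤ N k * τ * (N k * τ)
      step = by ((0≤ι (# 4) nn* (nn 2≤π nn* (nn 2≤π nn+ 0≤ι (# 4)))) nn* (sq-nonneg (N k * h)))
        (solve 3 (λ a b c → a :* (b :* (con (# 2) :* c)) :* (a :* (b :* (con (# 2) :* c))) :- con (# 16) :*
          (a :* a :* (b :* b)) := con (# 4) :* ((c :- con (# 2)) :* (c :- con (# 2) :+ con (# 4))) :*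
          (a :* b :* (a :* b))) refl (N k) h π)

-- Exchanging the argument in the finite product

module Comparison where
  open FiniteProducts public

  -- Ten times the constant of q-lower: then q k dominates s₀ enough for replacing ζ by ζ′
  -- to change the pair at k by a factor of at most 1 + c₀ / k².
  c₀ : ℕ
  c₀ = 47040

  -- Here and in `quadratic-ratio`, `k` stands for the square of an index; the threshold is
  -- `18816 = 4 · 4704`.
  4s≤q : ∀ {k q s} → 0# ≤ s → ι (# 18816) ≤ k → k * s ≤ ι (# 4704) * q → ι (# 4) * s ≤ q
  4s≤q {k} {q} {s} 0≤s k≥ p = by (0≤ι (+ 1 Q./ 4704) nn* (nn p nn+ nn k≥ nn* 0≤s))
    (solve 3 (λ a b c → a :- con (# 4) :* b := con (+ 1 Q./ 4704) :*
      (con (# 4704) :* a :- c :* b :+ (c :- con (# 18816)) :* b)) refl q s k)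

  -- Up to the common factor 4, the exchange costs at most `4 k s q + k s²`, and the additional
  -- weight `c₀` at most `2 c₀ s q`. Half of `c₀ q²` pays for the latter because `q ≥ 4 s`; the
  -- other half is `5 · 4704 q² ≥ 5 k s q` and pays for the former because `q ≥ s`.
  quadratic-ratio : ∀ {k q s a a′ g g′} → 0# ≤ s → a within s → a′ within s → g′ within s →
    ι (# 18816) ≤ k → k * s ≤ ι (# 4704) * q →
    k * (ι (# 4) * (q * q + 2# * (a′ * q) + g′ * g′)) ≤ (k + N c₀) * (ι (# 4) * (q * q + 2# * (a * q) + g * g))
  quadratic-ratio {k} {q} {s} {a} {a′} {g} {g′} 0≤s aw aw′ gw′ k≥ p = by
    (0≤ι (# 4) nn* (0≤k nn* (0≤ι (# 2) nn* (nn (lower aw) nn* 0≤q) nn+ 0≤ι (# 2) nn* (nn (upper aw′) nn* 0≤q)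
      nn+ sq-nonneg g nn+ nn (sq-within gw′))
      nn+ 0≤ι (# 47040) nn* (0≤ι (# 2) nn* (nn (lower aw) nn* 0≤q) nn+ sq-nonneg g)
      nn+ 0≤ι (# 23520) nn* (0≤q nn* nn 4s≤) nn+ 0≤ι (# 5) nn* (0≤q nn* nn p) nn+ 0≤k nn* (0≤s nn* nn s≤q)))
    (solve 7 (λ a b c d e f g → (a :+ con (# 47040)) :*
      (con (# 4) :* (b :* b :+ con (# 2) :* (c :* b) :+ d :* d)) :- a :*
      (con (# 4) :* (b :* b :+ con (# 2) :* (e :* b) :+ f :* f)) := con (# 4) :*
      (a :* (con (# 2) :* ((c :- (:- g)) :* b) :+ con (# 2) :* ((g :- e) :* b) :+ d :* d :+ (g :* g :- f :* f))
      :+ con (# 47040) :* (con (# 2) :* ((c :- (:- g)) :* b) :+ d :* d) :+ con (# 23520) :*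
      (b :* (b :- con (# 4) :* g)) :+ con (# 5) :* (b :* (con (# 4704) :* b :- a :* g)) :+ a :*
      (g :* (b :- g)))) refl k q a g a′ g′ s)
    where
    4s≤ : ι (# 4) * s ≤ q
    4s≤ = 4s≤q 0≤s k≥ p
    s≤q : s ≤ q
    s≤q = ≤-trans (by (0≤ι (# 3) nn* 0≤s) (solve 1 (λ a → con (# 4) :* a :- a := con (# 3) :* a) refl s)) 4s≤
    0≤q : 0# ≤ q
    0≤q = ≤-trans 0≤s s≤q
    0≤k : 0# ≤ k
    0≤k = ≤-trans (0≤ι (# 18816)) k≥

  -- With `a ≥ - s` and `q ≥ 4 s` the mixed term takes away at most half of `4 q²`, so the value
  -- stays above `2 q²`.
  quadratic-pos : ∀ {q s a g} → 0# ≤ s → a within s → ι (# 4) * s ≤ q → Pos q →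
    Pos (ι (# 4) * (q * q + 2# * (a * q) + g * g))
  quadratic-pos {q} {s} {a} {g} 0≤s aw 4s≤ Pq = pos-mono
    (by (0≤ι (# 8) nn* (nn (lower aw) nn* pos⇒nn Pq) nn+ 0≤ι (# 2) nn* (pos⇒nn Pq nn* nn 4s≤) nn+ 0≤ι
      (# 4) nn* sq-nonneg g)
      (solve 4 (λ a b c d → con (# 4) :* (a :* a :+ con (# 2) :* (b :* a) :+ c :* c) :- con (# 2) :* (a :* a)
        := con (# 8) :* ((b :- (:- d)) :* a) :+ con (# 2) :* (a :* (a :- con (# 4) :* d)) :+ con (# 4) :*
        (c :* c)) refl q a g s))
    (pos-* (pos-ι (ℚP.positive⁻¹ (# 2))) (pos-* Pq Pq))

  Pos-N : ∀ d → 0 ℕ.< d → Pos (N d)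
  Pos-N (suc d) _ = pos-mono (N-mono {1} {suc d} (ℕ.s≤s ℕ.z≤n)) Pos-1

  -- ∏ (1 + c/k²) over k > n is at most 1 + 2c/n once n ≥ 2c, because
  -- (1 + c/k²) (1 + 2c/k) ≤ 1 + 2c/(k-1) for k ≥ 2c.
  module Telescope (n c : ℕ) (2c≤n : c ℕ.+ c ℕ.≤ n) (0<n : 0 ℕ.< n) where
    private
      c′ 2c : R
      c′ = N c
      2c = N (c ℕ.+ c)
      sq : ℕ → R
      sq i = N (suc (n ℕ.+ i)) * N (suc (n ℕ.+ i))

      2c≈ : 2c ≈ c′ + c′
      2c≈ = N-+ c c

      key : ∀ x → c′ + c′ ≤ x + 1# → 0# ≤ x →
        (x + 1# + (c′ + c′)) * (((x + 1#) * (x + 1#) + c′) * x) ≤ (x + 1#) *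
          ((x + 1#) * ((x + 1#) * (x + (c′ + c′))))
      key x h 0≤x = by (0≤N c nn* ((0≤x nn+ 0≤1#) nn* nn h) nn+ 0≤N c nn* (0≤x nn+ 0≤1#) nn+ 0≤ι (# 2) nn*
        (0≤N c nn* 0≤N c))
        (solve 2 (λ a b → (a :+ con 1ℚ) :* ((a :+ con 1ℚ) :* ((a :+ con 1ℚ) :* (a :+ (b :+ b)))) :-
          (a :+ con 1ℚ :+ (b :+ b)) :* (((a :+ con 1ℚ) :* (a :+ con 1ℚ) :+ b) :* a) := b :*
          ((a :+ con 1ℚ) :* (a :+ con 1ℚ :- (b :+ b))) :+ b :* (a :+ con 1ℚ) :+ con (# 2) :* (b :* b))
          refl x c′)

      0≤k² : ∀ i → 0# ≤ sq i
      0≤k² i = sq-nonneg _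

      -- Bounds the quotient of the two products by `(1 + 2c/n) / (1 + 2c/(n + j))`. The
      -- denominator, discarded in `telescope`, is what lets the induction close.
      claim : ∀ j → N n * ((N (n ℕ.+ j) + 2c) * ∏ j (λ i → sq i + c′)) ≤ (N n + 2c) * (N (n ℕ.+ j) * ∏ j sq)
      claim zero = to (trans (*-cong refl (*-cong (+-cong n+0 refl) refl))
        (trans (solve 2 (λ a b → a :* ((a :+ b) :* con 1ℚ) := (a :+ b) :* (a :* con 1ℚ)) refl (N n) 2c)
          (*-cong refl (*-cong (sym n+0) refl))))
        where
        n+0 : N (n ℕ.+ 0) ≈ N n
        n+0 = ≡⇒≈ (cong N (ℕP.+-identityʳ n))
      claim (suc j) = pos-cancel Pos-d (begin
        d * (N n * ((N (n ℕ.+ suc j) + 2c) * ∏ (suc j) (λ i → sq i + c′)))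
          ≈⟨ *-cong refl (*-cong refl (*-cong (+-cong k≈ 2c≈)
            (trans (∏-last j _) (*-cong refl (+-cong (*-cong k≈′ k≈′) refl))))) ⟩
        d * (N n * ((x + 1# + (c′ + c′)) * (P * ((x + 1#) * (x + 1#) + c′))))
          ≈⟨ solve 5 (λ a b c d e → a :* (b :*
            ((c :+ con 1ℚ :+ (d :+ d)) :* (e :* ((c :+ con 1ℚ) :* (c :+ con 1ℚ) :+ d)))) :=
            (c :+ con 1ℚ :+ (d :+ d)) :* ((c :+ con 1ℚ) :* (c :+ con 1ℚ) :+ d) :* (b :* (a :* e))) refl d
            (N n) x c′ P ⟩
        (x + 1# + (c′ + c′)) * ((x + 1#) * (x + 1#) + c′) * (N n * (d * P))
          ≲⟨ *-mono 0≤f (0≤n+2c nn* (0≤x nn* 0≤Q)) ≤-refl (claim j) ⟩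
        (x + 1# + (c′ + c′)) * ((x + 1#) * (x + 1#) + c′) * ((N n + 2c) * (x * Q′))
          ≈⟨ solve 5 (λ a b c d e → (a :+ con 1ℚ :+ (b :+ b)) :* ((a :+ con 1ℚ) :* (a :+ con 1ℚ) :+ b) :*
            ((c :+ d) :* (a :* e)) := (a :+ con 1ℚ :+ (b :+ b)) :* (((a :+ con 1ℚ) :* (a :+ con 1ℚ) :+ b) :* a)
            :* ((c :+ d) :* e)) refl x c′ (N n) 2c Q′ ⟩
        (x + 1# + (c′ + c′)) * (((x + 1#) * (x + 1#) + c′) * x) * ((N n + 2c) * Q′)
          ≲⟨ *-mono (0≤k+2c nn* (0≤k²+c nn* 0≤x)) (0≤n+2c nn* 0≤Q) (key x 2c≤k 0≤x) ≤-refl ⟩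
        (x + 1#) * ((x + 1#) * ((x + 1#) * (x + (c′ + c′)))) * ((N n + 2c) * Q′)
          ≈⟨ solve 5 (λ a b c d e → (a :+ con 1ℚ) :* ((a :+ con 1ℚ) :* ((a :+ con 1ℚ) :* (a :+ (b :+ b)))) :*
            ((c :+ d) :* e) := (a :+ (b :+ b)) :*
            ((c :+ d) :* ((a :+ con 1ℚ) :* (e :* ((a :+ con 1ℚ) :* (a :+ con 1ℚ)))))) refl x c′ (N n) 2c Q′ ⟩
        (x + (c′ + c′)) * ((N n + 2c) * ((x + 1#) * (Q′ * ((x + 1#) * (x + 1#)))))
          ≈⟨ *-cong (+-cong refl 2c≈) (*-cong refl
            (*-cong k≈ (trans (∏-last j sq) (*-cong refl (*-cong k≈′ k≈′))))) ⟨
        d * ((N n + 2c) * (N (n ℕ.+ suc j) * ∏ (suc j) sq)) ∎)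
        where
        open ≤-Reasoning
        x d P Q′ : R
        x = N (n ℕ.+ j)
        d = x + 2c
        P = ∏ j (λ i → sq i + c′)
        Q′ = ∏ j sq
        k≈′ : N (suc (n ℕ.+ j)) ≈ x + 1#
        k≈′ = trans (N-suc (n ℕ.+ j)) (+-comm _ _)
        k≈ : N (n ℕ.+ suc j) ≈ x + 1#
        k≈ = trans (≡⇒≈ (cong N (ℕP.+-suc n j))) k≈′
        0≤x : 0# ≤ x
        0≤x = 0≤N (n ℕ.+ j)
        0≤Q : 0# ≤ Q′
        0≤Q = ∏-nonneg j sq 0≤k²
        0≤n+2c : 0# ≤ N n + 2c
        0≤n+2c = 0≤N n nn+ 0≤N (c ℕ.+ c)
        0≤k+2c : 0# ≤ x + 1# + (c′ + c′)
        0≤k+2c = 0≤x nn+ 0≤1# nn+ (0≤N c nn+ 0≤N c)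
        0≤k²+c : 0# ≤ (x + 1#) * (x + 1#) + c′
        0≤k²+c = sq-nonneg (x + 1#) nn+ 0≤N c
        0≤f : 0# ≤ (x + 1# + (c′ + c′)) * ((x + 1#) * (x + 1#) + c′)
        0≤f = 0≤k+2c nn* 0≤k²+c
        Pos-d : Pos d
        Pos-d = pos-mono (by (nn (N-mono (ℕP.m≤m+n n j)) nn+ 0≤N (c ℕ.+ c))
          (solve 3 (λ a b c → a :+ b :- c := a :- c :+ b) refl x 2c (N n))) (Pos-N n 0<n)
        2c≤k : c′ + c′ ≤ x + 1#
        2c≤k = ≤-trans (from 2c≈) (≤-trans (N-mono (ℕP.≤-trans 2c≤n (ℕP.m≤m+n n j)))
          (by 0≤1# (solve 1 (λ a → a :+ con 1ℚ :- a := con 1ℚ) refl x)))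

    telescope : ∀ j → N n * ∏ j (λ i → sq i + N c) ≤ (N n + N (c ℕ.+ c)) * ∏ j sq
    telescope j = pos-cancel Pos-d (begin
      d * (N n * P)            ≈⟨ solve 3 (λ a b c → a :* (b :* c) := b :* (a :* c)) refl d (N n) P ⟩
      N n * (d * P)            ≲⟨ claim j ⟩
      (N n + 2c) * (x * Q′)    ≲⟨ *-mono (0≤N n nn+ 0≤N (c ℕ.+ c))
        ((0≤N (n ℕ.+ j) nn+ 0≤N (c ℕ.+ c)) nn* ∏-nonneg j sq 0≤k²) ≤-refl
                                    (*-mono (0≤N (n ℕ.+ j)) (∏-nonneg j sq 0≤k²)
                                      (by (0≤N (c ℕ.+ c)) (solve 2 (λ a b → a :+ b :- a := b) refl x 2c))
                                      ≤-refl) ⟩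
      (N n + 2c) * (d * Q′)    ≈⟨ solve 4 (λ a b c d → (a :+ b) :* (c :* d) := c :* ((a :+ b) :* d)) refl
        (N n) 2c d Q′ ⟩
      d * ((N n + 2c) * Q′)    ∎)
      where
      open ≤-Reasoning
      x d P Q′ : R
      x = N (n ℕ.+ j)
      d = x + 2c
      P = ∏ j (λ i → sq i + c′)
      Q′ = ∏ j sq
      Pos-d : Pos d
      Pos-d = pos-mono (by (nn (N-mono (ℕP.m≤m+n n j)) nn+ 0≤N (c ℕ.+ c))
        (solve 3 (λ a b c → a :+ b :- c := a :- c :+ b) refl x 2c (N n))) (Pos-N n 0<n)

  2c₀ : ℕ
  2c₀ = c₀ ℕ.+ c₀

  module _ {α β α′ β′ : R} (αw : α within ι (# 7)) (βw : β within ι (# 7))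
           (αw′ : α′ within ι (# 7)) (βw′ : β′ within ι (# 7)) where
    module _ (n j : ℕ) (n≥ : 2c₀ ℕ.≤ n) where
      private
        m : ℕ
        m = n ℕ.+ j
      open Finite m
      module _ (7h≤1 : ι (# 7) * h ≤ 1#) where
        private
          index : ℕ → ℕ
          index i = suc (n ℕ.+ i)
          sq T T′ : ℕ → R
          sq i = N (index i) * N (index i)
          T i = pair α β (index i)
          T′ i = pair α′ β′ (index i)

          -- `2c₀ = 94080` lies above the threshold of `4s≤q`, so a single lower bound on `n` serves
          -- both the ratio and the telescoping.
          sq≥ : ∀ i → ι (# 18816) ≤ sq i
          sq≥ i = begin
            ι (# 18816)                 ≲⟨ by (0≤ι (# 75264))
              (solve 0 (con (# 94080) :- con (# 18816) := con (# 75264)) refl) ⟩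
            N 2c₀                       ≲⟨ N-mono (ℕP.≤-trans n≥ (ℕP.m≤n⇒m≤1+n (ℕP.m≤m+n n i))) ⟩
            N (index i)                 ≈⟨ solve 1 (λ a → a := con 1ℚ :* a) refl (N (index i)) ⟩
            1# * N (index i)            ≲⟨ *-mono 0≤1# (0≤N (index i)) (N-mono {1} {index i} (ℕ.s≤s ℕ.z≤n))
              ≤-refl ⟩
            N (index i) * N (index i)   ∎
            where open ≤-Reasoning

          index≤ : ∀ i → i ℕ.< j → index i ℕ.≤ m
          index≤ i i<j = ℕP.≤-trans (ℕP.≤-reflexive (≡-sym (ℕP.+-suc n i))) (ℕP.+-monoʳ-≤ n i<j)

          Pos-s₀ : Pos s₀
          Pos-s₀ = pos-* (pos-ι (ℚP.positive⁻¹ (# 147))) (pos-* Pos-h Pos-h)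
            where
            Pos-h : Pos h
            Pos-h = pos-ι (0<inv (m ℕ.+ m))

          Pos-q : ∀ i → i ℕ.< j → Pos (q (index i))
          Pos-q i i<j = pos-mono (4s≤q 0≤s₀ (sq≥ i) (q-lower (index i) (index≤ i i<j)))
            (pos-* (pos-ι (ℚP.positive⁻¹ (# 4))) Pos-s₀)

          T-pos : ∀ i → i ℕ.< j → Pos (T i)
          T-pos i i<j = pos-mono (from (pair-quadratic α β (index i)))
            (quadratic-pos 0≤s₀ (a-within 7h≤1 αw βw) (4s≤q 0≤s₀ (sq≥ i) (q-lower (index i) (index≤ i i<j)))
              (Pos-q i i<j))

          ratio : ∀ i → i ℕ.< j → sq i * T′ i ≤ (sq i + N c₀) * T i
          ratio i i<j = ≤-trans (to (*-cong refl (pair-quadratic α′ β′ (index i))))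
            (≤-trans (quadratic-ratio 0≤s₀ (a-within 7h≤1 αw βw) (a-within 7h≤1 αw′ βw′) (γ-within 7h≤1 αw′ βw′)
                       (sq≥ i) (q-lower (index i) (index≤ i i<j)))
              (from (*-cong refl (pair-quadratic α β (index i)))))

          0<n : 0 ℕ.< n
          0<n = ℕP.≤-trans (ℕ.s≤s ℕ.z≤n) n≥

          tail-ratio : N n * ∏ j T′ ≤ (N n + N 2c₀) * ∏ j T
          tail-ratio = pos-cancel (∏-pos j sq λ i _ → pos-* (Pos-N (index i) (ℕ.s≤s ℕ.z≤n))
            (Pos-N (index i) (ℕ.s≤s ℕ.z≤n))) (begin
            ∏ j sq * (N n * ∏ j T′)                      ≈⟨ solve 3 (λ a b c → a :* (b :* c) := b :* (a :* c))
              refl (∏ j sq) (N n) (∏ j T′) ⟩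
            N n * (∏ j sq * ∏ j T′)                      ≈⟨ *-cong refl (∏-* j sq T′) ⟨
            N n * ∏ j (λ i → sq i * T′ i)                ≲⟨ *-mono (0≤N n) (≤-trans (proj₁ mono) (proj₂ mono))
              ≤-refl (proj₂ mono) ⟩
            N n * ∏ j (λ i → (sq i + N c₀) * T i)        ≈⟨ *-cong refl (∏-* j (λ i → sq i + N c₀) T) ⟩
            N n * (∏ j (λ i → sq i + N c₀) * ∏ j T)      ≈⟨ sym (*-assoc _ _ _) ⟩
            N n * ∏ j (λ i → sq i + N c₀) * ∏ j T
              ≲⟨ *-mono (0≤N n nn* ∏-nonneg j _ (λ i → sq-nonneg _ nn+ 0≤N c₀)) 0≤T
                                                              (Telescope.telescope n c₀ n≥ 0<n j) ≤-refl ⟩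
            (N n + N 2c₀) * ∏ j sq * ∏ j T
              ≈⟨ solve 4 (λ a b c d → (a :+ b) :* c :* d := c :* ((a :+ b) :* d)) refl (N n) (N 2c₀) (∏ j sq)
              (∏ j T) ⟩
            ∏ j sq * ((N n + N 2c₀) * ∏ j T)             ∎)
            where
            open ≤-Reasoning
            0≤T : 0# ≤ ∏ j T
            0≤T = ∏-nonneg j T (λ i → 0≤pair α β (index i))
            mono : 0# ≤ ∏ j (λ i → sq i * T′ i) × ∏ j (λ i → sq i * T′ i) ≤ ∏ j (λ i → (sq i + N c₀) * T i)
            mono = ∏-mono j _ _ λ i i<j → sq-nonneg _ nn* 0≤pair α′ β′ (index i) , ratio i i<j

        -- Reads `F′ / F ≤ (1 + 2c₀/n) · head′ / head`, where the head consists of the factors with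
        -- index up to `n`. The bound does not depend on `j`, which may therefore tend to infinity
        -- while `n` stays fixed.
        finite-ratio : N n * (F α′ β′ * (γ α β * ∏ n (λ k → pair α β (suc k))))
                     ≤ (N n + N 2c₀) * (F α β * (γ α′ β′ * ∏ n (λ k → pair α′ β′ (suc k))))
        finite-ratio = pos-cancel (∏-pos j T T-pos) (begin
          ∏ j T * (N n * (F α′ β′ * (γ α β * H)))
            ≈⟨ solve 5 (λ a b c d e → a :* (b :* (c :* (d :* e))) := b :* (c :* (d :* (e :* a)))) refl (∏ j T)
              (N n) (F α′ β′) (γ α β) H ⟩
          N n * (F α′ β′ * (γ α β * (H * ∏ j T)))
            ≈⟨ *-cong refl (*-cong (F-split α′ β′) (sym (F-split α β))) ⟩
          N n * (γ α′ β′ * (H′ * ∏ j T′) * F α β)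
            ≈⟨ solve 5 (λ a b c d e → a :* (b :* (c :* d) :* e) := e :* (b :* c) :* (a :* d)) refl (N n)
              (γ α′ β′) H′ (∏ j T′) (F α β) ⟩
          F α β * (γ α′ β′ * H′) * (N n * ∏ j T′)
            ≲⟨ *-mono (0≤cosh-cos β α nn* (0≤γ α′ β′ nn* ∏-nonneg n _ (λ k → 0≤pair α′ β′ (suc k))))
                 ((0≤N n nn+ 0≤N 2c₀) nn* ∏-nonneg j T (λ i → 0≤pair α β (index i))) ≤-refl tail-ratio ⟩
          F α β * (γ α′ β′ * H′) * ((N n + N 2c₀) * ∏ j T)
            ≈⟨ solve 6 (λ a b c d e f → a :* (b :* c) :* ((d :+ e) :* f) := f :* ((d :+ e) :* (a :* (b :* c))))
              refl (F α β) (γ α′ β′) H′ (N n) (N 2c₀) (∏ j T) ⟩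
          ∏ j T * ((N n + N 2c₀) * (F α β * (γ α′ β′ * H′))) ∎)
          where
          open ≤-Reasoning
          H H′ : R
          H = ∏ n (λ k → pair α β (suc k))
          H′ = ∏ n (λ k → pair α′ β′ (suc k))
          F-split : ∀ x y → F x y ≈ γ x y * (∏ n (λ k → pair x y (suc k)) * ∏ j (λ i → pair x y (index i)))
          F-split x y = trans (F-product x y) (*-cong refl (∏-split n j (λ k → pair x y (suc k))))

-- The sine product as a limit

module SineProduct where
  open Comparison public

  step size : ℕ → R
  step m = Finite.h m
  size m = N (suc (m ℕ.+ m))

  size*step : ∀ m → size m * step m ≈ 1#
  size*step m = Finite.N*h m

  lim-step : Lim step 0#
  lim-step = lim-sub (λ m → m ℕ.+ m) m≤m+m lim-inv

  lim-x*step : ∀ x → Lim (λ m → x * step m) 0#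
  lim-x*step x = lim-0* x lim-step

  x*step-small : ∀ x → Ev (λ m → x * step m within 1#)
  x*step-small x = ev (lim-x*step x 1ℚ 0<1) λ m → within-resp (solve 2 (λ a b → a :* b :- con 0ℚ := a :* b)
    refl x (step m))

  lim-x*step² : ∀ x → Lim (λ m → x * (step m * step m)) 0#
  lim-x*step² x = lim-cong (λ _ → refl) (solve 1 (λ a → a :* (con 0ℚ :* con 0ℚ) := con 0ℚ) refl x)
    (lim-* (lim-const x) (lim-* lim-step lim-step))

  private
    -- The weight `2 M²` turns the leading term `½ (x/M)²` into `x²` and leaves an error of order
    -- `1/M²`.
    quadratic-limit : ∀ x (f : ℕ → R) →
      Ev (λ m → f m - ι ½ * ((x * step m) * (x * step m)) within ((x * step m) * (x * step m)) *
        ((x * step m) * (x * step m))) →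
      Lim (λ m → 2# * (size m * size m) * f m) (x * x)
    quadratic-limit x f E = lim-within (ev E λ m w → within-weaken (to (scaled m)) (within-resp (sym (shift m))
        (within-* (within-self (0≤ι (# 2) nn* sq-nonneg (size m))) w)))
      (lim-x*step² (2# * (x * x) * (x * x)))
      where
      open ≈-Reasoning
      shift : ∀ m → 2# * (size m * size m) * f m - x * x ≈ 2# * (size m * size m) *
        (f m - ι ½ * ((x * step m) * (x * step m)))
      shift m = begin
        2# * (size m * size m) * f m - x * x
          ≈⟨ solve 3 (λ a b c → con (# 2) :* (a :* a) :* b :- c :* c := con (# 2) :* (a :* a) :* b :- c :* c :*
            (con 1ℚ :* con 1ℚ)) refl (size m) (f m) x ⟩
        2# * (size m * size m) * f m - x * x * (1# * 1#)
          ≈⟨ -‿-cong refl (*-cong refl (*-cong (size*step m) (size*step m))) ⟨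
        2# * (size m * size m) * f m - x * x * (size m * step m * (size m * step m))
          ≈⟨ solve 4 (λ a b c d → con (# 2) :* (a :* a) :* b :- c :* c :* (a :* d :* (a :* d)) := con (# 2) :*
            (a :* a) :* (b :- con ½ :* (c :* d :* (c :* d)))) refl (size m) (f m) x (step m) ⟩
        2# * (size m * size m) * (f m - ι ½ * ((x * step m) * (x * step m))) ∎
      scaled : ∀ m → 2# * (size m * size m) * (((x * step m) * (x * step m)) * ((x * step m) * (x * step m)))
                   ≈ 2# * (x * x) * (x * x) * (step m * step m)
      scaled m = begin
        2# * (size m * size m) * (((x * step m) * (x * step m)) * ((x * step m) * (x * step m)))
          ≈⟨ solve 3 (λ a b c → con (# 2) :* (a :* a) :* (b :* c :* (b :* c) :* (b :* c :* (b :* c))) := con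
            (# 2) :* (b :* b) :* (b :* b) :* (c :* c) :* (a :* c :* (a :* c))) refl (size m) x (step m) ⟩
        2# * (x * x) * (x * x) * (step m * step m) * (size m * step m * (size m * step m))
          ≈⟨ *-cong refl (*-cong (size*step m) (size*step m)) ⟩
        2# * (x * x) * (x * x) * (step m * step m) * (1# * 1#)
          ≈⟨ solve 2 (λ a b → con (# 2) :* (a :* a) :* (a :* a) :* (b :* b) :* (con 1ℚ :* con 1ℚ) := con
            (# 2) :* (a :* a) :* (a :* a) :* (b :* b)) refl x (step m) ⟩
        2# * (x * x) * (x * x) * (step m * step m) ∎

  lim-cosh : ∀ x → Lim (λ m → 2# * (size m * size m) * (cosh (x * step m) - 1#)) (x * x)
  lim-cosh x = quadratic-limit x _ (ev (x*step-small x) λ m w → within-resp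
    (solve 3 (λ a b c → a :- (con 1ℚ :+ con ½ :* (b :* c :* (b :* c))) := a :- con 1ℚ :- con ½ :*
      (b :* c :* (b :* c))) refl (cosh (x * step m)) x (step m))
    (cosh-taylor₄ (x * step m) w))

  lim-1-cos : ∀ x → Lim (λ m → 2# * (size m * size m) * (1# - cos (x * step m))) (x * x)
  lim-1-cos x = quadratic-limit x _ (ev (x*step-small x) λ m w → within-resp
    (solve 3 (λ a b c → (:- (a :- (con 1ℚ :- con ½ :* (b :* c :* (b :* c))))) := con 1ℚ :- a :- con ½ :*
      (b :* c :* (b :* c))) refl (cos (x * step m)) x (step m))
    (within-neg (cos-taylor₄ (x * step m) w)))

  -- |w - ζ²|² for ζ = α + iβ and real w.
  P : R → R → R → R
  P α β w = w * w + 2# * ((β * β - α * α) * w) + (β * β + α * α) * (β * β + α * α)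

  W : ℕ → R
  W k = (N (suc k) * 2π) * (N (suc k) * 2π)

  -- The squared modulus of `ζ ∏ (W k - ζ²)`, left without normalisation because only values with
  -- the same `n` are compared.
  sineProduct : ℕ → R → R → R
  sineProduct n α β = (β * β + α * α) * ∏ n (λ k → P α β (W k))

  module _ (α β : R) where
    open Finite using (γ; pair; pair-quadratic; q; a)

    lim-γ : Lim (λ m → 2# * (size m * size m) * γ m α β) (β * β + α * α)
    lim-γ = lim-cong
      (λ m → (solve 3 (λ a b c → con (# 2) :* (a :* a) :* (b :- con 1ℚ) :+ con (# 2) :* (a :* a) :*
        (con 1ℚ :- c) := con (# 2) :* (a :* a) :* (b :- c)) refl (size m) (cosh (β * step m))
        (cos (α * step m)))) refl
      (lim-+ (lim-cosh β) (lim-1-cos α))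

    -- `a = (C - 1) - (1 - c) - (C - 1) (1 - c)`, where the product is of fourth order in `1/M` and
    -- vanishes under the weight `2 M²`.
    lim-a : Lim (λ m → 2# * (size m * size m) * a m α β) (β * β - α * α)
    lim-a = lim-cong expand (solve 2 (λ a b → a :* a :- b :* b :- a :* a :* (b :* b) :* con 0ℚ := a :* a
      :- b :* b) refl β α)
      (lim-- (lim-- (lim-cosh β) (lim-1-cos α)) (lim-* (lim-* (lim-cosh β) (lim-1-cos α)) (lim-x*step² (ι ½))))
      where
      expand : ∀ m → 2# * (size m * size m) * (cosh (β * step m) - 1#) - 2# * (size m * size m) *
        (1# - cos (α * step m))
        - 2# * (size m * size m) * (cosh (β * step m) - 1#) * (2# * (size m * size m) * (1# - cos (α * step m)))
          * (ι ½ * (step m * step m))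
        ≈ 2# * (size m * size m) * a m α β
      expand m = begin
        _ ≈⟨ solve 4 (λ a b c d → con (# 2) :* (a :* a) :* (b :- con 1ℚ) :- con (# 2) :* (a :* a) :*
          (con 1ℚ :- c) :- con (# 2) :* (a :* a) :* (b :- con 1ℚ) :* (con (# 2) :* (a :* a) :* (con 1ℚ :- c)) :*
          (con ½ :* (d :* d)) := con (# 2) :* (a :* a) :* (b :- con 1ℚ) :- con (# 2) :* (a :* a) :*
          (con 1ℚ :- c) :- con (# 2) :* (a :* a) :* ((b :- con 1ℚ) :* (con 1ℚ :- c)) :* (a :* d :* (a :* d)))
          refl M C c s ⟩
        2# * (M * M) * (C - 1#) - 2# * (M * M) * (1# - c) - 2# * (M * M) * ((C - 1#) * (1# - c)) *
          (M * s * (M * s))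
          ≈⟨ -‿-cong refl (*-cong refl (*-cong (size*step m) (size*step m))) ⟩
        2# * (M * M) * (C - 1#) - 2# * (M * M) * (1# - c) - 2# * (M * M) * ((C - 1#) * (1# - c)) * (1# * 1#)
          ≈⟨ solve 3 (λ a b c → con (# 2) :* (a :* a) :* (b :- con 1ℚ) :- con (# 2) :* (a :* a) :* (con 1ℚ :- c)
            :- con (# 2) :* (a :* a) :* ((b :- con 1ℚ) :* (con 1ℚ :- c)) :* (con 1ℚ :* con 1ℚ) := con (# 2) :*
            (a :* a) :* (b :* c :- con 1ℚ)) refl M C c ⟩
        2# * (M * M) * (C * c - 1#) ∎
        where
        open ≈-Reasoning
        M s C c : R
        M = size m
        s = step m
        C = cosh (β * s)
        c = cos (α * s)

    lim-q : ∀ k → Lim (λ m → 2# * (size m * size m) * q m (suc k)) (W k)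
    lim-q k = lim-cong (λ m → *-cong refl (-‿-cong refl
      (cos-cong (solve 3 (λ a b c → a :* (con (# 2) :* b) :* c := a :* (c :* (con (# 2) :* b))) refl
      (N (suc k)) π (step m))))) refl
      (lim-1-cos (N (suc k) * 2π))

    -- The pair is homogeneous of degree two in `q`, `a` and `γ`, so the weight `4 M⁴` distributes
    -- as `2 M²` to each occurrence.
    lim-pair : ∀ k → Lim (λ m → size m * size m * (size m * size m) * pair m α β (suc k)) (P α β (W k))
    lim-pair k = lim-cong
      (λ m → trans
        (solve 4 (λ a b c d → con (# 2) :* (a :* a) :* b :* (con (# 2) :* (a :* a) :* b) :+ con (# 2) :*
          (con (# 2) :* (a :* a) :* c :* (con (# 2) :* (a :* a) :* b)) :+ con (# 2) :* (a :* a) :* d :*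
          (con (# 2) :* (a :* a) :* d) := a :* a :* (a :* a) :*
          (con (# 4) :* (b :* b :+ con (# 2) :* (c :* b) :+ d :* d))) refl (size m) (q m (suc k)) (a m α β)
          (γ m α β))
        (*-cong refl (sym (pair-quadratic m α β (suc k))))) refl
      (lim-+ (lim-+ (lim-* (lim-q k) (lim-q k)) (lim-* (lim-const 2#) (lim-* lim-a (lim-q k))))
        (lim-* lim-γ lim-γ))

    lim-sineProduct : ∀ n → Lim
      (λ m → 2# * (size m * size m) * γ m α β * ∏ n (λ k → size m * size m * (size m * size m) * pair m α β
        (suc k)))
      (sineProduct n α β)
    lim-sineProduct n = lim-* lim-γ (lim-∏ n (λ m k → size m * size m * (size m * size m) * pair m α β (suc k))
      (λ k → P α β (W k)) lim-pair)

  -- The heads in `finite-ratio` have equal length on both sides, so a common weight makes all their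
  -- factors converge as M grows. With the two arguments exchanged, the same estimate bounds the
  -- ratio from the other side.
  sine-ratio : ∀ {α β α′ β′} → α within ι (# 7) → β within ι (# 7) → α′ within ι (# 7) → β′ within ι (# 7) →
    ∀ n → 2c₀ ℕ.≤ n →
    N n * (F α′ β′ * sineProduct n α β) ≤ (N n + N 2c₀) * (F α β * sineProduct n α′ β′)
  sine-ratio {α} {β} {α′} {β′} αw βw αw′ βw′ n n≥ = lim-≤
    (ev (lim-sub (n ℕ.+_) (λ m → ℕP.m≤n+m m n) (lim-x*step (ι (# 7))) 1ℚ 0<1) scaled)
    (lim-* (lim-const (N n)) (lim-* (lim-const (F α′ β′))
      (lim-sub (n ℕ.+_) (λ m → ℕP.m≤n+m m n) (lim-sineProduct α β n))))
    (lim-* (lim-const (N n + N 2c₀)) (lim-* (lim-const (F α β))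
      (lim-sub (n ℕ.+_) (λ m → ℕP.m≤n+m m n) (lim-sineProduct α′ β′ n))))
    where
    open Finite using (γ; pair)
    scaled : ∀ j → ι (# 7) * step (n ℕ.+ j) - 0# within ι 1ℚ →
      N n * (F α′ β′ * (2# * (size (n ℕ.+ j) * size (n ℕ.+ j)) * γ (n ℕ.+ j) α β
        * ∏ n (λ k → size (n ℕ.+ j) * size (n ℕ.+ j) * (size (n ℕ.+ j) * size (n ℕ.+ j)) * pair (n ℕ.+ j) α β
          (suc k))))
      ≤ (N n + N 2c₀) * (F α β * (2# * (size (n ℕ.+ j) * size (n ℕ.+ j)) * γ (n ℕ.+ j) α′ β′
        * ∏ n (λ k → size (n ℕ.+ j) * size (n ℕ.+ j) * (size (n ℕ.+ j) * size (n ℕ.+ j)) * pair (n ℕ.+ j) α′ β′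
          (suc k))))
    scaled j w = begin
      N n * (F α′ β′ * (2# * (M * M) * γ m α β * ∏ n (λ k → M * M * (M * M) * pair m α β (suc k))))
        ≈⟨ factor-out (N n) (F α′ β′) (γ m α β) (pair m α β) ⟩
      S * (N n * (F α′ β′ * (γ m α β * ∏ n (λ k → pair m α β (suc k)))))
        ≲⟨ *-mono 0≤S (≤-trans nonneg finite) ≤-refl finite ⟩
      S * ((N n + N 2c₀) * (F α β * (γ m α′ β′ * ∏ n (λ k → pair m α′ β′ (suc k)))))
        ≈⟨ factor-out (N n + N 2c₀) (F α β) (γ m α′ β′) (pair m α′ β′) ⟨
      (N n + N 2c₀) * (F α β * (2# * (M * M) * γ m α′ β′ * ∏ n
        (λ k → M * M * (M * M) * pair m α′ β′ (suc k)))) ∎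
      where
      open ≤-Reasoning
      m : ℕ
      m = n ℕ.+ j
      M S : R
      M = size m
      S = 2# * (M * M) * ∏ n (λ _ → M * M * (M * M))
      0≤S : 0# ≤ S
      0≤S = 0≤ι (# 2) nn* sq-nonneg M nn* ∏-nonneg n _ (λ _ → sq-nonneg M nn* sq-nonneg M)
      finite : N n * (F α′ β′ * (γ m α β * ∏ n (λ k → pair m α β (suc k))))
             ≤ (N n + N 2c₀) * (F α β * (γ m α′ β′ * ∏ n (λ k → pair m α′ β′ (suc k))))
      finite = finite-ratio αw βw αw′ βw′ n j n≥
        (≤-trans (to (solve 1 (λ a → con (# 7) :* a := con (# 7) :* a :- con 0ℚ) refl (step m))) (upper w))
      nonneg : 0# ≤ N n * (F α′ β′ * (γ m α β * ∏ n (λ k → pair m α β (suc k))))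
      nonneg = 0≤N n nn* (0≤cosh-cos β′ α′ nn*
        (Finite.0≤γ m α β nn* ∏-nonneg n _ (λ k → Finite.0≤pair m α β (suc k))))
      factor-out : ∀ x y g (p : ℕ → R) → x * (y * (2# * (M * M) * g * ∏ n (λ k → M * M * (M * M) * p (suc k))))
                                       ≈ S * (x * (y * (g * ∏ n (λ k → p (suc k)))))
      factor-out x y g p = trans (*-cong refl (*-cong refl
        (*-cong refl (∏-* n (λ _ → M * M * (M * M)) (λ k → p (suc k))))))
        (solve 6 (λ a b c d e f → a :* (b :* (con (# 2) :* (c :* c) :* d :* (e :* f))) := con (# 2) :*
          (c :* c) :* e :* (a :* (b :* (d :* f)))) refl x y M g (∏ n (λ _ → M * M * (M * M)))
          (∏ n (λ k → p (suc k))))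

-- Roots of -1 and the product over the integers

module RootsOfMinusOne where
  open SineProduct public

  -- An upper bound `B` of `b` turns the lower bound `δ` of the product into the lower bound `δ / B`
  -- of `f`.
  pos-factor : ∀ {f b} → 0# ≤ f → Pos (f * b) → Pos f
  pos-factor {f} {b} 0≤f (δ , 0<δ , δ≤) =
    let B , 0<B , w = within-bounded b
        r , 0<r , Br≡1 = reciprocal B 0<B
    in r Q.* δ , 0<* 0<r 0<δ , (begin
      ι (r Q.* δ)           ≈⟨ ι-* r δ ⟩
      ι r * ι δ             ≲⟨ *-mono (ι-mono (ℚP.<⇒≤ 0<r)) (0≤f nn* ι-mono (ℚP.<⇒≤ 0<B)) ≤-refl
                                 (≤-trans δ≤ (*-mono 0≤f (ι-mono (ℚP.<⇒≤ 0<B)) ≤-refl (upper w))) ⟩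
      ι r * (f * ι B)       ≈⟨ solve 3 (λ a b c → a :* (b :* c) := c :* a :* b) refl (ι r) f (ι B) ⟩
      ι B * ι r * f         ≈⟨ *-cong (trans (sym (ι-* B r)) (≡⇒≈ (cong ι Br≡1))) refl ⟩
      1# * f                ≈⟨ *-identityˡ f ⟩
      f                     ∎)
    where open ≤-Reasoning

  -- The sign of w is that of a rational approximation of w to within √δ / 2.
  pos-square⇒apart : ∀ {w} → Pos (w * w) → Pos w ⊎ Pos (- w)
  pos-square⇒apart {w} (δ , 0<δ , δ≤w²) = decide (ℚP.≤-total 0ℚ p)
    where
    r : ℚ
    r = proj₁ (scale 1ℚ δ 0≤1 0<δ)
    0<r : 0ℚ Q.< r
    0<r = proj₁ (proj₂ (scale 1ℚ δ 0≤1 0<δ))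
    r≤1 : r Q.≤ 1ℚ
    r≤1 = proj₁ (proj₂ (proj₂ (scale 1ℚ δ 0≤1 0<δ)))
    r≤δ : 1ℚ Q.* r Q.≤ δ
    r≤δ = proj₂ (proj₂ (proj₂ (scale 1ℚ δ 0≤1 0<δ)))
    0<ε : 0ℚ Q.< ½ Q.* r
    0<ε = 0<* 0<½ 0<r
    near : Ev (λ m → w ≤ ι (seq w m) + ι (½ Q.* r) × ι (seq w m) ≤ w + ι (½ Q.* r))
    near = approx w (½ Q.* r) 0<ε
    p : ℚ
    p = seq w (proj₁ near)
    w≤ : w ≤ ι p + ι (½ Q.* r)
    w≤ = proj₁ (proj₂ near (proj₁ near) ℕP.≤-refl)
    ≤w : ι p ≤ w + ι (½ Q.* r)
    ≤w = proj₂ (proj₂ near (proj₁ near) ℕP.≤-refl)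
    half : ι (½ Q.* r) ≈ ι ½ * ι r
    half = ι-* ½ r
    r²≤ : ι r * ι r ≤ w * w
    r²≤ = ≤-trans (by (ι-mono (ℚP.<⇒≤ 0<r) nn* nn (ι-mono r≤1))
      (solve 1 (λ a → con 1ℚ :* a :- a :* a := a :* (con 1ℚ :- a)) refl (ι r)))
      (≤-trans (from (ι-* 1ℚ r)) (≤-trans (ι-mono r≤δ) δ≤w²))
    positive : ∀ v → v * v ≈ w * w → - (ι ½ * ι r) ≤ v → Pos v
    positive v v²≈ -ε≤v = r , 0<r , pos-cancel {v + ι r} {ι r} {v}
      (½ Q.* r , 0<ε , ≤-trans (to half) (by (nn -ε≤v)
        (solve 2 (λ a b → a :+ b :- con ½ :* b := a :- (:- (con ½ :* b))) refl v (ι r))))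
      (by (nn r²≤) (trans (solve 2 (λ a b → (a :+ b) :* a :- (a :+ b) :* b := a :* a :- b :* b) refl v (ι r))
        (-‿-cong v²≈ refl)))
    decide : (0ℚ Q.≤ p) ⊎ (p Q.≤ 0ℚ) → Pos w ⊎ Pos (- w)
    decide (inj₁ 0≤p) = inj₁ (positive w refl
      (by (ι-mono 0≤p nn+ nn (≤-trans ≤w (+-mono ≤-refl (to half))))
        (solve 3 (λ a b c → a :- (:- (con ½ :* b)) := c :+ (a :+ con ½ :* b :- c)) refl w (ι r) (ι p))))
    decide (inj₂ p≤0) = inj₂ (positive (- w) (solve 1 (λ a → (:- a) :* (:- a) := a :* a) refl w)
      (by (nn (ι-mono p≤0) nn+ nn (≤-trans w≤ (+-mono ≤-refl (to half))))
        (solve 3 (λ a b c → (:- a) :- (:- (con ½ :* b)) := con 0ℚ :- c :+ (c :+ con ½ :* b :- a)) refl w (ι r)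
        (ι p))))

  module Roots (m : ℕ) where
    open Angles m
    n : ℕ
    n = suc m

    A : R
    A = ι (inv m) * π

    -- `A` is half of `τ`, so these are the angles `(2 i + 1) π / n`, those of the statement with
    -- `k = i + 1`.
    θ : ℕ → R
    θ i = A + N i * τ

    -- Real and imaginary part of `2 π t ω`, where `ω` is the root of -1 at the angle `θ i`.
    α β : R → ℕ → R
    α t i = 2π * t * cos (θ i)
    β t i = 2π * t * sin (θ i)

    -- `∣ p - t ω ∣²` for the same `ω`.
    v : R → ℕ → R → R
    v t i p = p * p + t * t - 2# * (p * t) * cos (θ i)

    e : R → R → R
    e t p = (t ↑ n + p ↑ n) * (t ↑ n + p ↑ n)

    cos-nA : cos (N n * A) ≈ - 1#
    cos-nA = trans (cos-cong (trans (solve 3 (λ a b c → a :* (b :* c) := b :* a :* c) refl (N n) (ι (inv m)) π)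
      (trans (*-cong (inv*N m) refl) (*-identityˡ π)))) cos-π

    v-product : ∀ t p → Pos t → ∏ n (λ i → v t i p) ≈ e t p
    v-product t p Pos-t = begin
      ∏ n (λ i → v t i p)                                              ≈⟨ chord-product p t A Pos-t ⟩
      p ↑ n * p ↑ n + t ↑ n * t ↑ n - 2# * (p ↑ n * t ↑ n) * cos
        (N n * A) ≈⟨ -‿-cong refl (*-cong refl cos-nA) ⟩
      p ↑ n * p ↑ n + t ↑ n * t ↑ n - 2# * (p ↑ n * t ↑ n) * - 1#       ≈⟨ square-sum (p ↑ n) (t ↑ n) ⟩
      e t p                                                            ∎
      where
      open ≈-Reasoning
      square-sum : ∀ x y → x * x + y * y - 2# * (x * y) * - 1# ≈ (y + x) * (y + x)
      square-sum x y = solve 2 (λ a b → a :* a :+ b :* b :- con (# 2) :* (a :* b) :* (:- (con 1ℚ)) :=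
        (b :+ a) :* (b :+ a)) refl x y

    -- `W k` is the square of `2 π (k + 1)`, so `w - ζ²` splits as `(√w - ζ) (√w + ζ)`; the two
    -- factors belong to the integers `± (k + 1)`.
    P-factor : ∀ t i k → P (α t i) (β t i) (W k) ≈ 2π * 2π * (2π * 2π) *
      (v t i (N (suc k)) * v t i (- N (suc k)))
    P-factor t i k = begin
      P (κ′ * t * c) (κ′ * t * s) (M * κ′ * (M * κ′))
        ≈⟨ solve 5 (λ a b c d e → a :* b :* (a :* b) :* (a :* b :* (a :* b)) :+ con (# 2) :*
          ((b :* c :* d :* (b :* c :* d) :- b :* c :* e :* (b :* c :* e)) :* (a :* b :* (a :* b))) :+
          (b :* c :* d :* (b :* c :* d) :+ b :* c :* e :* (b :* c :* e)) :*
          (b :* c :* d :* (b :* c :* d) :+ b :* c :* e :* (b :* c :* e)) := b :* b :* (b :* b) :*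
          (a :* a :* (a :* a) :+ con (# 2) :* (a :* a) :* (c :* c) :*
          (e :* e :+ d :* d :- con (# 2) :* (e :* e)) :+ c :* c :* (c :* c) :*
          ((e :* e :+ d :* d) :* (e :* e :+ d :* d)))) refl M κ′ t s c ⟩
      κ′ * κ′ * (κ′ * κ′) * (M * M * (M * M) + 2# * (M * M) * (t * t) * ((c * c + s * s) - 2# * (c * c))
        + t * t * (t * t) * ((c * c + s * s) * (c * c + s * s)))
        ≈⟨ *-cong refl (+-cong (+-cong refl (*-cong refl (-‿-cong (cos²+sin² (θ i)) refl)))
          (*-cong refl (*-cong (cos²+sin² (θ i)) (cos²+sin² (θ i))))) ⟩
      κ′ * κ′ * (κ′ * κ′) * (M * M * (M * M) + 2# * (M * M) * (t * t) * (1# - 2# * (c * c)) + t * t * (t * t) *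
        (1# * 1#))
        ≈⟨ solve 4 (λ a b c d → a :* a :* (a :* a) :* (b :* b :* (b :* b) :+ con (# 2) :* (b :* b) :*
          (c :* c) :* (con 1ℚ :- con (# 2) :* (d :* d)) :+ c :* c :* (c :* c) :* (con 1ℚ :* con 1ℚ))
          := a :* a :* (a :* a) :* ((b :* b :+ c :* c :- con (# 2) :* (b :* c) :* d) :*
          ((:- b) :* (:- b) :+ c :* c :- con (# 2) :* ((:- b) :* c) :* d))) refl κ′ M t c ⟩
      κ′ * κ′ * (κ′ * κ′) * (v t i M * v t i (- M)) ∎
      where
      open ≈-Reasoning
      κ′ c s M : R
      κ′ = 2π
      c = cos (θ i)
      s = sin (θ i)
      M = N (suc k)

    radius : ∀ t i → β t i * β t i + α t i * α t i ≈ 2π * 2π * v t i 0#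
    radius t i = begin
      κ′ * t * s * (κ′ * t * s) + κ′ * t * c * (κ′ * t * c)
        ≈⟨ solve 4 (λ a b c d → a :* b :* c :* (a :* b :* c) :+ a :* b :* d :* (a :* b :* d) := a :* a :*
          (b :* b) :* (d :* d :+ c :* c)) refl κ′ t s c ⟩
      κ′ * κ′ * (t * t) * (c * c + s * s)
        ≈⟨ *-cong refl (cos²+sin² (θ i)) ⟩
      κ′ * κ′ * (t * t) * 1#
        ≈⟨ solve 3 (λ a b c → a :* a :* (b :* b) :* con 1ℚ := a :* a :*
          (con 0ℚ :* con 0ℚ :+ b :* b :- con (# 2) :* (con 0ℚ :* b) :* c)) refl κ′ t c ⟩
      κ′ * κ′ * v t i 0# ∎
      where
      open ≈-Reasoning
      κ′ c s : R
      κ′ = 2π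
      c = cos (θ i)
      s = sin (θ i)

    S : R → ℕ → R
    S t zero    = e t 0#
    S t (suc j) = S t j * (e t (N (suc j)) * e t (- N (suc j)))

    -- The powers of `2 π` that separate the sine products from the product over the integers. They
    -- do not depend on `t`, so they cancel in `product-ratio`.
    Z : ℕ → R
    Z zero    = ∏ n (λ _ → 2π * 2π)
    Z (suc j) = Z j * ∏ n (λ _ → 2π * 2π * (2π * 2π))

    Z-pos : ∀ j → Pos (Z j)
    Z-pos zero    = ∏-pos n _ λ _ _ → pos-* Pos-2π Pos-2π
    Z-pos (suc j) = pos-* (Z-pos j) (∏-pos n _ λ _ _ → pos-* (pos-* Pos-2π Pos-2π) (pos-* Pos-2π Pos-2π))

    S-product : ∀ t → Pos t → ∀ j → ∏ n (λ i → sineProduct j (α t i) (β t i)) ≈ Z j * S t j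
    S-product t Pos-t zero = begin
      ∏ n (λ i → sineProduct 0 (α t i) (β t i))
        ≈⟨ ∏-cong n (λ i _ → trans (solve 2 (λ a b → (a :* a :+ b :* b) :* con 1ℚ := a :* a :+ b :* b) refl
        (β t i) (α t i)) (radius t i)) ⟩
      ∏ n (λ i → 2π * 2π * v t i 0#)              ≈⟨ ∏-* n (λ _ → 2π * 2π) (λ i → v t i 0#) ⟩
      Z 0 * ∏ n (λ i → v t i 0#)                  ≈⟨ *-cong refl (v-product t 0# Pos-t) ⟩
      Z 0 * S t 0                                 ∎
      where open ≈-Reasoning
    S-product t Pos-t (suc j) = begin
      ∏ n (λ i → sineProduct (suc j) (α t i) (β t i))
        ≈⟨ ∏-cong n (λ i _ → trans (*-cong refl (∏-last j (λ k → P (α t i) (β t i) (W k))))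
          (trans (sym (*-assoc (β t i * β t i + α t i * α t i) (∏ j (λ k → P (α t i) (β t i) (W k)))
          (P (α t i) (β t i) (W j)))) (*-cong refl (P-factor t i j)))) ⟩
      ∏ n (λ i → sineProduct j (α t i) (β t i) * (2π * 2π * (2π * 2π) * (v t i M * v t i (- M))))
        ≈⟨ ∏-* n (λ i → sineProduct j (α t i) (β t i)) (λ i → 2π * 2π * (2π * 2π) * (v t i M * v t i (- M))) ⟩
      ∏ n (λ i → sineProduct j (α t i) (β t i)) * ∏ n (λ i → 2π * 2π * (2π * 2π) * (v t i M * v t i (- M)))
        ≈⟨ *-cong (S-product t Pos-t j) (trans (∏-* n (λ _ → 2π * 2π * (2π * 2π)) (λ i → v t i M * v t i (- M)))
             (*-cong refl (trans (∏-* n (λ i → v t i M) (λ i → v t i (- M)))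
               (*-cong (v-product t M Pos-t) (v-product t (- M) Pos-t))))) ⟩
      Z j * S t j * (Y * (e t M * e t (- M)))
        ≈⟨ solve 5 (λ a b c d e → a :* b :* (c :* (d :* e)) := a :* c :* (b :* (d :* e))) refl (Z j) (S t j) Y
          (e t M) (e t (- M)) ⟩
      Z (suc j) * S t (suc j) ∎
      where
      open ≈-Reasoning
      M Y : R
      M = N (suc j)
      Y = ∏ n (λ _ → 2π * 2π * (2π * 2π))

    private
      2π-within : 2π within ι (# 7)
      2π-within = within-≤ (pos⇒nn Pos-2π) (by (0≤ι (+ 1 Q./ 5) nn+ 0≤ι (# 2) nn* nn π≤17/5)
        (solve 1 (λ a → con (# 7) :- con (# 2) :* a := con (+ 1 Q./ 5) :+ con (# 2) :* (con (+ 17 Q./ 5) :- a))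
          refl π))

      angle-within : ∀ {t c} → t within 1# → c within 1# → 2π * t * c within ι (# 7)
      angle-within tw cw = within-weaken (to (solve 0 (con (# 7) :* con 1ℚ :* con 1ℚ := con (# 7)) refl))
        (within-* (within-* 2π-within tw) cw)

      π-within : π within ι (# 7)
      π-within = within-≤ (pos⇒nn Pos-π) (by (0≤ι (+ 18 Q./ 5) nn+ nn π≤17/5)
        (solve 1 (λ a → con (# 7) :- a := con (+ 18 Q./ 5) :+ (con (+ 17 Q./ 5) :- a)) refl π))

    module _ {t : R} (Pos-t : Pos t) (Pos-1-t : Pos (1# - t)) where
      unit : t within 1#
      unit = within-≤ (pos⇒nn Pos-t) (0≤⇒≤ (pos⇒nn Pos-1-t))

      α-within : ∀ i → α t i within ι (# 7)
      α-within i = angle-within unit (cos-within (θ i))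
      β-within : ∀ i → β t i within ι (# 7)
      β-within i = angle-within unit (sin-within (θ i))

      private
        far : ∀ k → Pos ((N (suc k) - t) * (N (suc k) - t))
        far k = pos-* p p
          where
          p : Pos (N (suc k) - t)
          p = pos-mono (by (nn (N-mono {1} {suc k} (ℕ.s≤s ℕ.z≤n)))
            (solve 2 (λ a b → a :- b :- (con 1ℚ :- b) := a :- con 1ℚ) refl (N (suc k)) t)) Pos-1-t

      v-pos-0 : ∀ i → Pos (v t i 0#)
      v-pos-0 i = pos-mono (to (solve 2 (λ a b → a :* a := con 0ℚ :* con 0ℚ :+ a :* a :- con (# 2) :*
        (con 0ℚ :* a) :* b) refl t (cos (θ i)))) (pos-* Pos-t Pos-t)

      -- Since `cos ≤ 1`, the squared distance is at least `(k + 1 - t)²`, which is positive because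
      -- `t < 1`.
      v-pos-+ : ∀ i k → Pos (v t i (N (suc k)))
      v-pos-+ i k = pos-mono (by (0≤ι (# 2) nn*
        (0≤N (suc k) nn* pos⇒nn Pos-t nn* nn (upper (cos-within (θ i)))))
        (solve 3 (λ a b c → a :* a :+ b :* b :- con (# 2) :* (a :* b) :* c :- (a :- b) :* (a :- b) := con
          (# 2) :* (a :* b :* (con 1ℚ :- c))) refl (N (suc k)) t (cos (θ i)))) (far k)

      v-pos-- : ∀ i k → Pos (v t i (- N (suc k)))
      v-pos-- i k = pos-mono (by (0≤ι (# 2) nn*
        (0≤N (suc k) nn* pos⇒nn Pos-t nn* nn (lower (cos-within (θ i)))))
        (solve 3 (λ a b c → (:- a) :* (:- a) :+ b :* b :- con (# 2) :* ((:- a) :* b) :* c :- (a :- b) :*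
          (a :- b) := con (# 2) :* (a :* b :* (c :- (:- (con 1ℚ))))) refl (N (suc k)) t (cos (θ i)))) (far k)

      e-pos-0 : Pos (e t 0#)
      e-pos-0 = pos-mono (to (v-product t 0# Pos-t)) (∏-pos n _ λ i _ → v-pos-0 i)

      e-pos-+ : ∀ k → Pos (e t (N (suc k)))
      e-pos-+ k = pos-mono (to (v-product t (N (suc k)) Pos-t)) (∏-pos n _ λ i _ → v-pos-+ i k)

      e-pos-- : ∀ k → Pos (e t (- N (suc k)))
      e-pos-- k = pos-mono (to (v-product t (- N (suc k)) Pos-t)) (∏-pos n _ λ i _ → v-pos-- i k)

      S-pos : ∀ j → Pos (S t j)
      S-pos zero    = e-pos-0
      S-pos (suc j) = pos-* (S-pos j) (pos-* (e-pos-+ j) (e-pos-- j))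

      sineProduct-pos : ∀ i j → Pos (sineProduct j (α t i) (β t i))
      sineProduct-pos i j = pos-* (pos-mono (from (radius t i)) (pos-* (pos-* Pos-2π Pos-2π) (v-pos-0 i)))
        (∏-pos j _ λ k _ → pos-mono (from (P-factor t i k))
          (pos-* (pos-* (pos-* Pos-2π Pos-2π) (pos-* Pos-2π Pos-2π)) (pos-* (v-pos-+ i k) (v-pos-- i k))))

      -- Compare with ζ = π, where F is 2.
      F-pos : ∀ i → Pos (F (α t i) (β t i))
      F-pos i = compare 2c₀ ℕP.≤-refl
        where
        within-7 : 0# within ι (# 7)
        within-7 = within-0 (0≤ι (# 7))
        Pos-Fπ : Pos (F π 0#)
        Pos-Fπ = pos-mono (by (nn (1≤cosh 0#)) (trans (-‿-cong (-‿-cong refl cos-π) refl)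
          (solve 1 (λ a → a :- (:- (con 1ℚ)) :- con (# 2) := a :- con 1ℚ) refl (cosh 0#))))
            (pos-ι (ℚP.positive⁻¹ (# 2)))
        compare : ∀ j → 2c₀ ℕ.≤ j → Pos (F (α t i) (β t i))
        compare j j≥ = pos-factor {F (α t i) (β t i)} {sineProduct j π 0# * (N j + N 2c₀)} (0≤cosh-cos _ _)
          (pos-mono (≤-trans (sine-ratio (α-within i) (β-within i) π-within within-7 j j≥)
              (to (solve 4 (λ a b c d → (a :+ b) :* (c :* d) := c :* (d :* (a :+ b))) refl (N j) (N 2c₀)
                (F (α t i) (β t i)) (sineProduct j π 0#))))
            (pos-* (Pos-N j (ℕP.≤-trans (ℕ.s≤s ℕ.z≤n) j≥)) (pos-* Pos-Fπ (sineProduct-pos i j))))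

    Fs : R → R
    Fs t = ∏ n (λ i → F (α t i) (β t i))

    -- One factor `1 + 2c₀/(j + 1)` for each root; `j + 1` is the length at which `product-ratio`
    -- truncates.
    ρ : ℕ → R
    ρ j = ∏ n (λ _ → 1# + N 2c₀ * ι (inv j))

    lim-ρ : Lim ρ (∏ n (λ _ → 1#))
    lim-ρ = lim-∏ n _ _ λ _ → lim-cong (λ _ → refl) (solve 0 (con 1ℚ :+ con 0ℚ := con 1ℚ) refl)
      (lim-+ (lim-const 1#) (lim-0* (N 2c₀) lim-inv))

    ∏-1 : ∀ k → ∏ k (λ _ → 1#) ≈ 1#
    ∏-1 zero    = refl
    ∏-1 (suc k) = trans (*-identityˡ _) (∏-1 k)

    1≤ρ : ∀ j → 1# ≤ ρ j
    1≤ρ j = ≤-trans (from (∏-1 n)) (proj₂ (∏-mono n _ _ λ _ _ → 0≤1# ,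
      by (0≤N 2c₀ nn* 0≤inv j) (solve 2 (λ a b → con 1ℚ :+ a :* b :- con 1ℚ := a :* b) refl (N 2c₀)
        (ι (inv j)))))

    module _ {s t : R} (Pos-s : Pos s) (Pos-1-s : Pos (1# - s)) (Pos-t : Pos t) (Pos-1-t : Pos (1# - t)) where
      -- `sine-ratio` multiplied over all roots. The roles of `s` and `t` are interchangeable, and
      -- `limit` uses both orders.
      product-ratio : ∀ j → 2c₀ ℕ.≤ j → Fs t * S s (suc j) ≤ ρ j * (Fs s * S t (suc j))
      product-ratio j j≥ = pos-cancel (Z-pos (suc j)) (begin
        Z (suc j) * (Fs t * S s (suc j))
          ≈⟨ solve 3 (λ a b c → a :* (b :* c) := b :* (a :* c)) refl (Z (suc j)) (Fs t) (S s (suc j)) ⟩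
        Fs t * (Z (suc j) * S s (suc j))
          ≈⟨ trans (∏-* n (G t) (T s)) (*-cong refl (S-product s Pos-s (suc j))) ⟨
        ∏ n (λ i → G t i * T s i)
          ≲⟨ proj₂ (∏-mono n _ _ λ i _ → 0≤cosh-cos _ _ nn* pos⇒nn (sineProduct-pos Pos-s Pos-1-s i (suc j)) ,
            term i) ⟩
        ∏ n (λ i → (1# + N 2c₀ * ι (inv j)) * (G s i * T t i))
          ≈⟨ trans (∏-* n (λ _ → 1# + N 2c₀ * ι (inv j)) (λ i → G s i * T t i))
            (*-cong refl (trans (∏-* n (G s) (T t)) (*-cong refl (S-product t Pos-t (suc j))))) ⟩
        ρ j * (Fs s * (Z (suc j) * S t (suc j)))
          ≈⟨ solve 4 (λ a b c d → a :* (b :* (c :* d)) := c :* (a :* (b :* d))) refl (ρ j) (Fs s) (Z (suc j))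
            (S t (suc j)) ⟩
        Z (suc j) * (ρ j * (Fs s * S t (suc j))) ∎)
        where
        open ≤-Reasoning
        G T : R → ℕ → R
        G u i = F (α u i) (β u i)
        T u i = sineProduct (suc j) (α u i) (β u i)
        term : ∀ i → G t i * T s i ≤ (1# + N 2c₀ * ι (inv j)) * (G s i * T t i)
        term i = pos-cancel (Pos-N (suc j) (ℕ.s≤s ℕ.z≤n)) (begin
          N (suc j) * (G t i * T s i)
            ≲⟨ sine-ratio (α-within Pos-s Pos-1-s i) (β-within Pos-s Pos-1-s i) (α-within Pos-t Pos-1-t i)
              (β-within Pos-t Pos-1-t i)
                 (suc j) (ℕP.m≤n⇒m≤1+n j≥) ⟩
          (N (suc j) + N 2c₀) * (G s i * T t i)
            ≈⟨ solve 4 (λ a b c d → (a :+ b) :* (c :* d) := (a :+ b :* con 1ℚ) :* (c :* d)) refl (N (suc j))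
              (N 2c₀) (G s i) (T t i) ⟩
          (N (suc j) + N 2c₀ * 1#) * (G s i * T t i)
            ≈⟨ *-cong (+-cong refl (*-cong refl (sym (inv*N j)))) refl ⟩
          (N (suc j) + N 2c₀ * (ι (inv j) * N (suc j))) * (G s i * T t i)
            ≈⟨ solve 5 (λ a b c d e → (a :+ b :* (c :* a)) :* (d :* e) := a :* ((con 1ℚ :+ b :* c) :* (d :* e)))
              refl (N (suc j)) (N 2c₀) (ι (inv j)) (G s i) (T t i) ⟩
          N (suc j) * ((1# + N 2c₀ * ι (inv j)) * (G s i * T t i)) ∎)

    module _ {x y : R} (Pos-x : Pos x) (Pos-1-x : Pos (1# - x)) (Pos-y : Pos y) (Pos-1-y : Pos (1# - y)) where
      -- `L` and `p` are characterised by multiplied-out equations, which suits quotients formed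
      -- with any apartness proof. The two orders of `product-ratio` give `p ≤ ρ L` and `L ≤ ρ p`,
      -- and `ρ` tends to 1.
      limit : ∀ (L : R) (p : ℕ → R) → L * Fs x ≈ Fs y → (∀ j → p j * S x j ≈ S y j) → Lim (p ∘ suc) L
      limit L p L-eq p-eq = lim-within {e = λ j → (ρ j - 1#) * (ρ j * L)} (2c₀ , close)
        (lim-cong (λ _ → refl) (trans (*-cong (-‿-cong (∏-1 n) refl) (*-cong (∏-1 n) refl))
          (solve 1 (λ a → (con 1ℚ :- con 1ℚ) :* (con 1ℚ :* a) := con 0ℚ) refl L))
          (lim-* (lim-- lim-ρ (lim-const 1#)) (lim-* lim-ρ (lim-const L))))
        where
        open ≤-Reasoning
        Fx : Pos (Fs x)
        Fx = ∏-pos n _ λ i _ → F-pos Pos-x Pos-1-x i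
        0≤L : 0# ≤ L
        0≤L = pos-cancel Fx (begin
          Fs x * 0#   ≈⟨ solve 1 (λ a → a :* con 0ℚ := con 0ℚ) refl (Fs x) ⟩
          0#          ≲⟨ ∏-nonneg n _ (λ i → 0≤cosh-cos (β y i) (α y i)) ⟩
          Fs y        ≈⟨ trans (sym L-eq) (*-comm _ _) ⟩
          Fs x * L    ∎)
        p≤ : ∀ j → 2c₀ ℕ.≤ j → p (suc j) ≤ ρ j * L
        p≤ j j≥ = pos-cancel (pos-* Fx (S-pos Pos-x Pos-1-x (suc j))) (begin
          Fs x * S x (suc j) * p (suc j)
            ≈⟨ trans (solve 3 (λ a b c → a :* b :* c := a :* (c :* b)) refl (Fs x) (S x (suc j)) (p (suc j)))
              (*-cong refl (p-eq (suc j))) ⟩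
          Fs x * S y (suc j)
            ≲⟨ product-ratio Pos-y Pos-1-y Pos-x Pos-1-x j j≥ ⟩
          ρ j * (Fs y * S x (suc j))
            ≈⟨ *-cong refl (*-cong (sym L-eq) refl) ⟩
          ρ j * (L * Fs x * S x (suc j))
            ≈⟨ solve 4 (λ a b c d → a :* (b :* c :* d) := c :* d :* (a :* b)) refl (ρ j) L (Fs x)
              (S x (suc j)) ⟩
          Fs x * S x (suc j) * (ρ j * L) ∎)
        L≤ : ∀ j → 2c₀ ℕ.≤ j → L ≤ ρ j * p (suc j)
        L≤ j j≥ = pos-cancel (pos-* Fx (S-pos Pos-x Pos-1-x (suc j))) (begin
          Fs x * S x (suc j) * L
            ≈⟨ trans (solve 3 (λ a b c → a :* b :* c := c :* a :* b) refl (Fs x) (S x (suc j)) L)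
              (*-cong L-eq refl) ⟩
          Fs y * S x (suc j)
            ≲⟨ product-ratio Pos-x Pos-1-x Pos-y Pos-1-y j j≥ ⟩
          ρ j * (Fs x * S y (suc j))
            ≈⟨ *-cong refl (*-cong refl (sym (p-eq (suc j)))) ⟩
          ρ j * (Fs x * (p (suc j) * S x (suc j)))
            ≈⟨ solve 4 (λ a b c d → a :* (b :* (c :* d)) := b :* d :* (a :* c)) refl (ρ j) (Fs x) (p (suc j))
              (S x (suc j)) ⟩
          Fs x * S x (suc j) * (ρ j * p (suc j)) ∎)
        -- The majorant does not mention `p`, so that its limit 0 is known beforehand.
        close : ∀ j → 2c₀ ℕ.≤ j → p (suc j) - L within (ρ j - 1#) * (ρ j * L)
        close j j≥ = bounds
          (by ((nn (1≤ρ j)) nn* nn (p≤ j j≥) nn+ nn (L≤ j j≥))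
            (solve 3 (λ a b c → a :- b :- (:- ((c :- con 1ℚ) :* (c :* b))) := (c :- con 1ℚ) :* (c :* b :- a) :+
              (c :* a :- b)) refl (p (suc j)) L (ρ j)))
          (by (nn (1≤ρ j) nn* (nn (1≤ρ j) nn* 0≤L) nn+ nn (p≤ j j≥))
            (solve 3 (λ a b c → (a :- con 1ℚ) :* (a :* b) :- (c :- b) := (a :- con 1ℚ) :* ((a :- con 1ℚ) :* b)
              :+ (a :* b :- c)) refl (ρ j) L (p (suc j))))

-- Passage to the reals of the statement

module Transfer where
  open RootsOfMinusOne public
  open PowerSeries using (one)
  open import Data.Fin using (Fin; zero; suc; toℕ)
  open D.Sequences using (expSum)

  opaque
    unfolding R

    -- The identity map. It marks where the order defined through negation gives way to `_≤_`.
    toR : D.ℝ → R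
    toR x = x

  opaque
    unfolding toR R seq

    seq-toR : ∀ x n → seq (toR x) n ≡ D.seq x n
    seq-toR x n = ≡-refl

  toR-fromℚ : ∀ q → toR (D.fromℚ q) ≈ ι q
  toR-fromℚ q = pointwise λ n → ≡-trans (seq-toR (D.fromℚ q) n) (≡-sym (seq-ι q n))

  toR-+ : ∀ x y → toR (x D.+ y) ≈ toR x + toR y
  toR-+ x y = pointwise λ n → ≡-trans (seq-toR (x D.+ y) n)
    (≡-sym (≡-trans (seq-+ (toR x) (toR y) n) (cong₂ Q._+_ (seq-toR x n) (seq-toR y n))))

  toR-* : ∀ x y → toR (x D.* y) ≈ toR x * toR y
  toR-* x y = pointwise λ n → ≡-trans (seq-toR (x D.* y) n)
    (≡-sym (≡-trans (seq-* (toR x) (toR y) n) (cong₂ Q._*_ (seq-toR x n) (seq-toR y n))))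

  toR-neg : ∀ x → toR (D.- x) ≈ - toR x
  toR-neg x = pointwise λ n → ≡-trans (seq-toR (D.- x) n)
    (≡-sym (≡-trans (seq-neg (toR x) n) (cong Q.-_ (seq-toR x n))))

  toR-exp : ∀ x → toR (D.exp x) ≈ exp (toR x)
  toR-exp x = pointwise λ n → ≡-trans (seq-toR (D.exp x) n)
    (≡-sym (≡-trans (seq-exp (toR x) n) (cong (λ q → expSum one q n) (seq-toR x n))))

  toR-cos : ∀ x → toR (D.cos x) ≈ cos (toR x)
  toR-cos x = pointwise λ n → ≡-trans (seq-toR (D.cos x) n)
    (≡-sym (≡-trans (seq-cos (toR x) n) (cong (λ q → expSum D.cosCoeff q n) (seq-toR x n))))

  toR-sin : ∀ x → toR (D.sin x) ≈ sin (toR x)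
  toR-sin x = pointwise λ n → ≡-trans (seq-toR (D.sin x) n)
    (≡-sym (≡-trans (seq-sin (toR x) n) (cong (λ q → expSum D.sinCoeff q n) (seq-toR x n))))

  toR-π : toR D.π ≈ π
  toR-π = pointwise λ n → ≡-trans (seq-toR D.π n)
    (≡-sym (≡-trans (seq-* (ι (# 4)) leib n) (cong₂ Q._*_ (seq-ι (# 4) n) (seq-leib n))))

  toR-cosh : ∀ x → toR (D.cosh x) ≈ cosh (toR x)
  toR-cosh x = trans (toR-* (D.fromℚ ½) (D.exp x D.+ D.exp (D.- x)))
    (*-cong (toR-fromℚ ½) (trans (toR-+ (D.exp x) (D.exp (D.- x)))
    (+-cong (toR-exp x) (trans (toR-exp (D.- x)) (exp-cong (toR-neg x))))))

  opaque
    unfolding toR R seq ι _+_ _*_ -_ _≤_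

    <⇒pos : ∀ {x} → D.0ℝ D.< x → Pos (toR x)
    <⇒pos {x} (δ , 0<δ , M , f) = δ , 0<δ , λ ε 0<ε → M , λ n M≤n →
      ≤-by (0≤+ (0≤- (f n M≤n)) (ℚP.<⇒≤ 0<ε)) (S.solve 3
        (λ a b c → a S.:+ b S.:- c S.:= a S.:- (S.con 0ℚ S.:+ c) S.:+ b) ≡-refl (D.seq x n) ε δ)

    <1⇒pos : ∀ {x} → x D.< D.1ℝ → Pos (1# - toR x)
    <1⇒pos {x} (δ , 0<δ , M , f) = δ , 0<δ , λ ε 0<ε → M , λ n M≤n →
      ≤-by (0≤+ (0≤- (f n M≤n)) (ℚP.<⇒≤ 0<ε)) (S.solve 3
        (λ a b c → S.con 1ℚ S.:+ (S.:- a) S.:+ b S.:- c S.:= S.con 1ℚ S.:- (a S.:+ c) S.:+ b) ≡-refl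
        (D.seq x n) ε δ)

    pos⇒< : ∀ {x} → Pos (toR x) → D.0ℝ D.< x
    pos⇒< {x} (δ , 0<δ , δ≤x) = ½ Q.* δ , 0<* 0<½ 0<δ , ev (δ≤x (½ Q.* δ) (0<* 0<½ 0<δ)) λ n a →
      ≤-by (0≤- a) (S.solve 2 (λ a b → a S.:- (S.con 0ℚ S.:+ S.con ½ S.:* b) S.:= a S.:+ S.con ½ S.:* b S.:- b)
        ≡-refl (D.seq x n) δ)

    neg⇒< : ∀ {x} → Pos (- toR x) → x D.< D.0ℝ
    neg⇒< {x} (δ , 0<δ , δ≤-x) = ½ Q.* δ , 0<* 0<½ 0<δ , ev (δ≤-x (½ Q.* δ) (0<* 0<½ 0<δ)) λ n a →
      ≤-by (0≤- a) (S.solve 2 (λ a b → S.con 0ℚ S.:- (a S.:+ S.con ½ S.:* b) S.:= (S.:- a) S.:+ S.con ½ S.:* b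
        S.:- b) ≡-refl (D.seq x n) δ)

    ≈-eventually : ∀ {x y : R} → Ev (λ n → seq x n ≡ seq y n) → x ≈ y
    ≈-eventually {x} {y} E = close⇒≈ {x} {y} λ ε 0<ε → ev E λ n eq →
      subst (λ z → Q.∣ z Q.- seq y n ∣ Q.≤ ε) (≡-sym eq)
        (subst (Q._≤ ε) (≡-sym (cong Q.∣_∣ (ℚP.+-inverseʳ (seq y n)))) (ℚP.<⇒≤ 0<ε))

    -- The strict bound has to come with its own gap: `∣ a N - L ∣` is kept below `½ δ`, which
    -- leaves `½ δ` up to `ε`. The quantity `η = ¼ δ` is spent twice, on the limit and on the
    -- passage from `_≤_` to the terms.
    lim⇒⟶ : ∀ {a L} → Lim (toR ∘ a) (toR L) → a D.⟶ L
    lim⇒⟶ {a} {L} p ε (δ , 0<δ , N₀ , f) =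
      let η = ½ Q.* (½ Q.* δ)
          0<η = 0<* 0<½ (0<* 0<½ 0<δ)
          M , h = p η 0<η
      in M , λ k M≤k → ½ Q.* δ , 0<* 0<½ 0<δ ,
        ev ((N₀ , f) & lower (h k M≤k) η 0<η & upper (h k M≤k) η 0<η) λ n (d , l , u) →
          ℚP.≤-trans (ℚP.+-monoˡ-≤ (½ Q.* δ) (∣∣≤ {D.seq (a k) n Q.- D.seq L n} {½ Q.* δ}
              (ℚP.≤-trans u (ℚP.≤-reflexive (S.solve 1 (λ a → S.con ½ S.:* (S.con ½ S.:* a) S.:+ S.con ½ S.:*
                (S.con ½ S.:* a) S.:= S.con ½ S.:* a) ≡-refl δ)))
              (≤-by (0≤- l) (S.solve 3 (λ a b c → S.con ½ S.:* a S.:- (S.:- (b S.:- c)) S.:= b S.:- c S.:+ S.con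
                ½ S.:* (S.con ½ S.:* a) S.:- (S.:- (S.con ½ S.:* (S.con ½ S.:* a)))) ≡-refl δ (D.seq (a k) n)
                (D.seq L n)))))
            (ℚP.≤-trans (ℚP.≤-reflexive (S.solve 1 (λ a → S.con ½ S.:* a S.:+ S.con ½ S.:* a S.:= S.con 0ℚ S.:+
              a) ≡-refl δ)) d)

  lim⇒∏ℤ : ∀ c L → Lim (λ j → toR (D.∏± j c)) (toR L) → D.∏ℤ c ≐ L
  lim⇒∏ℤ c L p = lim⇒⟶ {λ j → D.∏± j c} {L} p

  recip-inverse : ∀ q → ¬ (q ≡ 0ℚ) → D.Sequences.recip q Q.* q ≡ 1ℚ
  recip-inverse q q≢0 with q ℚP.≟ 0ℚ
  ... | yes q≡0 = contradiction q≡0 q≢0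
  ... | no q≢0′ = ℚP.*-inverseˡ q {{Q.≢-nonZero q≢0′}}

  opaque
    unfolding toR R seq _*_

    -- `recip` has the placeholder value 0 at 0, so the terms are known to agree only from the index
    -- on at which `y` is bounded away from 0.
    quotient-* : ∀ x y y#0 → toR (x D./ y ∵ y#0) * toR y ≈ toR x
    quotient-* x y y#0 = ≈-eventually
      (let δ , 0<δ , M , far = D.#0⇒far y y#0 in M , λ n M≤n →
        ≡-trans (ℚP.*-assoc (D.seq x n) (D.Sequences.recip (D.seq y n)) (D.seq y n))
          (≡-trans (cong (λ z → D.seq x n Q.* z)
            (recip-inverse (D.seq y n) λ y≡0 → ℚP.<-irrefl ≡-refl
              (ℚP.<-≤-trans 0<δ (subst (λ z → δ Q.≤ Q.∣ z ∣) y≡0 (far n M≤n)))))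
            (ℚP.*-identityʳ (D.seq x n))))

  pos⇒#0 : ∀ {x w} → toR x ≈ w → Pos w → x D.# D.0ℝ
  pos⇒#0 e p = inj₂ (pos⇒< (pos-mono (from e) p))

  -- Meant for `xⁿ + kⁿ`, which is negative for odd `n` and `k < 0` and positive otherwise; its
  -- square is handled uniformly.
  square⇒#0 : ∀ {x w} → toR x ≈ w → Pos (w * w) → x D.# D.0ℝ
  square⇒#0 e p with pos-square⇒apart p
  ... | inj₁ pos = inj₂ (pos⇒< (pos-mono (from e) pos))
  ... | inj₂ neg = inj₁ (neg⇒< (pos-mono (from (neg-cong e)) neg))

  toR-^ : ∀ x n → toR (x D.^ n) ≈ toR x ↑ n
  toR-^ x zero    = toR-fromℚ 1ℚ
  toR-^ x (suc n) = trans (pointwise λ k → ≡-trans (seq-toR (x D.^ suc n) k)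
    (≡-sym (≡-trans (seq-* (toR x) (toR (x D.^ n)) k) (cong₂ Q._*_ (seq-toR x k) (seq-toR (x D.^ n) k)))))
      (trans (*-cong refl (toR-^ x n)) (*-comm _ _))

  toR-∏-suc : ∀ {n} (c : Fin (suc n) → D.ℝ) → toR (D.∏ c) ≈ toR (c zero) * toR (D.∏ (c ∘ suc))
  toR-∏-suc c = pointwise λ k → ≡-trans (seq-toR (D.∏ c) k)
    (≡-sym (≡-trans (seq-* (toR (c zero)) (toR (D.∏ (c ∘ suc))) k)
      (cong₂ Q._*_ (seq-toR (c zero) k) (seq-toR (D.∏ (c ∘ suc)) k))))

  -- Stated in multiplied form, so that a product of quotients is identified without dividing by
  -- `∏ n f`.
  toR-∏ : ∀ n (f g : ℕ → R) (c : Fin n → D.ℝ) → (∀ i → toR (c i) * f (toℕ i) ≈ g (toℕ i)) →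
          toR (D.∏ c) * ∏ n f ≈ ∏ n g
  toR-∏ zero    f g c e = trans (*-cong (toR-fromℚ 1ℚ) refl) (*-identityˡ 1#)
  toR-∏ (suc n) f g c e = begin
    toR (D.∏ c) * (f 0 * ∏ n (f ∘ suc))
      ≈⟨ *-cong (toR-∏-suc c) refl ⟩
    toR (c zero) * toR (D.∏ (c ∘ suc)) * (f 0 * ∏ n (f ∘ suc))
      ≈⟨ solve 4 (λ a b c d → a :* b :* (c :* d) := a :* c :* (b :* d)) refl (toR (c zero))
        (toR (D.∏ (c ∘ suc))) (f 0) (∏ n (f ∘ suc)) ⟩
    toR (c zero) * f 0 * (toR (D.∏ (c ∘ suc)) * ∏ n (f ∘ suc))
      ≈⟨ *-cong (e zero) (toR-∏ n (f ∘ suc) (g ∘ suc) (c ∘ suc) (e ∘ suc)) ⟩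
    g 0 * ∏ n (g ∘ suc) ∎
    where open ≈-Reasoning

  lim-unshift : ∀ {f L} → Lim (f ∘ suc) L → Lim f L
  lim-unshift p ε 0<ε = let M , h = p ε 0<ε in suc M , λ where (suc m) (ℕ.s≤s M≤m) → h m M≤m

  quotient²-* : ∀ x y y#0 → toR ((x D./ y ∵ y#0) D.^ 2) * (toR y * toR y) ≈ toR x * toR x
  quotient²-* x y y#0 = begin
    toR ((x D./ y ∵ y#0) D.^ 2) * (toR y * toR y)
      ≈⟨ *-cong (toR-^ (x D./ y ∵ y#0) 2) refl ⟩
    1# * toR (x D./ y ∵ y#0) * toR (x D./ y ∵ y#0) * (toR y * toR y)
      ≈⟨ square-* (toR (x D./ y ∵ y#0)) (toR y) ⟩
    toR (x D./ y ∵ y#0) * toR y * (toR (x D./ y ∵ y#0) * toR y)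
      ≈⟨ *-cong (quotient-* x y y#0) (quotient-* x y y#0) ⟩
    toR x * toR x ∎
    where
    open ≈-Reasoning
    square-* : ∀ u w → 1# * u * u * (w * w) ≈ u * w * (u * w)
    square-* u w = solve 2 (λ a b → con 1ℚ :* a :* a :* (b :* b) := a :* b :* (a :* b)) refl u w

  toR-fromℤ : ∀ k → toR (D.fromℤ k) ≈ ι (k Q./ 1)
  toR-fromℤ k = pointwise λ n → ≡-trans (seq-toR (D.fromℤ k) n) (≡-sym (seq-ι (k Q./ 1) n))

  fromℤ-neg : ∀ j → toR (D.fromℤ -[1+ j ]) ≈ - N (suc j)
  fromℤ-neg j = trans (toR-fromℤ -[1+ j ]) (ι-neg (# (suc j)))

  toR-∏±-suc : ∀ c j → toR (D.∏± (suc j) c) ≈ toR (D.∏± j c) * (toR (c (+ suc j)) * toR (c -[1+ j ]))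
  toR-∏±-suc c j = pointwise λ n → ≡-trans (seq-toR (D.∏± (suc j) c) n)
    (≡-sym (≡-trans (seq-* (toR (D.∏± j c)) (toR (c (+ suc j)) * toR (c -[1+ j ])) n)
      (cong₂ Q._*_ (seq-toR (D.∏± j c) n) (≡-trans (seq-* (toR (c (+ suc j))) (toR (c -[1+ j ])) n)
        (cong₂ Q._*_ (seq-toR (c (+ suc j)) n) (seq-toR (c -[1+ j ]) n))))))

  module Main (m : ℕ) .(n≢0 : NonZero (suc m)) where
    open Roots m

    θ-unfold : ∀ (i : Fin (suc m)) → toR (D.θ (suc m) {{n≢0}} i) ≈ ι (+ (2 ℕ.* toℕ i ℕ.+ 1) Q./ suc m) * toR D.π
    θ-unfold i = pointwise λ k → ≡-trans (seq-toR (D.θ (suc m) {{n≢0}} i) k)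
      (≡-sym (≡-trans (seq-* (ι (+ (2 ℕ.* toℕ i ℕ.+ 1) Q./ suc m)) (toR D.π) k)
        (cong₂ Q._*_ (seq-ι (+ (2 ℕ.* toℕ i ℕ.+ 1) Q./ suc m) k) (seq-toR D.π k))))

    toR-θ : ∀ i → toR (D.θ (suc m) {{n≢0}} i) ≈ θ (toℕ i)
    toR-θ i = begin
      toR (D.θ (suc m) {{n≢0}} i)
        ≈⟨ trans (θ-unfold i) (*-cong (≡⇒≈ (cong ι (/-inv k m))) toR-π) ⟩
      ι (# k Q.* inv m) * π
        ≈⟨ *-cong (trans (ι-* (# k) (inv m)) (*-cong N-odd refl)) refl ⟩
      (2# * N (toℕ i) + 1#) * ι (inv m) * π
        ≈⟨ solve 3 (λ a b c → (con (# 2) :* a :+ con 1ℚ) :* b :* c := b :* c :+ a :* (b :* (con (# 2) :* c)))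
          refl (N (toℕ i)) (ι (inv m)) π ⟩
      θ (toℕ i) ∎
      where
      open ≈-Reasoning
      k : ℕ
      k = 2 ℕ.* toℕ i ℕ.+ 1
      N-odd : N k ≈ 2# * N (toℕ i) + 1#
      N-odd = trans (N-+ (2 ℕ.* toℕ i) 1) (+-cong (trans (N-+ (toℕ i) (toℕ i ℕ.+ 0))
        (trans (+-cong refl (≡⇒≈ (cong N (ℕP.+-identityʳ (toℕ i))))) (solve 1 (λ a → a :+ a := con (# 2) :* a)
          refl (N (toℕ i))))) refl)

    2π* : D.ℝ → D.ℝ
    2π* t = D.fromℤ (+ 2) D.* D.π D.* t

    2π*-unfold : ∀ t → toR (2π* t) ≈ 2# * toR D.π * toR t
    2π*-unfold t = pointwise λ k → ≡-trans (seq-toR (2π* t) k)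
      (≡-sym (≡-trans (seq-* (2# * toR D.π) (toR t) k)
        (cong₂ Q._*_ (≡-trans (seq-* 2# (toR D.π) k) (cong₂ Q._*_ (seq-ι (# 2) k) (seq-toR D.π k)))
          (seq-toR t k))))

    factor-unfold : ∀ t (i : Fin (suc m)) → toR (D.factor (suc m) {{n≢0}} t i)
      ≈ toR (D.cosh (2π* t D.* D.sin (D.θ (suc m) {{n≢0}} i))) - toR
        (D.cos (2π* t D.* D.cos (D.θ (suc m) {{n≢0}} i)))
    factor-unfold t i = pointwise λ k → ≡-trans (seq-toR (D.factor (suc m) {{n≢0}} t i) k)
      (≡-sym (≡-trans (seq-+ (toR C) (- toR c) k)
        (cong₂ Q._+_ (seq-toR C k) (≡-trans (seq-neg (toR c) k) (cong Q.-_ (seq-toR c k))))))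
      where
      C c : D.ℝ
      C = D.cosh (2π* t D.* D.sin (D.θ (suc m) {{n≢0}} i))
      c = D.cos (2π* t D.* D.cos (D.θ (suc m) {{n≢0}} i))

    toR-factor : ∀ t i → toR (D.factor (suc m) {{n≢0}} t i) ≈ F (α (toR t) (toℕ i)) (β (toR t) (toℕ i))
    toR-factor t i = begin
      toR (D.factor (suc m) {{n≢0}} t i)
        ≈⟨ trans (factor-unfold t i) (-‿-cong (toR-cosh (2π* t D.* D.sin (D.θ (suc m) {{n≢0}} i)))
          (toR-cos (2π* t D.* D.cos (D.θ (suc m) {{n≢0}} i)))) ⟩
      cosh (toR (2π* t D.* D.sin (D.θ (suc m) {{n≢0}} i))) - cos (toR (2π* t D.* D.cos (D.θ (suc m) {{n≢0}} i)))
        ≈⟨ -‿-cong (cosh-cong (trans (toR-* (2π* t) (D.sin (D.θ (suc m) {{n≢0}} i)))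
          (*-cong κt≈ (trans (toR-sin (D.θ (suc m) {{n≢0}} i)) (sin-cong (toR-θ i))))))
                   (cos-cong (trans (toR-* (2π* t) (D.cos (D.θ (suc m) {{n≢0}} i)))
                     (*-cong κt≈ (trans (toR-cos (D.θ (suc m) {{n≢0}} i)) (cos-cong (toR-θ i)))))) ⟩
      F (α (toR t) (toℕ i)) (β (toR t) (toℕ i)) ∎
      where
      open ≈-Reasoning
      κt≈ : toR (2π* t) ≈ 2π * toR t
      κt≈ = trans (2π*-unfold t) (*-cong (*-cong refl toR-π) refl)

    e-cong : ∀ {t p q} → p ≈ q → e t p ≈ e t q
    e-cong p≈q = *-cong (+-cong refl (↑-cong (suc m) p≈q)) (+-cong refl (↑-cong (suc m) p≈q))

    toR-term : ∀ t k → toR (t D.^ suc m D.+ D.fromℤ k D.^ suc m) ≈ toR t ↑ suc m + toR (D.fromℤ k) ↑ suc m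
    toR-term t k = trans (toR-+ (t D.^ suc m) (D.fromℤ k D.^ suc m))
      (+-cong (toR-^ t (suc m)) (toR-^ (D.fromℤ k) (suc m)))

    toR-∏± : ∀ x y (c : ℤ → D.ℝ) → (∀ k → toR (c k) * e x (toR (D.fromℤ k)) ≈ e y (toR (D.fromℤ k))) →
             ∀ j → toR (D.∏± j c) * S x j ≈ S y j
    toR-∏± x y c c-e = go
      where
      at : ∀ k {p} → toR (D.fromℤ k) ≈ p → toR (c k) * e x p ≈ e y p
      at k h = trans (*-cong refl (e-cong (sym h))) (trans (c-e k) (e-cong h))
      go : ∀ j → toR (D.∏± j c) * S x j ≈ S y j
      go zero    = at (+ 0) (toR-fromℤ (+ 0))
      go (suc j) = begin
        toR (D.∏± (suc j) c) * (S x j * (e x (N (suc j)) * e x (- N (suc j))))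
          ≈⟨ *-cong (toR-∏±-suc c j) refl ⟩
        toR (D.∏± j c) * (toR (c (+ suc j)) * toR (c -[1+ j ])) *
          (S x j * (e x (N (suc j)) * e x (- N (suc j))))
          ≈⟨ solve 6 (λ a b c d e f → a :* (b :* c) :* (d :* (e :* f)) := a :* d :* (b :* e :* (c :* f))) refl
            (toR (D.∏± j c)) (toR (c (+ suc j))) (toR (c -[1+ j ])) (S x j) (e x (N (suc j)))
            (e x (- N (suc j))) ⟩
        toR (D.∏± j c) * S x j * (toR (c (+ suc j)) * e x (N (suc j)) * (toR (c -[1+ j ]) * e x (- N (suc j))))
          ≈⟨ *-cong (go j) (*-cong (at (+ suc j) (toR-fromℤ (+ suc j))) (at -[1+ j ] (fromℤ-neg j))) ⟩
        S y (suc j) ∎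
        where open ≈-Reasoning

    module _ {x : D.ℝ} (0<x : D.0ℝ D.< x) (x<1 : x D.< D.1ℝ) where
      private
        e-pos : ∀ k → Pos (e (toR x) (toR (D.fromℤ k)))
        e-pos (+ zero)   = pos-mono (from (e-cong (toR-fromℤ (+ 0)))) (e-pos-0 (<⇒pos 0<x) (<1⇒pos x<1))
        e-pos (+ suc k)  = pos-mono (from (e-cong (toR-fromℤ (+ suc k)))) (e-pos-+ (<⇒pos 0<x) (<1⇒pos x<1) k)
        e-pos (-[1+ k ]) = pos-mono (from (e-cong (fromℤ-neg k))) (e-pos-- (<⇒pos 0<x) (<1⇒pos x<1) k)

      term#0 : ∀ k → x D.^ suc m D.+ D.fromℤ k D.^ suc m D.# D.0ℝ
      term#0 k = square⇒#0 (toR-term x k) (e-pos k)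

      factor#0 : ∀ i → D.factor (suc m) {{n≢0}} x i D.# D.0ℝ
      factor#0 i = pos⇒#0 (toR-factor x i) (F-pos (<⇒pos 0<x) (<1⇒pos x<1) (toℕ i))

      module _ {y : D.ℝ} (0<y : D.0ℝ D.< y) (y<1 : y D.< D.1ℝ) where
        converges : D.∏ℤ (λ k → ((y D.^ suc m D.+ D.fromℤ k D.^ suc m) D./ (x D.^ suc m D.+ D.fromℤ k D.^ suc m)
          ∵ term#0 k) D.^ 2)
                    ≐ D.∏ (λ i → D.factor (suc m) {{n≢0}} y i D./ D.factor (suc m) {{n≢0}} x i ∵ factor#0 i)
        converges = lim⇒∏ℤ
          (λ k → ((y D.^ suc m D.+ D.fromℤ k D.^ suc m) D./ (x D.^ suc m D.+ D.fromℤ k D.^ suc m) ∵ term#0 k)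
            D.^ 2)
          (D.∏ (λ i → D.factor (suc m) {{n≢0}} y i D./ D.factor (suc m) {{n≢0}} x i ∵ factor#0 i))
          -- `limit` speaks of `p ∘ suc`; restoring the first partial product leaves the limit
          -- unchanged.
          (lim-unshift (limit (<⇒pos 0<x) (<1⇒pos x<1) (<⇒pos 0<y) (<1⇒pos y<1)
          (toR (D.∏ (λ i → D.factor (suc m) {{n≢0}} y i D./ D.factor (suc m) {{n≢0}} x i ∵ factor#0 i)))
          (λ j → toR (D.∏± j (λ k → ((y D.^ suc m D.+ D.fromℤ k D.^ suc m) D./
            (x D.^ suc m D.+ D.fromℤ k D.^ suc m) ∵ term#0 k) D.^ 2)))
          (toR-∏ (suc m) (λ i → F (α (toR x) i) (β (toR x) i)) (λ i → F (α (toR y) i) (β (toR y) i))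
            (λ i → D.factor (suc m) {{n≢0}} y i D./ D.factor (suc m) {{n≢0}} x i ∵ factor#0 i)
            (λ i → trans (*-cong refl (sym (toR-factor x i)))
              (trans (quotient-* (D.factor (suc m) {{n≢0}} y i) (D.factor (suc m) {{n≢0}} x i) (factor#0 i))
                (toR-factor y i))))
          (toR-∏± (toR x) (toR y) (λ k → ((y D.^ suc m D.+ D.fromℤ k D.^ suc m) D./
            (x D.^ suc m D.+ D.fromℤ k D.^ suc m) ∵ term#0 k) D.^ 2)
            (λ k → trans (*-cong refl (*-cong (sym (toR-term x k)) (sym (toR-term x k))))
              (trans (quotient²-* (y D.^ suc m D.+ D.fromℤ k D.^ suc m) (x D.^ suc m D.+ D.fromℤ k D.^ suc m)
                (term#0 k))
                (*-cong (toR-term y k) (toR-term y k)))))))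

open import Defs
open import Data.Fin using (Fin)

corollary2p5 : (n : ℕ) .{{_ : NonZero n}} (x y : ℝ) →
    0ℝ < x → x < 1ℝ → 0ℝ < y → y < 1ℝ → x ≤ y →
    Σ[ den₁#0 ∈ ((k : ℤ) → x ^ n + fromℤ k ^ n # 0ℝ) ]
    Σ[ den₂#0 ∈ ((i : Fin n) → factor n x i # 0ℝ) ]
    (∏ℤ (λ k → ((y ^ n + fromℤ k ^ n) / (x ^ n + fromℤ k ^ n) ∵ den₁#0 k) ^ 2)
    ≐ ∏ (λ i → factor n y i / factor n x i ∵ den₂#0 i))
corollary2p5 zero {{n≢0}} x y _ _ _ _ _ = contradiction ≡-refl (ℕ.≢-nonZero⁻¹ 0 {{n≢0}})
corollary2p5 (suc m) {{n≢0}} x y 0<x x<1 0<y y<1 _ =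
  term#0 {x} 0<x x<1 , factor#0 {x} 0<x x<1 , converges {x} 0<x x<1 {y} 0<y y<1
  where open Transfer.Main m n≢0 using (term#0; factor#0; converges)
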